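{- For every $\varepsilon>0$ there exists $\Delta_0=\Delta_0(\varepsilon)$ such that every simple graph $G$ with maximum degree $\Delta\ge \Delta_0$ satisfies $\Delta\le \chi'_{DP}(G)\le (1+\varepsilon)\Delta$. Equivalently, for every simple graph $G$ with maximum degree $\Delta$, $\chi'_{DP}(G)=\Delta+o(\Delta)$, where $o(\Delta)$ denotes a quantity $g(\Delta)$, depending only on $\Delta$, with $g(\Delta)/\Delta\to 0$ as $\Delta\to\infty$.
   Context: Let $G$ be a simple graph and $\mathcal{Q}=\{1,\dots,q\}$ a set of colours. Two distinct edges are incident (written $e\sim f$) if they share a vertex. An edge correspondence assigns to each ordered pair of incident edges $(e,f)$ a partial matching $M_{e,f}\subseteq \mathcal{Q}\times\mathcal{Q}$, i.e. a set of pairs in which each colour appears as first coordinate of at most one pair and as second coordinate of at most one pair, with $M_{f,e}$ consisting of the reversals of the pairs of $M_{e,f}$. An edge correspondence colouring is a map $\sigma:E(G)\to\mathcal{Q}$ such that for all incident edges $e,f$, $(\sigma(e),\sigma(f))\notin M_{e,f}$. The edge correspondence number $\chi'_{DP}(G)$ is the minimum $q$ such that for every edge correspondence on $G$ with colour set $\{1,\dots,q\}$ an edge correspondence colouring exists. -}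

module Defs where

open import Data.Bool using (Bool; true; false; if_then_else_)
open import Data.Nat using (ℕ; _<_; _⊔_)
open import Data.Fin using (Fin; toℕ)
open import Data.List using (List; map; foldr; allFin)
open import Data.Nat.ListAction using (sum)
open import Data.Product using (Σ; _×_)
open import Data.Sum using (_⊎_)
open import Relation.Binary.PropositionalEquality using (_≡_)
open import Relation.Nullary using (¬_)

record Graph : Set where
  field
    n     : ℕ
    adj   : Fin n → Fin n → Bool
    sym   : ∀ u v → adj u v ≡ adj v u
    irrefl : ∀ v → adj v v ≡ false
open Graph public

degree : (G : Graph) → Fin (n G) → ℕ
degree G v = sum (map (λ u → if adj G v u then 1 else 0) (allFin (n G)))

maxDegree : Graph → ℕ
maxDegree G = foldr _⊔_ 0 (map (degree G) (allFin (n G)))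

-- An edge {u,v}, stored canonically with u < v.
record Edge (G : Graph) : Set where
  constructor edge
  field
    lo   : Fin (n G)
    hi   : Fin (n G)
    lo<hi : toℕ lo < toℕ hi
    isAdj : adj G lo hi ≡ true
open Edge public

Incident : {G : Graph} → Edge G → Edge G → Set
Incident e f =
  ¬ (lo e ≡ lo f × hi e ≡ hi f) ×
  (lo e ≡ lo f ⊎ lo e ≡ hi f ⊎ hi e ≡ lo f ⊎ hi e ≡ hi f)

-- An edge correspondence with colour set Fin q: for every pair of edges a
-- relation M e f on colours; for incident pairs it is a partial matching,
-- and M f e is the reversal of M e f. (Values on non-incident pairs are
-- irrelevant.)
record EdgeCorrespondence (G : Graph) (q : ℕ) : Set where
  field
    M : Edge G → Edge G → Fin q → Fin q → Bool
    matchingˡ : ∀ e f → Incident e f → ∀ a b b' →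
                M e f a b ≡ true → M e f a b' ≡ true → b ≡ b'
    matchingʳ : ∀ e f → Incident e f → ∀ a a' b →
                M e f a b ≡ true → M e f a' b ≡ true → a ≡ a'
    reversal : ∀ e f → Incident e f → ∀ a b → M f e b a ≡ M e f a b
open EdgeCorrespondence public

IsCorrespondenceColouring : {G : Graph} {q : ℕ} → EdgeCorrespondence G q →
                            (Edge G → Fin q) → Set
IsCorrespondenceColouring {G} C σ =
  ∀ (e f : Edge G) → Incident e f → ¬ (M C e f (σ e) (σ f) ≡ true)

DPEdgeColourable : Graph → ℕ → Set
DPEdgeColourable G q =
  ∀ (C : EdgeCorrespondence G q) →
    Σ (Edge G → Fin q) (IsCorrespondenceColouring C)

IsEdgeCorrespondenceNumber : Graph → ℕ → Set
IsEdgeCorrespondenceNumber G k =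
  DPEdgeColourable G k × (∀ q → q < k → ¬ DPEdgeColourable G q)

{-# OPTIONS --safe #-}
-- A semi-random ("nibble") argument.  Lists have size ℓ and each colour of each edge has at most d
-- conflicts at either end; initially d / ℓ ≤ 1 / (1 + 1 / (2 h)) < 1.  In a round every edge tentatively
-- picks each of its colours with probability 1 / R, R = m ℓ.  An edge keeps its pick unless it
-- conflicts with the pick of an earlier edge, and every colour in conflict with some pick is deleted.
-- Lists then lose a fraction of about 2 ρ / m, ρ = d / ℓ, while the edges in conflict with a given
-- colour at a vertex v lose a fraction of about (1 + ρ) / m: they get coloured, or the relevant
-- colour is deleted by a pick at their other end.  (Since that deletion must not be too rare, extra
-- coins equalise the deletion rates.)  As ρ < 1, the ratio improves.  Both quantities are
-- concentrated with exponentially small error, so by the local lemma some outcome is good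
-- everywhere, and boundedly many rounds bring d / ℓ below 1 / 32, where a plain application of the
-- local lemma finishes.  Only the deletions at the far end count, and distinct edges at v
-- have distinct far ends; this is where simplicity of the graph enters.
module Submission where

-- Deletions caused at `v` itself are ignored because one pick by an edge at `v` may conflict with
-- many edges at `v`, so a single variable could change the number of survivors a lot. Without them
-- every variable removes at most two targets, and an exponential moment can be carried through the
-- variables one at a time. This is also why conflicts between picks are settled by the order of the
-- items: whether a pick will be kept is known before it is read, so each variable acts on the basis
-- of the past only. Probabilities are counts of outcomes with the powers of `R` cleared, and
-- exponentials are powers of rationals such as `1 + 1 / M`, so Bernoulli's inequality is the only
-- analysis required. The ratio is always `r / B` with `B` fixed, and a round lowers `r` by one at a
-- slightly smaller scale `q`; hence the number of rounds is known before the maximum degree is.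
-- Finally, the edge correspondence number is a minimum. To exhibit it, colourability itself has to
-- be decided, by a finite search.

module EdgeCorrespondences where

  open import Axiom.UniquenessOfIdentityProofs using (module Decidable⇒UIP)
  open import Data.Bool using (Bool; true; false; _∧_; _∨_; not; if_then_else_)
  open import Data.Bool.Properties using (T-≡; ∧-comm; ∨-comm) renaming (_≟_ to _≟B_)
  open import Data.Empty using (⊥; ⊥-elim)
  open import Data.Fin using (Fin; zero; suc; toℕ; fromℕ<; combine; remQuot; _↑ˡ_; _↑ʳ_) renaming (_≤_ to _≤F_)
  open import Data.Fin.Properties using (remQuot-combine; combine-remQuot; ↑ˡ-injective; combine-monoˡ-<; combine-injectiveˡ; toℕ-injective; toℕ-fromℕ<; toℕ<n; nonZeroIndex; any?) renaming (_≟_ to _≟F_; suc-injective to sucF-injective)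
  import Data.Integer as ℤ
  import Data.Integer.Properties as ℤ
  open import Data.List using (foldr; tabulate)
  open import Data.List.Properties using (map-tabulate)
  open import Data.Maybe using (Maybe; just; nothing; is-just) renaming (map to mapMaybe)
  open import Data.Maybe.Properties using (just-injective)
  open import Data.Nat
  open import Data.Nat.DivMod using (m≡m%n+[m/n]*n; m%n<n; m/n*n≤m; /-monoˡ-≤; m*n/n≡m)
  open import Data.Nat.Induction using (<-wellFounded; Acc; acc)
  open import Data.Nat.ListAction using (sum)
  open import Data.Nat.Properties
  open import Algebra.Properties.CommutativeSemigroup *-commutativeSemigroup using (x∙yz≈y∙xz; xy∙z≈xz∙y)
  open import Data.Nat.Tactic.RingSolver using (solve-∀)
  open import Data.Product using (Σ; _×_; _,_; proj₁; proj₂)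
  import Data.Rational as ℚ
  import Data.Rational.Properties as ℚ
  import Data.Rational.Unnormalised as ℚᵘ
  import Data.Rational.Unnormalised.Properties as ℚᵘ
  open import Data.Sum using (_⊎_; inj₁; inj₂; [_,_]′)
  open import Data.Vec using (Vec; []; _∷_; lookup; _[_]≔_; replicate) renaming (tabulate to tabulateV)
  open import Data.Vec.Properties using (lookup∘update; lookup∘update′) renaming (lookup∘tabulate to lookup∘tabulateV)
  open import Function using (_∘_; id)
  open import Function.Bundles using (Equivalence)
  open import Relation.Binary.Definitions using (tri<; tri≈; tri>)
  open import Relation.Binary.PropositionalEquality
  open import Relation.Nullary using (¬_; Dec; yes; no; does; ¬?; _×-dec_; _⊎-dec_; _→-dec_; decidable-stable)

  -- Finite sums and indicators

  opaque
    ∑ : ∀ {n} → (Fin n → ℕ) → ℕ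
    ∑ {zero}  f = 0
    ∑ {suc n} f = f zero + ∑ (f ∘ suc)

    ∑-cong : ∀ {n} {f g : Fin n → ℕ} → (∀ i → f i ≡ g i) → ∑ f ≡ ∑ g
    ∑-cong {zero}  p = refl
    ∑-cong {suc n} p = cong₂ _+_ (p zero) (∑-cong (p ∘ suc))

    ∑-mono : ∀ {n} {f g : Fin n → ℕ} → (∀ i → f i ≤ g i) → ∑ f ≤ ∑ g
    ∑-mono {zero}  p = z≤n
    ∑-mono {suc n} p = +-mono-≤ (p zero) (∑-mono (p ∘ suc))

    ∑-const : ∀ n a → ∑ {n} (λ _ → a) ≡ n * a
    ∑-const zero    a = refl
    ∑-const (suc n) a = cong (a +_) (∑-const n a)

    ∑-zero : ∀ n → ∑ {n} (λ _ → 0) ≡ 0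
    ∑-zero n = trans (∑-const n 0) (*-zeroʳ n)

    interchange-+ : ∀ a b c d → (a + b) + (c + d) ≡ (a + c) + (b + d)
    interchange-+ = solve-∀

    ∑-+ : ∀ {n} (f g : Fin n → ℕ) → ∑ (λ i → f i + g i) ≡ ∑ f + ∑ g
    ∑-+ {zero}  f g = refl
    ∑-+ {suc n} f g = trans (cong (f zero + g zero +_) (∑-+ (f ∘ suc) (g ∘ suc)))
                            (interchange-+ (f zero) (g zero) _ _)

    ∑-*ˡ : ∀ {n} a (f : Fin n → ℕ) → ∑ (λ i → a * f i) ≡ a * ∑ f
    ∑-*ˡ {zero}  a f = sym (*-zeroʳ a)
    ∑-*ˡ {suc n} a f = trans (cong (a * f zero +_) (∑-*ˡ a (f ∘ suc)))
                             (sym (*-distribˡ-+ a (f zero) _))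

    ∑-*ʳ : ∀ {n} (f : Fin n → ℕ) a → ∑ (λ i → f i * a) ≡ ∑ f * a
    ∑-*ʳ {zero}  f a = refl
    ∑-*ʳ {suc n} f a = trans (cong (f zero * a +_) (∑-*ʳ (f ∘ suc) a))
                             (sym (*-distribʳ-+ a (f zero) _))

    ∑-swap : ∀ {m n} (f : Fin m → Fin n → ℕ) →
             ∑ (λ i → ∑ (λ j → f i j)) ≡ ∑ (λ j → ∑ (λ i → f i j))
    ∑-swap {zero}  {n} f = sym (∑-zero n)
    ∑-swap {suc m} f = trans (cong (∑ (f zero) +_) (∑-swap (f ∘ suc)))
                             (sym (∑-+ (f zero) _))

    ∑-≤const : ∀ {n} {f : Fin n → ℕ} a → (∀ i → f i ≤ a) → ∑ f ≤ n * a
    ∑-≤const {n} a p = ≤-trans (∑-mono p) (≤-reflexive (∑-const n a))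

    term≤∑ : ∀ {n} (f : Fin n → ℕ) i → f i ≤ ∑ f
    term≤∑ f zero    = m≤m+n _ _
    term≤∑ f (suc i) = ≤-trans (term≤∑ (f ∘ suc) i) (m≤n+m _ _)

    ∑-↑ : ∀ a b (f : Fin (a + b) → ℕ) → ∑ f ≡ ∑ (λ i → f (i ↑ˡ b)) + ∑ (λ j → f (a ↑ʳ j))
    ∑-↑ zero    b f = refl
    ∑-↑ (suc a) b f = trans (cong (f zero +_) (∑-↑ a b (f ∘ suc))) (sym (+-assoc (f zero) _ _))

    ∑-combine : ∀ m k (f : Fin (m * k) → ℕ) →
                ∑ f ≡ ∑ (λ e → ∑ (λ j → f (combine {m} {k} e j)))
    ∑-combine zero    k f = refl
    ∑-combine (suc m) k f = trans (∑-↑ k (m * k) f)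
      (cong (∑ (λ i → f (i ↑ˡ (m * k))) +_) (∑-combine m k (λ j → f (k ↑ʳ j))))

    ∑-suc : ∀ {n} (f : Fin (suc n) → ℕ) → ∑ f ≡ f zero + ∑ (f ∘ suc)
    ∑-suc f = refl

    ∑-search : ∀ {n} (f : Fin n → ℕ) → 0 < ∑ f → Σ (Fin n) λ i → 0 < f i
    ∑-search {suc n} f p with f zero in eq
    ... | suc _ = zero , subst (0 <_) (sym eq) (s≤s z≤n)
    ... | zero with i , q ← ∑-search (f ∘ suc) p = suc i , q

  ⟦_⟧ : Bool → ℕ
  ⟦ true ⟧  = 1
  ⟦ false ⟧ = 0

  # : ∀ {n} → (Fin n → Bool) → ℕ
  # p = ∑ (λ i → ⟦ p i ⟧)

  ⟦∧⟧ : ∀ a b → ⟦ a ∧ b ⟧ ≡ ⟦ a ⟧ * ⟦ b ⟧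
  ⟦∧⟧ true  b = sym (+-identityʳ ⟦ b ⟧)
  ⟦∧⟧ false b = refl

  ⟦∨⟧≤ : ∀ a b → ⟦ a ∨ b ⟧ ≤ ⟦ a ⟧ + ⟦ b ⟧
  ⟦∨⟧≤ true  b = s≤s z≤n
  ⟦∨⟧≤ false b = ≤-refl

  ⟦not⟧ : ∀ b → ⟦ b ⟧ + ⟦ not b ⟧ ≡ 1
  ⟦not⟧ true  = refl
  ⟦not⟧ false = refl

  ⟦⟧-mono : ∀ {a b} → (a ≡ true → b ≡ true) → ⟦ a ⟧ ≤ ⟦ b ⟧
  ⟦⟧-mono {false} p = z≤n
  ⟦⟧-mono {true} {b} p rewrite p refl = ≤-refl

  ⟦⟧≤ : ∀ {a k} → (a ≡ true → 1 ≤ k) → ⟦ a ⟧ ≤ k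
  ⟦⟧≤ {false} p = z≤n
  ⟦⟧≤ {true}  p = p refl

  true≢false : ∀ {b : Bool} → b ≡ true → b ≡ false → ⊥
  true≢false refl ()

  ¬true⇒false : ∀ {b : Bool} → ¬ (b ≡ true) → b ≡ false
  ¬true⇒false {true}  p = ⊥-elim (p refl)
  ¬true⇒false {false} p = refl

  ≡true⇒1≤ : ∀ {b} → b ≡ true → 1 ≤ ⟦ b ⟧
  ≡true⇒1≤ refl = ≤-refl

  ∧-true : ∀ {a b} → a ≡ true → b ≡ true → a ∧ b ≡ true
  ∧-true refl refl = refl

  ∧-trueˡ : ∀ {a b} → a ∧ b ≡ true → a ≡ true
  ∧-trueˡ {true} p = refl

  ∧-trueʳ : ∀ {a b} → a ∧ b ≡ true → b ≡ true
  ∧-trueʳ {true} p = p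

  ∧-congʳ : ∀ a {b b′} → (a ≡ true → b ≡ b′) → a ∧ b ≡ a ∧ b′
  ∧-congʳ true  p = p refl
  ∧-congʳ false p = refl

  ∨-trueˡ : ∀ {a b} → a ≡ true → a ∨ b ≡ true
  ∨-trueˡ refl = refl

  ∨-trueʳ : ∀ {a b} → b ≡ true → a ∨ b ≡ true
  ∨-trueʳ {true}  refl = refl
  ∨-trueʳ {false} refl = refl

  ∨-elim : ∀ {a b} → a ∨ b ≡ true → a ≡ true ⊎ b ≡ true
  ∨-elim {true}  p = inj₁ refl
  ∨-elim {false} p = inj₂ p

  not-true : ∀ {b} → not b ≡ true → b ≡ false
  not-true {false} p = refl

  false⇒not : ∀ {b} → b ≡ false → not b ≡ true
  false⇒not refl = refl

  infix 5 _==_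
  _==_ : ∀ {n} → Fin n → Fin n → Bool
  i == j = does (i ≟F j)

  ==⇒≡ : ∀ {n} {i j : Fin n} → (i == j) ≡ true → i ≡ j
  ==⇒≡ {i = i} {j} p with i ≟F j
  ... | yes q = q

  ==-refl : ∀ {n} (i : Fin n) → (i == i) ≡ true
  ==-refl i with i ≟F i
  ... | yes _ = refl
  ... | no ¬p = ⊥-elim (¬p refl)

  ==-sym : ∀ {n} (i j : Fin n) → (i == j) ≡ (j == i)
  ==-sym i j with i ≟F j | j ≟F i
  ... | yes p | yes q = refl
  ... | no ¬p | no ¬q = refl
  ... | yes p | no ¬q = ⊥-elim (¬q (sym p))
  ... | no ¬p | yes q = ⊥-elim (¬p (sym q))

  ==-suc : ∀ {n} (i j : Fin n) → (suc i == suc j) ≡ (i == j)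
  ==-suc i j with i ≟F j
  ... | yes refl = refl
  ... | no ¬p    = refl

  opaque
    unfolding ∑
    ∑-δ : ∀ {n} (j : Fin n) (f : Fin n → ℕ) → ∑ (λ i → ⟦ i == j ⟧ * f i) ≡ f j
    ∑-δ {suc n} zero f = trans (cong₂ _+_ (+-identityʳ (f zero)) (∑-zero n)) (+-identityʳ (f zero))
    ∑-δ {suc n} (suc j) f = trans (∑-cong (λ i → cong (λ b → ⟦ b ⟧ * f (suc i)) (==-suc i j)))
                                  (∑-δ j (f ∘ suc))

  ∑-== : ∀ {n} (j : Fin n) → # (λ i → i == j) ≡ 1
  ∑-== {n} j = trans (∑-cong {n} (λ i → sym (*-identityʳ _))) (∑-δ j (λ _ → 1))

  opaque
    unfolding ∑
    ∑-atMostOne : ∀ {n} (p : Fin n → Bool) →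
                  (∀ i j → p i ≡ true → p j ≡ true → i ≡ j) → # (λ i → p i) ≤ 1
    ∑-atMostOne {zero}  p u = z≤n
    ∑-atMostOne {suc n} p u with p zero in eq
    ... | false = ∑-atMostOne (p ∘ suc) (λ i j a b → sucF-injective (u (suc i) (suc j) a b))
    ... | true  = s≤s (≤-reflexive (trans (∑-cong none) (∑-zero n)))
      where
      none : ∀ i → ⟦ p (suc i) ⟧ ≡ 0
      none i with p (suc i) in eq′
      ... | false = refl
      ... | true with () ← u zero (suc i) eq eq′

  opaque
    any : ∀ {n} → (Fin n → Bool) → Bool
    any {zero}  p = false
    any {suc n} p = p zero ∨ any (p ∘ suc)

    any-suc : ∀ {n} (p : Fin (suc n) → Bool) → any p ≡ p zero ∨ any (p ∘ suc)
    any-suc p = refl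

    any-intro : ∀ {n} (p : Fin n → Bool) i → p i ≡ true → any p ≡ true
    any-intro p zero    q = ∨-trueˡ q
    any-intro p (suc i) q = ∨-trueʳ {p zero} (any-intro (p ∘ suc) i q)

    any-elim : ∀ {n} (p : Fin n → Bool) → any p ≡ true → Σ (Fin n) λ i → p i ≡ true
    any-elim {suc n} p q with p zero in eq
    ... | true  = zero , eq
    ... | false with i , r ← any-elim (p ∘ suc) q = suc i , r

  any-none : ∀ {n} (p : Fin n → Bool) → (∀ i → p i ≡ false) → any p ≡ false
  any-none p q = ¬true⇒false (λ r → let i , s = any-elim p r in true≢false s (q i))

  opaque
    unfolding ∑ any
    any-cong : ∀ {n} {p q : Fin n → Bool} → (∀ i → p i ≡ q i) → any p ≡ any q
    any-cong {zero}  e = refl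
    any-cong {suc n} e = cong₂ _∨_ (e zero) (any-cong (e ∘ suc))

    ⟦any⟧≤∑ : ∀ {n} (p : Fin n → Bool) → ⟦ any p ⟧ ≤ # (λ i → p i)
    ⟦any⟧≤∑ {zero}  p = z≤n
    ⟦any⟧≤∑ {suc n} p = ≤-trans (⟦∨⟧≤ (p zero) _) (+-monoʳ-≤ ⟦ p zero ⟧ (⟦any⟧≤∑ (p ∘ suc)))

  -- Double counting through the witness `x`. It bounds the number of events that share a variable
  -- with a given one, and the number of items at distance two.
  ∑-⟦∧⟧-any≤ : ∀ {m n} (P : Fin m → Bool) (Q : Fin m → Fin n → Bool) C →
               (∀ x → # (λ y → Q x y) ≤ C) →
               # (λ y → any (λ x → P x ∧ Q x y)) ≤ # (λ x → P x) * C
  ∑-⟦∧⟧-any≤ P Q C h = begin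
    # (λ y → any (λ x → P x ∧ Q x y)) ≤⟨ ∑-mono (λ y → ⟦any⟧≤∑ (λ x → P x ∧ Q x y)) ⟩
    ∑ (λ y → # (λ x → P x ∧ Q x y)) ≡⟨ ∑-swap (λ y x → ⟦ P x ∧ Q x y ⟧) ⟩
    ∑ (λ x → # (λ y → P x ∧ Q x y)) ≡⟨ ∑-cong (λ x → trans (∑-cong (λ y → ⟦∧⟧ (P x) (Q x y))) (∑-*ˡ ⟦ P x ⟧ (λ y → ⟦ Q x y ⟧))) ⟩
    ∑ (λ x → ⟦ P x ⟧ * # (λ y → Q x y)) ≤⟨ ∑-mono (λ x → *-monoʳ-≤ ⟦ P x ⟧ (h x)) ⟩
    ∑ (λ x → ⟦ P x ⟧ * C) ≡⟨ ∑-*ʳ (λ x → ⟦ P x ⟧) C ⟩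
    # (λ x → P x) * C ∎
    where open ≤-Reasoning

  <ᵇ-true : ∀ {a b} → a < b → (a <ᵇ b) ≡ true
  <ᵇ-true p = Equivalence.to T-≡ (<⇒<ᵇ p)

  <ᵇ-true⁻ : ∀ {a b} → (a <ᵇ b) ≡ true → a < b
  <ᵇ-true⁻ {a} {b} p = <ᵇ⇒< a b (Equivalence.from T-≡ p)

  <ᵇ-false⁻ : ∀ {a b} → (a <ᵇ b) ≡ false → b ≤ a
  <ᵇ-false⁻ p = ≮⇒≥ (λ q → true≢false (<ᵇ-true q) p)

  -- Counting over the product space, and the local lemma

  DependsOn : ∀ {R n} {A : Set} → (Fin n → Bool) → (Vec (Fin R) n → A) → Set
  DependsOn S f = ∀ ω ω′ → (∀ i → S i ≡ true → lookup ω i ≡ lookup ω′ i) → f ω ≡ f ω′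

  opaque
    ∑Ω : ∀ R {n} → (Vec (Fin R) n → ℕ) → ℕ
    ∑Ω R {zero}  f = f []
    ∑Ω R {suc n} f = ∑ {R} (λ x → ∑Ω R (λ ω → f (x ∷ ω)))

  #Ω : ∀ R {n} → (Vec (Fin R) n → Bool) → ℕ
  #Ω R p = ∑Ω R (λ ω → ⟦ p ω ⟧)

  module _ {R : ℕ} where

    opaque
      unfolding ∑Ω
      ∑Ω-cong : ∀ {n} {f g : Vec (Fin R) n → ℕ} → (∀ ω → f ω ≡ g ω) → ∑Ω R f ≡ ∑Ω R g
      ∑Ω-cong {zero}  p = p []
      ∑Ω-cong {suc n} p = ∑-cong (λ x → ∑Ω-cong (λ ω → p (x ∷ ω)))

      ∑Ω-mono : ∀ {n} {f g : Vec (Fin R) n → ℕ} → (∀ ω → f ω ≤ g ω) → ∑Ω R f ≤ ∑Ω R g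
      ∑Ω-mono {zero}  p = p []
      ∑Ω-mono {suc n} p = ∑-mono (λ x → ∑Ω-mono (λ ω → p (x ∷ ω)))

      ∑Ω-+ : ∀ {n} (f g : Vec (Fin R) n → ℕ) → ∑Ω R (λ ω → f ω + g ω) ≡ ∑Ω R f + ∑Ω R g
      ∑Ω-+ {zero}  f g = refl
      ∑Ω-+ {suc n} f g = trans (∑-cong (λ x → ∑Ω-+ (f ∘ (x ∷_)) (g ∘ (x ∷_)))) (∑-+ {R} _ _)

      ∑Ω-*ˡ : ∀ {n} a (f : Vec (Fin R) n → ℕ) → ∑Ω R (λ ω → a * f ω) ≡ a * ∑Ω R f
      ∑Ω-*ˡ {zero}  a f = refl
      ∑Ω-*ˡ {suc n} a f = trans (∑-cong (λ x → ∑Ω-*ˡ a (f ∘ (x ∷_)))) (∑-*ˡ {R} a _)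

      ∑Ω-zero : ∀ n → ∑Ω R {n} (λ _ → 0) ≡ 0
      ∑Ω-zero zero    = refl
      ∑Ω-zero (suc n) = trans (∑-cong (λ x → ∑Ω-zero n)) (∑-zero R)

      ∑Ω-one : ∀ n → ∑Ω R {n} (λ _ → 1) ≡ R ^ n
      ∑Ω-one zero    = refl
      ∑Ω-one (suc n) = trans (∑-cong (λ x → ∑Ω-one n)) (∑-const R (R ^ n))

      ∑Ω-search : ∀ {n} (p : Vec (Fin R) n → Bool) → 0 < #Ω R (λ ω → p ω) →
                  Σ (Vec (Fin R) n) λ ω → p ω ≡ true
      ∑Ω-search {zero} p q with p [] in eq
      ... | true = [] , eq
      ∑Ω-search {suc n} p q with x , r ← ∑-search _ q
                            with ω , s ← ∑Ω-search (p ∘ (x ∷_)) r = x ∷ ω , s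

      ∑Ω-suc : ∀ {n} (f : Vec (Fin R) (suc n) → ℕ) → ∑Ω R f ≡ ∑ (λ x → ∑Ω R (λ ω → f (x ∷ ω)))
      ∑Ω-suc f = refl

      ∑Ω-[] : (f : Vec (Fin R) 0 → ℕ) → ∑Ω R f ≡ f []
      ∑Ω-[] f = refl

    opaque
      unfolding ∑Ω ∑
      ∑Ω-∑ : ∀ {n k} (f : Fin k → Vec (Fin R) n → ℕ) →
             ∑Ω R (λ ω → ∑ (λ j → f j ω)) ≡ ∑ (λ j → ∑Ω R (f j))
      ∑Ω-∑ {n} {zero}  f = ∑Ω-zero n
      ∑Ω-∑ {n} {suc k} f = trans (∑Ω-+ (f zero) _) (cong (∑Ω R (f zero) +_) (∑Ω-∑ (f ∘ suc)))

    DependsOn-∷ : ∀ {n} {A : Set} {S : Fin (suc n) → Bool} {f : Vec (Fin R) (suc n) → A} →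
                  DependsOn S f → ∀ x → DependsOn (S ∘ suc) (f ∘ (x ∷_))
    DependsOn-∷ d x ω ω′ p = d (x ∷ ω) (x ∷ ω′) λ { zero _ → refl ; (suc i) → p i }

  module _ {R : ℕ} (x₀ : Fin R) where

    -- The product rule for functions of disjoint sets of coordinates. Coordinates are peeled off
    -- one by one; if the first belongs to `g`, the two functions change places, so only
    -- `independence-head` computes. The element `x₀` is a value at which to freeze a coordinate
    -- that a function ignores.
    independence : ∀ {n} (S : Fin n → Bool) (f g : Vec (Fin R) n → ℕ) →
                   DependsOn S f → DependsOn (not ∘ S) g →
                   ∑Ω R (λ ω → f ω * g ω) * R ^ n ≡ ∑Ω R f * ∑Ω R g
    independence-head : ∀ {n} (S : Fin (suc n) → Bool) (f g : Vec (Fin R) (suc n) → ℕ) →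
                        DependsOn S f → DependsOn (not ∘ S) g → S zero ≡ true →
                        ∑Ω R (λ ω → f ω * g ω) * R ^ suc n ≡ ∑Ω R f * ∑Ω R g

    independence {zero}  S f g df dg rewrite ∑Ω-[] (λ ω → f ω * g ω) | ∑Ω-[] f | ∑Ω-[] g = *-identityʳ _
    independence {suc n} S f g df dg with S zero in eq
    ... | true  = independence-head S f g df dg eq
    ... | false = begin
      ∑Ω R (λ ω → f ω * g ω) * R ^ suc n ≡⟨ cong (_* R ^ suc n) (∑Ω-cong (λ ω → *-comm (f ω) (g ω))) ⟩
      ∑Ω R (λ ω → g ω * f ω) * R ^ suc n ≡⟨ independence-head (not ∘ S) g f dg df′ (cong not eq) ⟩
      ∑Ω R g * ∑Ω R f ≡⟨ *-comm (∑Ω R g) _ ⟩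
      ∑Ω R f * ∑Ω R g ∎
      where
      open ≡-Reasoning
      not-not : ∀ b → b ≡ true → not (not b) ≡ true
      not-not b refl = refl
      df′ : DependsOn (not ∘ not ∘ S) f
      df′ ω ω′ p = df ω ω′ (λ i q → p i (not-not (S i) q))

    independence-head {n} S f g df dg s0 = begin
      ∑Ω R (λ ω → f ω * g ω) * (R * R ^ n)
        ≡⟨ cong (_* (R * R ^ n)) (∑Ω-suc (λ ω → f ω * g ω)) ⟩
      ∑ (λ x → ∑Ω R (λ ω → f (x ∷ ω) * g (x ∷ ω))) * (R * R ^ n)
        ≡⟨ ∑-*ʳ (λ x → ∑Ω R (λ ω → f (x ∷ ω) * g (x ∷ ω))) _ ⟨
      ∑ (λ x → ∑Ω R (λ ω → f (x ∷ ω) * g (x ∷ ω)) * (R * R ^ n))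
        ≡⟨ ∑-cong per-x ⟩
      ∑ (λ x → ∑Ω R (f ∘ (x ∷_)) * (R * G))
        ≡⟨ ∑-*ʳ (λ x → ∑Ω R (f ∘ (x ∷_))) (R * G) ⟩
      ∑ (λ x → ∑Ω R (f ∘ (x ∷_))) * (R * G)
        ≡⟨ cong₂ _*_ (sym (∑Ω-suc f)) (trans (sym (∑-const R G)) (trans (∑-cong (λ x → ∑Ω-cong (λ ω → g-const x₀ x ω))) (sym (∑Ω-suc g)))) ⟩
      ∑Ω R f * ∑Ω R g ∎
      where
      open ≡-Reasoning
      G = ∑Ω R (λ ω → g (x₀ ∷ ω))
      g-const : ∀ x y ω → g (x ∷ ω) ≡ g (y ∷ ω)
      g-const x y ω = dg _ _ λ { zero q → ⊥-elim (true≢false s0 (not-true q)) ; (suc i) _ → refl }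
      per-x : ∀ x → ∑Ω R (λ ω → f (x ∷ ω) * g (x ∷ ω)) * (R * R ^ n) ≡ ∑Ω R (f ∘ (x ∷_)) * (R * G)
      per-x x = begin
        ∑Ω R (λ ω → f (x ∷ ω) * g (x ∷ ω)) * (R * R ^ n)
          ≡⟨ cong (_* (R * R ^ n)) (∑Ω-cong (λ ω → cong (f (x ∷ ω) *_) (g-const x x₀ ω))) ⟩
        ∑Ω R (λ ω → f (x ∷ ω) * g (x₀ ∷ ω)) * (R * R ^ n)
          ≡⟨ x∙yz≈y∙xz (∑Ω R (λ ω → f (x ∷ ω) * g (x₀ ∷ ω))) R (R ^ n) ⟩
        R * (∑Ω R (λ ω → f (x ∷ ω) * g (x₀ ∷ ω)) * R ^ n)
          ≡⟨ cong (R *_) (independence (S ∘ suc) (f ∘ (x ∷_)) (g ∘ (x₀ ∷_)) (DependsOn-∷ df x) (DependsOn-∷ {S = not ∘ S} dg x₀)) ⟩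
        R * (∑Ω R (f ∘ (x ∷_)) * G)
          ≡⟨ x∙yz≈y∙xz R (∑Ω R (f ∘ (x ∷_))) G ⟩
        ∑Ω R (f ∘ (x ∷_)) * (R * G) ∎

    module LocalLemma {n J : ℕ}
      (B     : Fin J → Vec (Fin R) n → Bool)
      (near  : Fin J → Fin n → Bool)
      (B-dep : ∀ e → DependsOn (near e) (B e))
      (V C q : ℕ)
      (near≤V : ∀ e → # (λ i → near e i) ≤ V)
      (near≤C : ∀ i → # (λ e → near e i) ≤ C)
      (prob  : ∀ e → #Ω R (λ ω → B e ω) * q ≤ R ^ n)
      (4VC≤q : 4 * (V * C) ≤ q) (2<q : 2 < q) where

      adj : Fin J → Fin J → Bool
      adj e f = any (λ i → near e i ∧ near f i)

      far : ∀ e f → adj e f ≡ false → ∀ i → near e i ≡ true → near f i ≡ false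
      far e f p i q = ¬true⇒false λ r → true≢false (any-intro (λ i → near e i ∧ near f i) i (∧-true q r)) p

      deg : ∀ e → # (λ f → adj e f) ≤ V * C
      deg e = ≤-trans (∑-⟦∧⟧-any≤ (near e) (λ i f → near f i) C near≤C) (*-monoˡ-≤ C (near≤V e))

      bad : (Fin J → Bool) → Vec (Fin R) n → Bool
      bad T ω = any (λ f → T f ∧ B f ω)

      good : (Fin J → Bool) → Vec (Fin R) n → ℕ
      good T ω = ⟦ not (bad T ω) ⟧

      #good : (Fin J → Bool) → ℕ
      #good T = ∑Ω R (good T)

      #bad&good : Fin J → (Fin J → Bool) → ℕ
      #bad&good e T = ∑Ω R (λ ω → ⟦ B e ω ⟧ * good T ω)

      Adj Far : Fin J → (Fin J → Bool) → Fin J → Bool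
      Adj e T f = T f ∧ adj e f
      Far e T f = T f ∧ not (adj e f)

      good-Far≥ : ∀ e T ω → good T ω ≤ good (Far e T) ω
      good-Far≥ e T ω = ⟦⟧-mono λ p → false⇒not (any-none _ λ f →
        ¬true⇒false λ q → true≢false
          (any-intro _ f (∧-true (∧-trueˡ {T f} (∧-trueˡ {T f ∧ _} q)) (∧-trueʳ {T f ∧ _} q))) (not-true p))

      good-split : ∀ e T ω →
        good (Far e T) ω ≤ good T ω + ∑ (λ f → ⟦ Adj e T f ⟧ * (⟦ B f ω ⟧ * good (Far e T) ω))
      good-split e T ω with bad (Far e T) ω in eqF
      ... | true  = z≤n
      ... | false with bad T ω in eqT
      ...   | false = s≤s z≤n
      ...   | true with f , p ← any-elim _ eqT =
        ≤-trans (≤-reflexive (sym term≡1)) (term≤∑ (λ f → ⟦ Adj e T f ⟧ * (⟦ B f ω ⟧ * 1)) f)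
        where
        Tf : T f ≡ true
        Tf = ∧-trueˡ p
        Bf : B f ω ≡ true
        Bf = ∧-trueʳ {T f} p
        adj-f : adj e f ≡ true
        adj-f with adj e f in eqa
        ... | true  = refl
        ... | false = ⊥-elim (true≢false (any-intro (λ f → Far e T f ∧ B f ω) f
                        (∧-true (∧-true Tf (cong not eqa)) Bf)) eqF)
        term≡1 : ⟦ Adj e T f ⟧ * (⟦ B f ω ⟧ * 1) ≡ 1
        term≡1 rewrite Tf | Bf | adj-f = refl

      size : (Fin J → Bool) → ℕ
      size T = # (λ f → T f)

      size-split : ∀ e T → size (Adj e T) + size (Far e T) ≡ size T
      size-split e T = trans (sym (∑-+ _ _)) (∑-cong λ f → split (T f) (adj e f))
        where
        split : ∀ a b → ⟦ a ∧ b ⟧ + ⟦ a ∧ not b ⟧ ≡ ⟦ a ⟧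
        split true  b = ⟦not⟧ b
        split false b = refl

      R^n>0 : NonZero (R ^ n)
      R^n>0 = m^n≢0 R n {{nonZeroIndex x₀}}

      -- Replacing `T` by `Far e T` only enlarges the left side; after that the two factors read
      -- disjoint sets of variables and `independence` applies.
      far-bound : ∀ e T → #bad&good e T * q ≤ #good (Far e T)
      far-bound e T = *-cancelʳ-≤ _ _ (R ^ n) {{R^n>0}} (begin
        #bad&good e T * q * R ^ n ≤⟨ *-monoˡ-≤ (R ^ n) (*-monoˡ-≤ q (∑Ω-mono (λ ω → *-monoʳ-≤ ⟦ B e ω ⟧ (good-Far≥ e T ω)))) ⟩
        #bad&good e (Far e T) * q * R ^ n ≡⟨ xy∙z≈xz∙y (#bad&good e (Far e T)) q (R ^ n) ⟩
        #bad&good e (Far e T) * R ^ n * q ≡⟨ cong (_* q) (independence (near e) (λ ω → ⟦ B e ω ⟧) (good (Far e T)) (λ ω ω′ p → cong ⟦_⟧ (B-dep e ω ω′ p)) dep) ⟩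
        #Ω R (λ ω → B e ω) * #good (Far e T) * q ≡⟨ xy∙z≈xz∙y (#Ω R (λ ω → B e ω)) (#good (Far e T)) q ⟩
        #Ω R (λ ω → B e ω) * q * #good (Far e T) ≤⟨ *-monoˡ-≤ (#good (Far e T)) (prob e) ⟩
        R ^ n * #good (Far e T) ≡⟨ *-comm (R ^ n) _ ⟩
        #good (Far e T) * R ^ n ∎)
        where
        open ≤-Reasoning
        dep : DependsOn (not ∘ near e) (good (Far e T))
        dep ω ω′ p = cong (⟦_⟧ ∘ not) (any-cong eq)
          where
          eq : ∀ f → Far e T f ∧ B f ω ≡ Far e T f ∧ B f ω′
          eq f with T f
          ... | false = refl
          ... | true with adj e f in eqa
          ...   | true  = refl
          ...   | false = B-dep f ω ω′ (λ i nf → p i (cong not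
                            (¬true⇒false (λ ne → true≢false nf (far e f eqa i ne)))))

      -- Given that all events of `T` are avoided, `B e` has probability at most `2 / q`. Relative
      -- to the events of `T` sharing no variable with `e` it has at most `1 / q`. The others number
      -- at most `q / 4`, and by induction each takes at most `2 / q` of the outcomes counted by
      -- `g′`; together they take at most half, so the extra conditioning costs a factor of at most
      -- 2.
      conditional : ∀ k T → size T ≤ k → ∀ e → #bad&good e T * q ≤ 2 * #good T
      conditional k T s≤k e with size (Adj e T) in eqs
      ... | zero = ≤-trans (far-bound e T) (≤-trans (∑Ω-mono no-adj) (m≤m+n _ _))
        where
        no-adj : ∀ ω → good (Far e T) ω ≤ good T ω
        no-adj ω = ⟦⟧-mono λ p → false⇒not (any-none _ λ f → ¬true⇒false λ q → true≢false
          (any-intro (λ f → Far e T f ∧ B f ω) f (∧-true (∧-true (∧-trueˡ q) (false⇒not (¬true⇒false λ a →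
             1+n≰n (≤-trans (≤-trans (≡true⇒1≤ (∧-true (∧-trueˡ {T f} q) a)) (term≤∑ (λ f → ⟦ Adj e T f ⟧) f)) (≤-reflexive eqs)))))
             (∧-trueʳ {T f} q))) (not-true p))
      conditional zero T s≤k e | suc a =
        ⊥-elim (1+n≰n (≤-trans (≤-trans (s≤s z≤n) (≤-trans (≤-reflexive (sym eqs)) (≤-trans (m≤m+n _ _) (≤-reflexive (size-split e T))))) s≤k))
      conditional (suc k) T s≤k e | suc a = *-cancelˡ-≤ q {{>-nonZero (≤-trans (s≤s z≤n) 2<q)}} (begin
        q * (#bad&good e T * q) ≤⟨ *-monoʳ-≤ q (far-bound e T) ⟩
        q * g′ ≤⟨ half ⟩
        q * (2 * #good T) ∎)
        where
        open ≤-Reasoning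
        F = Far e T
        g′ = #good F
        s = size (Adj e T)
        size-F : size F ≤ k
        size-F = +-cancelˡ-≤ 1 _ _ (≤-trans (+-monoˡ-≤ (size F) (≤-trans (s≤s z≤n) (≤-reflexive (sym eqs))))
                   (≤-trans (≤-reflexive (size-split e T)) s≤k))
        s≤VC : s ≤ V * C
        s≤VC = ≤-trans (∑-mono (λ f → ⟦⟧-mono (∧-trueʳ {T f}))) (deg e)
        split-total : g′ ≤ #good T + ∑ (λ f → ⟦ Adj e T f ⟧ * #bad&good f F)
        split-total = begin
          g′ ≤⟨ ∑Ω-mono (good-split e T) ⟩
          ∑Ω R (λ ω → good T ω + ∑ (λ f → ⟦ Adj e T f ⟧ * (⟦ B f ω ⟧ * good F ω)))
            ≡⟨ ∑Ω-+ (good T) _ ⟩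
          #good T + ∑Ω R (λ ω → ∑ (λ f → ⟦ Adj e T f ⟧ * (⟦ B f ω ⟧ * good F ω)))
            ≡⟨ cong (#good T +_) (trans (∑Ω-∑ (λ f ω → ⟦ Adj e T f ⟧ * (⟦ B f ω ⟧ * good F ω))) (∑-cong (λ f → ∑Ω-*ˡ ⟦ Adj e T f ⟧ _))) ⟩
          #good T + ∑ (λ f → ⟦ Adj e T f ⟧ * #bad&good f F) ∎
        loss : q * ∑ (λ f → ⟦ Adj e T f ⟧ * #bad&good f F) ≤ s * (2 * g′)
        loss = begin
          q * ∑ (λ f → ⟦ Adj e T f ⟧ * #bad&good f F) ≡⟨ ∑-*ˡ q _ ⟨
          ∑ (λ f → q * (⟦ Adj e T f ⟧ * #bad&good f F)) ≡⟨ ∑-cong (λ f → pull q ⟦ Adj e T f ⟧ (#bad&good f F)) ⟩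
          ∑ (λ f → ⟦ Adj e T f ⟧ * (#bad&good f F * q)) ≤⟨ ∑-mono (λ f → *-monoʳ-≤ ⟦ Adj e T f ⟧ (conditional k F size-F f)) ⟩
          ∑ (λ f → ⟦ Adj e T f ⟧ * (2 * g′)) ≡⟨ ∑-*ʳ (λ f → ⟦ Adj e T f ⟧) (2 * g′) ⟩
          s * (2 * g′) ∎
          where
          pull : ∀ a b c → a * (b * c) ≡ b * (c * a)
          pull = solve-∀
        half : q * g′ ≤ q * (2 * #good T)
        half = +-cancelˡ-≤ (q * g′) _ _ (begin
          q * g′ + q * g′ ≡⟨ double q g′ ⟩
          2 * (q * g′) ≤⟨ *-monoʳ-≤ 2 (*-monoʳ-≤ q split-total) ⟩
          2 * (q * (#good T + ∑ (λ f → ⟦ Adj e T f ⟧ * #bad&good f F)))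
                            ≡⟨ expand q (#good T) _ ⟩
          q * (2 * #good T) + 2 * (q * ∑ (λ f → ⟦ Adj e T f ⟧ * #bad&good f F))
                            ≤⟨ +-monoʳ-≤ (q * (2 * #good T)) (*-monoʳ-≤ 2 loss) ⟩
          q * (2 * #good T) + 2 * (s * (2 * g′)) ≡⟨ regroup (q * (2 * #good T)) s g′ ⟩
          4 * s * g′ + q * (2 * #good T) ≤⟨ +-monoˡ-≤ (q * (2 * #good T)) (*-monoˡ-≤ g′ (≤-trans (*-monoʳ-≤ 4 s≤VC) 4VC≤q)) ⟩
          q * g′ + q * (2 * #good T) ∎)
          where
          double : ∀ a b → a * b + a * b ≡ 2 * (a * b)
          double = solve-∀
          expand : ∀ a b c → 2 * (a * (b + c)) ≡ a * (2 * b) + 2 * (a * c)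
          expand = solve-∀
          regroup : ∀ a s g → a + 2 * (s * (2 * g)) ≡ 4 * s * g + a
          regroup = solve-∀

      below : ℕ → Fin J → Bool
      below k f = toℕ f <ᵇ k

      #good-below>0 : ∀ k → 0 < #good (below k)
      #good-below>0 zero = subst (0 <_) (sym (trans (∑Ω-cong all-good) (∑Ω-one n))) (>-nonZero⁻¹ _ {{R^n>0}})
        where
        all-good : ∀ ω → good (below 0) ω ≡ 1
        all-good ω = cong (⟦_⟧ ∘ not) (any-none _ (λ f → refl))
      #good-below>0 (suc k) = step (#good-below>0 k)
        where
        step : 0 < #good (below k) → 0 < #good (below (suc k))
        step pos with k <? J
        ... | no k≮J = ≤-trans pos (∑Ω-mono (λ ω → ⟦⟧-mono λ p → false⇒not (any-none _ λ f → ¬true⇒false λ q →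
                true≢false (any-intro (λ f → below k f ∧ B f ω) f
                  (∧-true (<ᵇ-true (≤-trans (toℕ<n f) (≮⇒≥ k≮J))) (∧-trueʳ {below (suc k) f} q))) (not-true p))))
        ... | yes k<J = n≢0⇒n>0 λ z → 1+n≰n (≤-trans 2<q (*-cancelˡ-≤ g {{>-nonZero pos}} (begin
                g * q ≤⟨ *-monoˡ-≤ q (∑Ω-mono covered) ⟩
                ∑Ω R (λ ω → good (below (suc k)) ω + ⟦ B e ω ⟧ * good (below k) ω) * q
                                            ≡⟨ cong (_* q) (∑Ω-+ (good (below (suc k))) _) ⟩
                (#good (below (suc k)) + #bad&good e (below k)) * q ≡⟨ cong (λ t → (t + #bad&good e (below k)) * q) z ⟩
                #bad&good e (below k) * q ≤⟨ conditional (size (below k)) (below k) ≤-refl e ⟩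
                2 * g ≡⟨ *-comm 2 g ⟩
                g * 2 ∎)))
          where
          open ≤-Reasoning
          e = fromℕ< k<J
          g = #good (below k)
          covered : ∀ ω → good (below k) ω ≤ good (below (suc k)) ω + ⟦ B e ω ⟧ * good (below k) ω
          covered ω with bad (below k) ω in eqk
          ... | true = z≤n
          ... | false with B e ω in eqe
          ...   | true  = m≤n+m 1 _
          ...   | false = ≤-trans (≡true⇒1≤ (false⇒not (any-none _ λ f → ¬true⇒false λ q →
                     [ (λ fk → true≢false (any-intro (λ f → below k f ∧ B f ω) f (∧-true (<ᵇ-true fk) (∧-trueʳ {below (suc k) f} q))) eqk)
                     , (λ fk → true≢false (∧-trueʳ {below (suc k) f} q)
                          (trans (cong (λ f → B f ω) (toℕ-injective (trans fk (sym (toℕ-fromℕ< k<J))))) eqe)) ]′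
                     (m≤n⇒m<n∨m≡n (≤-pred (<ᵇ-true⁻ (∧-trueˡ {below (suc k) f} q))))))) (m≤m+n _ _)

      avoid : Σ (Vec (Fin R) n) λ ω → ∀ e → B e ω ≡ false
      avoid with ω , p ← ∑Ω-search (λ ω → not (bad (below J) ω)) (#good-below>0 J) =
        ω , λ e → ¬true⇒false λ q → true≢false
          (any-intro (λ f → below J f ∧ B f ω) e (∧-true (<ᵇ-true (toℕ<n e)) q)) (not-true p)

  -- Bernoulli-type inequalities

  -- Bernoulli's inequality `1 + a / N ≤ (1 + 1 / N) ^ a` without denominators.
  bernoulli⁺ : ∀ N a → (N + a) * N ^ a ≤ N * suc N ^ a
  bernoulli⁺ N zero = ≤-reflexive (cong (_* 1) (+-identityʳ N))
  bernoulli⁺ N (suc a) = begin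
    (N + suc a) * (N * N ^ a) ≤⟨ m≤m+n _ (a * N ^ a) ⟩
    (N + suc a) * (N * N ^ a) + a * N ^ a ≡⟨ regroup N a (N ^ a) ⟩
    suc N * ((N + a) * N ^ a) ≤⟨ *-monoʳ-≤ (suc N) (bernoulli⁺ N a) ⟩
    suc N * (N * suc N ^ a) ≡⟨ x∙yz≈y∙xz (suc N) N (suc N ^ a) ⟩
    N * (suc N * suc N ^ a) ∎
    where
    open ≤-Reasoning
    regroup : ∀ N a p → (N + (1 + a)) * (N * p) + a * p ≡ (1 + N) * ((N + a) * p)
    regroup = solve-∀

  -- The companion `1 - a / (N + 1) ≤ (1 - 1 / (N + 1)) ^ a`; `b` stands for `N + 1 - a`, which
  -- keeps truncated subtraction out of the induction.
  bernoulli⁻ : ∀ N a b → b + a ≡ suc N → b * suc N ^ a ≤ suc N * N ^ a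
  bernoulli⁻ N zero b p = ≤-reflexive (cong (_* 1) (trans (sym (+-identityʳ b)) p))
  bernoulli⁻ N (suc a) b p = begin
    b * (suc N * suc N ^ a) ≡⟨ *-assoc b (suc N) _ ⟨
    (b * suc N) * suc N ^ a ≤⟨ *-monoˡ-≤ (suc N ^ a) b[1+N]≤ ⟩
    (N * suc b) * suc N ^ a ≡⟨ *-assoc N (suc b) _ ⟩
    N * (suc b * suc N ^ a) ≤⟨ *-monoʳ-≤ N (bernoulli⁻ N a (suc b) (trans (sym (+-suc b a)) p)) ⟩
    N * (suc N * N ^ a) ≡⟨ x∙yz≈y∙xz N (suc N) (N ^ a) ⟩
    suc N * (N * N ^ a) ∎
    where
    open ≤-Reasoning
    b≤N : b ≤ N
    b≤N = ≤-trans (m≤m+n b a) (≤-reflexive (suc-injective (trans (sym (+-suc b a)) p)))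
    b[1+N]≤ : b * suc N ≤ N * suc b
    b[1+N]≤ = begin
      b * suc N ≡⟨ *-suc b N ⟩
      b + b * N ≤⟨ +-mono-≤ b≤N (≤-reflexive (*-comm b N)) ⟩
      N + N * b ≡⟨ *-suc N b ⟨
      N * suc b ∎

  ^-distrib-* : ∀ a b x → (a * b) ^ x ≡ a ^ x * b ^ x
  ^-distrib-* a b zero    = refl
  ^-distrib-* a b (suc x) = trans (cong (a * b *_) (^-distrib-* a b x)) (mix a b (a ^ x) (b ^ x))
    where
    mix : ∀ a b c d → (a * b) * (c * d) ≡ (a * c) * (b * d)
    mix = solve-∀

  -- By Bernoulli `(1 + 1 / N) ^ N` is at least 2. In both tail bounds this turns a surplus of
  -- `N * k` in the exponent into the saving `2 ^ k`.
  two-pow : ∀ N k E .{{_ : NonZero N}} → N * k ≤ E → 2 ^ k * N ^ E ≤ suc N ^ E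
  two-pow N k E le = begin
    2 ^ k * N ^ E ≡⟨ cong (2 ^ k *_) (trans (cong (N ^_) (sym eqE)) (^-distribˡ-+-* N (N * k) _)) ⟩
    2 ^ k * (N ^ (N * k) * N ^ e) ≡⟨ *-assoc (2 ^ k) _ _ ⟨
    2 ^ k * N ^ (N * k) * N ^ e ≡⟨ cong (λ t → 2 ^ k * t * N ^ e) (sym (^-*-assoc N N k)) ⟩
    2 ^ k * (N ^ N) ^ k * N ^ e ≡⟨ cong (_* N ^ e) (^-distrib-* 2 (N ^ N) k) ⟨
    (2 * N ^ N) ^ k * N ^ e ≤⟨ *-mono-≤ (^-monoˡ-≤ k doubling) (^-monoˡ-≤ e (n≤1+n N)) ⟩
    (suc N ^ N) ^ k * suc N ^ e ≡⟨ cong (_* suc N ^ e) (^-*-assoc (suc N) N k) ⟩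
    suc N ^ (N * k) * suc N ^ e ≡⟨ ^-distribˡ-+-* (suc N) (N * k) e ⟨
    suc N ^ (N * k + e) ≡⟨ cong (suc N ^_) eqE ⟩
    suc N ^ E ∎
    where
    open ≤-Reasoning
    e = E ∸ N * k
    eqE : N * k + e ≡ E
    eqE = m+[n∸m]≡n le
    doubling : 2 * N ^ N ≤ suc N ^ N
    doubling = *-cancelˡ-≤ N (begin
      N * (2 * N ^ N) ≡⟨ reg N (N ^ N) ⟩
      (N + N) * N ^ N ≤⟨ bernoulli⁺ N N ⟩
      N * suc N ^ N ∎)
      where
      reg : ∀ a b → a * (2 * b) ≡ (a + a) * b
      reg = solve-∀

  -- The last step of both tail bounds, in the manner of Markov: `C / A` bounds the probability, and
  -- it is at most `2 ^ - k`.
  cancel-weight : ∀ {S r A C k} .{{_ : NonZero A}} → S * A ≤ r * C → C * 2 ^ k ≤ A → S * 2 ^ k ≤ r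
  cancel-weight {S} {r} {A} {C} {k} p q = *-cancelʳ-≤ _ _ A (begin
    S * 2 ^ k * A ≡⟨ xy∙z≈xz∙y S (2 ^ k) A ⟩
    S * A * 2 ^ k ≤⟨ *-monoˡ-≤ (2 ^ k) p ⟩
    r * C * 2 ^ k ≡⟨ *-assoc r C _ ⟩
    r * (C * 2 ^ k) ≤⟨ *-monoʳ-≤ r q ⟩
    r * A ∎)
    where open ≤-Reasoning

  -- Exponential-moment tail bounds

  module UpperTail (R M : ℕ) {{_ : NonZero M}} where

    private
      N = M * R

    -- In fractions, `P` has probability at most `(1 + 1 / N) ^ K / (1 + 1 / M) ^ x`. A variable
    -- with `n₀` contributing values has the mean weight `1 + n₀ / N`, which is at most
    -- `(1 + 1 / N) ^ n₀`. The induction carries the event with the threshold still to be reached,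
    -- instead of a moment.
    weight : ∀ {n} (h : Fin n → Fin R → ℕ) → (∀ i x → h i x ≤ 1) →
             ∀ x K → ∑ (λ i → ∑ (h i)) ≤ K →
             (P : Vec (Fin R) n → Bool) →
             (∀ ω → P ω ≡ true → x ≤ ∑ (λ i → h i (lookup ω i))) →
             #Ω R (λ ω → P ω) * (suc M ^ x * N ^ K) ≤ R ^ n * (M ^ x * suc N ^ K)
    weight {zero} h h≤1 x K ΣK P Px = begin
      #Ω R (λ ω → P ω) * (suc M ^ x * N ^ K) ≡⟨ cong (_* (suc M ^ x * N ^ K)) (∑Ω-[] (λ ω → ⟦ P ω ⟧)) ⟩
      ⟦ P [] ⟧ * (suc M ^ x * N ^ K) ≤⟨ base ⟩
      1 * (M ^ x * suc N ^ K) ∎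
      where
      open ≤-Reasoning
      base : ⟦ P [] ⟧ * (suc M ^ x * N ^ K) ≤ 1 * (M ^ x * suc N ^ K)
      base with P [] in eq
      ... | false = z≤n
      ... | true with Px [] eq
      ...   | x≤0 rewrite n≤0⇒n≡0 (≤-trans x≤0 (≤-reflexive (trans (∑-cong {zero} {g = λ _ → 0} λ ()) (∑-zero 0)))) =
        *-monoʳ-≤ 1 (*-monoʳ-≤ 1 (^-monoˡ-≤ K (n≤1+n N)))
    weight {suc n} h h≤1 x K ΣK P Px = *-cancelʳ-≤ _ _ M (begin
      #Ω R (λ ω → P ω) * (suc M ^ x * N ^ K) * M
        ≡⟨ cong₂ (λ s t → s * (suc M ^ x * t) * M) (∑Ω-suc (λ ω → ⟦ P ω ⟧)) (trans (cong (N ^_) (sym K≡)) (^-distribˡ-+-* N n₀ K′)) ⟩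
      ∑ S * (suc M ^ x * (N ^ n₀ * N ^ K′)) * M
        ≡⟨ reg₁ (∑ S) (suc M ^ x) (N ^ n₀) (N ^ K′) M ⟩
      ∑ S * (suc M ^ x * N ^ K′ * M) * N ^ n₀
        ≤⟨ *-monoˡ-≤ (N ^ n₀) sum-bound ⟩
      R ^ n * (M ^ x * suc N ^ K′) * (N + n₀) * N ^ n₀
        ≡⟨ *-assoc (R ^ n * (M ^ x * suc N ^ K′)) (N + n₀) _ ⟩
      R ^ n * (M ^ x * suc N ^ K′) * ((N + n₀) * N ^ n₀)
        ≤⟨ *-monoʳ-≤ (R ^ n * (M ^ x * suc N ^ K′)) (bernoulli⁺ N n₀) ⟩
      R ^ n * (M ^ x * suc N ^ K′) * (M * R * suc N ^ n₀)
        ≡⟨ reg₂ (R ^ n) (M ^ x) (suc N ^ K′) M R (suc N ^ n₀) ⟩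
      R * R ^ n * (M ^ x * (suc N ^ n₀ * suc N ^ K′)) * M
        ≡⟨ cong (λ t → R * R ^ n * (M ^ x * t) * M) (trans (sym (^-distribˡ-+-* (suc N) n₀ K′)) (cong (suc N ^_) K≡)) ⟩
      R * R ^ n * (M ^ x * suc N ^ K) * M ∎)
      where
      open ≤-Reasoning
      n₀ = ∑ (h zero)
      K′ = K ∸ n₀
      Σsuc : n₀ + ∑ (λ i → ∑ (h (suc i))) ≤ K
      Σsuc = ≤-trans (≤-reflexive (sym (∑-suc (λ i → ∑ (h i))))) ΣK
      K≡ : n₀ + K′ ≡ K
      K≡ = m+[n∸m]≡n {n₀} (≤-trans (m≤m+n n₀ _) Σsuc)
      ΣK′ : ∑ (λ i → ∑ (h (suc i))) ≤ K′
      ΣK′ = +-cancelˡ-≤ n₀ _ _ (≤-trans Σsuc (≤-reflexive (sym K≡)))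
      S : Fin R → ℕ
      S y = #Ω R (λ ω → P (y ∷ ω))
      reg₁ : ∀ s a b c m → s * (a * (b * c)) * m ≡ s * (a * c * m) * b
      reg₁ = solve-∀
      reg₂ : ∀ r a b m R c → r * (a * b) * (m * R * c) ≡ R * r * (a * (c * b)) * m
      reg₂ = solve-∀
      per-y : ∀ y → S y * (suc M ^ x * N ^ K′ * M) ≤ R ^ n * (M ^ x * suc N ^ K′) * (M + h zero y)
      per-y y = go (h zero y) refl (h≤1 zero y) x Px
        where
        IH : ∀ x′ → (∀ ω → P (y ∷ ω) ≡ true → x′ ≤ ∑ (λ i → h (suc i) (lookup ω i))) →
             S y * (suc M ^ x′ * N ^ K′) ≤ R ^ n * (M ^ x′ * suc N ^ K′)
        IH x′ = weight (h ∘ suc) (h≤1 ∘ suc) x′ K′ ΣK′ (P ∘ (y ∷_))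
        go : ∀ a → h zero y ≡ a → a ≤ 1 → ∀ x → (∀ ω → P ω ≡ true → x ≤ ∑ (λ i → h i (lookup ω i))) →
             S y * (suc M ^ x * N ^ K′ * M) ≤ R ^ n * (M ^ x * suc N ^ K′) * (M + a)
        -- Once the threshold is zero nothing more has to be contributed, so the value of this
        -- variable need not be recorded.
        go a eq _ zero Px = begin
          S y * (1 * N ^ K′ * M) ≡⟨ *-assoc (S y) (1 * N ^ K′) M ⟨
          S y * (1 * N ^ K′) * M ≤⟨ *-mono-≤ (IH 0 (λ _ _ → z≤n)) (m≤m+n M a) ⟩
          R ^ n * (1 * suc N ^ K′) * (M + a) ∎
        go zero eq _ x@(suc _) Px = begin
          S y * (suc M ^ x * N ^ K′ * M) ≡⟨ *-assoc (S y) (suc M ^ x * N ^ K′) M ⟨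
          S y * (suc M ^ x * N ^ K′) * M ≤⟨ *-mono-≤ (IH x shift) (m≤m+n M 0) ⟩
          R ^ n * (M ^ x * suc N ^ K′) * (M + 0) ∎
          where
          shift : ∀ ω → P (y ∷ ω) ≡ true → x ≤ ∑ (λ i → h (suc i) (lookup ω i))
          shift ω p = ≤-trans (Px (y ∷ ω) p) (≤-reflexive (trans (∑-suc (λ i → h i (lookup (y ∷ ω) i))) (cong (_+ ∑ (λ i → h (suc i) (lookup ω i))) eq)))
        go (suc zero) eq _ (suc x) Px = begin
          S y * (suc M * suc M ^ x * N ^ K′ * M) ≡⟨ reg₃ (S y) (suc M) (suc M ^ x) (N ^ K′) M ⟩
          S y * (suc M ^ x * N ^ K′) * (M * suc M) ≤⟨ *-monoˡ-≤ (M * suc M) (IH x shift) ⟩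
          R ^ n * (M ^ x * suc N ^ K′) * (M * suc M) ≡⟨ reg₄ (R ^ n) (M ^ x) (suc N ^ K′) M ⟩
          R ^ n * (M * M ^ x * suc N ^ K′) * (M + 1) ∎
          where
          shift : ∀ ω → P (y ∷ ω) ≡ true → x ≤ ∑ (λ i → h (suc i) (lookup ω i))
          shift ω p = ≤-pred (≤-trans (Px (y ∷ ω) p) (≤-reflexive (trans (∑-suc (λ i → h i (lookup (y ∷ ω) i))) (cong (_+ ∑ (λ i → h (suc i) (lookup ω i))) eq))))
          reg₃ : ∀ s a b c m → s * (a * b * c * m) ≡ s * (b * c) * (m * a)
          reg₃ = solve-∀
          reg₄ : ∀ r a b m → r * (a * b) * (m * (1 + m)) ≡ r * (m * a * b) * (m + 1)
          reg₄ = solve-∀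
        go (suc (suc a)) eq (s≤s ()) x Px
      sum-bound : ∑ S * (suc M ^ x * N ^ K′ * M) ≤ R ^ n * (M ^ x * suc N ^ K′) * (N + n₀)
      sum-bound = begin
        ∑ S * (suc M ^ x * N ^ K′ * M) ≡⟨ ∑-*ʳ S _ ⟨
        ∑ (λ y → S y * (suc M ^ x * N ^ K′ * M)) ≤⟨ ∑-mono per-y ⟩
        ∑ (λ y → R ^ n * (M ^ x * suc N ^ K′) * (M + h zero y)) ≡⟨ ∑-*ˡ (R ^ n * (M ^ x * suc N ^ K′)) (λ y → M + h zero y) ⟩
        R ^ n * (M ^ x * suc N ^ K′) * ∑ (λ y → M + h zero y) ≡⟨ cong (R ^ n * (M ^ x * suc N ^ K′) *_) (trans (∑-+ (λ _ → M) (h zero)) (cong (_+ n₀) (trans (∑-const R M) (*-comm R M)))) ⟩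
        R ^ n * (M ^ x * suc N ^ K′) * (N + n₀) ∎

    -- The condition on `j` gives `(1 + 1 / N) ^ j ≤ 1 + 1 / M`. So the denominator in `weight` is
    -- at least `(1 + 1 / N) ^ (j * x)`, and the excess of `j * x` over `K` is handed to `two-pow`.
    tail : {{_ : NonZero R}} → ∀ {n} (h : Fin n → Fin R → ℕ) → (∀ i x → h i x ≤ 1) →
           ∀ x K j k → ∑ (λ i → ∑ (h i)) ≤ K → K + M * R * k ≤ j * x → j * suc M ≤ M * R →
           (P : Vec (Fin R) n → Bool) →
           (∀ ω → P ω ≡ true → x ≤ ∑ (λ i → h i (lookup ω i))) →
           #Ω R (λ ω → P ω) * 2 ^ k ≤ R ^ n
    tail {n} h h≤1 x K j k ΣK K≤ j≤ P Px =
      cancel-weight {S = #Ω R (λ ω → P ω)} {k = k} {{m*n≢0 _ _ {{m^n≢0 (suc M) x}} {{m^n≢0 N K {{m*n≢0 M R}}}}}}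
        (weight h h≤1 x K ΣK P Px) powers
      where
      instance
        N≢0 : NonZero N
        N≢0 = m*n≢0 M R
      open ≤-Reasoning
      E = j * x ∸ K
      E≡ : K + E ≡ j * x
      E≡ = m+[n∸m]≡n (≤-trans (m≤m+n K _) K≤)
      Nk≤E : N * k ≤ E
      Nk≤E = +-cancelˡ-≤ K _ _ (≤-trans K≤ (≤-reflexive (sym E≡)))
      j≤N : j ≤ N
      j≤N = ≤-trans (m≤m*n j (suc M)) j≤
      b = suc N ∸ j
      b≡ : b + j ≡ suc N
      b≡ = m∸n+n≡m (≤-trans j≤N (n≤1+n N))
      base : suc N ^ j * M ≤ N ^ j * suc M
      base = *-cancelʳ-≤ _ _ b {{>-nonZero (m<n⇒0<n∸m (s≤s j≤N))}} (begin
        suc N ^ j * M * b ≡⟨ reg₁ (suc N ^ j) M b ⟩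
        M * (b * suc N ^ j) ≤⟨ *-monoʳ-≤ M (bernoulli⁻ N j b b≡) ⟩
        M * (suc N * N ^ j) ≡⟨ *-assoc M (suc N) _ ⟨
        M * suc N * N ^ j ≤⟨ *-monoˡ-≤ (N ^ j) M[1+N]≤ ⟩
        suc M * b * N ^ j ≡⟨ reg₂ (suc M) b (N ^ j) ⟩
        N ^ j * suc M * b ∎)
        where
        reg₁ : ∀ a m b → a * m * b ≡ m * (b * a)
        reg₁ = solve-∀
        reg₂ : ∀ m b a → m * b * a ≡ a * m * b
        reg₂ = solve-∀
        M[1+N]≤ : M * suc N ≤ suc M * b
        M[1+N]≤ = +-cancelʳ-≤ (suc M * j) _ _ (begin
          M * suc N + suc M * j ≤⟨ +-monoʳ-≤ (M * suc N) (≤-trans (≤-reflexive (*-comm (suc M) j)) (≤-trans j≤ (n≤1+n N))) ⟩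
          M * suc N + suc N ≡⟨ +-comm (M * suc N) (suc N) ⟩
          suc M * suc N ≡⟨ cong (suc M *_) b≡ ⟨
          suc M * (b + j) ≡⟨ *-distribˡ-+ (suc M) b j ⟩
          suc M * b + suc M * j ∎)
      powers : M ^ x * suc N ^ K * 2 ^ k ≤ suc M ^ x * N ^ K
      powers = *-cancelʳ-≤ _ _ (N ^ E) {{m^n≢0 N E}} (begin
        M ^ x * suc N ^ K * 2 ^ k * N ^ E ≡⟨ *-assoc (M ^ x * suc N ^ K) _ _ ⟩
        M ^ x * suc N ^ K * (2 ^ k * N ^ E) ≤⟨ *-monoʳ-≤ (M ^ x * suc N ^ K) (two-pow N k E Nk≤E) ⟩
        M ^ x * suc N ^ K * suc N ^ E ≡⟨ *-assoc (M ^ x) _ _ ⟩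
        M ^ x * (suc N ^ K * suc N ^ E) ≡⟨ cong (M ^ x *_) (trans (sym (^-distribˡ-+-* (suc N) K E)) (trans (cong (suc N ^_) E≡) (sym (^-*-assoc (suc N) j x)))) ⟩
        M ^ x * (suc N ^ j) ^ x ≡⟨ *-comm (M ^ x) _ ⟩
        (suc N ^ j) ^ x * M ^ x ≡⟨ ^-distrib-* (suc N ^ j) M x ⟨
        (suc N ^ j * M) ^ x ≤⟨ ^-monoˡ-≤ x base ⟩
        (N ^ j * suc M) ^ x ≡⟨ ^-distrib-* (N ^ j) (suc M) x ⟩
        (N ^ j) ^ x * suc M ^ x ≡⟨ cong (_* suc M ^ x) (trans (^-*-assoc N j x) (trans (cong (N ^_) (sym E≡)) (^-distribˡ-+-* N K E))) ⟩
        N ^ K * N ^ E * suc M ^ x ≡⟨ reg (N ^ K) (N ^ E) (suc M ^ x) ⟩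
        suc M ^ x * N ^ K * N ^ E ∎)
        where
        reg : ∀ a b c → a * b * c ≡ c * a * b
        reg = solve-∀

  -- An adapted process: variable i hits the targets f with H i ω f, and may look at ω only up to
  -- index i.  A survivor is a target never hit.  If every potential survivor has many
  -- single-variable hits available, few outcomes leave u survivors.
  module _ {R : ℕ} where

    Adapted : ∀ {n k} → (Fin n → Vec (Fin R) n → Fin k → Bool) → Set
    Adapted H = ∀ i ω ω′ → (∀ j → j ≤F i → lookup ω j ≡ lookup ω′ j) → ∀ f → H i ω f ≡ H i ω′ f

    survives : ∀ {n k} → (Fin k → Bool) → (Fin n → Vec (Fin R) n → Fin k → Bool) →
               Vec (Fin R) n → Fin k → Bool
    survives U H ω f = U f ∧ not (any (λ i → H i ω f))

    -- Each variable is reset alone, the rest of `ω` being kept. For an adapted process the summand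
    -- is `R` times the conditional probability, given the earlier variables of `ω`, that variable
    -- `i` hits `f`.
    chances : ∀ {n k} → (Fin n → Vec (Fin R) n → Fin k → Bool) → Vec (Fin R) n → Fin k → ℕ
    chances H ω f = ∑ (λ i → # (λ x → H i (ω [ i ]≔ x) f))

  module Survivors {R : ℕ} (x₀ : Fin R) (L : ℕ) {{_ : NonZero L}} where

    private
      N = (2 + L) * R

    private
      instance
        R≢0 : NonZero R
        R≢0 = nonZeroIndex x₀
        N≢0 : NonZero N
        N≢0 = m*n≢0 (2 + L) R

      N′ = pred N

      N≡ : suc N′ ≡ N
      N≡ = suc-pred N

    -- In fractions the bound is `(1 + 1 / L) ^ y * (1 - 1 / N) ^ K`. If `u` of at most `u + y`
    -- targets survive, at most `y` are ever hit, and each hit is paid for by a factor `1 + 1 / L`.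
    -- By `factor` this payment allows a gain of `1 - a / (2 + L)` in a step with `a` hits. Averaged
    -- over the values of the variable the gain is `1 - n₀ / N`, at most `(1 - 1 / N) ^ n₀`, while
    -- the survivors lose at most `n₀` of their chances.
    weight : ∀ {n k} (H : Fin n → Vec (Fin R) n → Fin k → Bool) (U : Fin k → Bool) →
             Adapted H → (∀ i ω → # (λ f → U f ∧ H i ω f) ≤ 2) →
             ∀ u y K → # (λ f → U f) ≤ u + y →
             (P : Vec (Fin R) n → Bool) →
             (∀ ω → P ω ≡ true → u ≤ # (λ f → survives U H ω f)) →
             (∀ ω → P ω ≡ true → K ≤ ∑ (λ f → ⟦ survives U H ω f ⟧ * chances H ω f)) →
             #Ω R (λ ω → P ω) * (L ^ y * N ^ K) ≤ R ^ n * (suc L ^ y * N′ ^ K)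
    weight {zero} H U ad two u y K |U|≤ P Pu PK = begin
      #Ω R (λ ω → P ω) * (L ^ y * N ^ K) ≡⟨ cong (_* (L ^ y * N ^ K)) (∑Ω-[] (λ ω → ⟦ P ω ⟧)) ⟩
      ⟦ P [] ⟧ * (L ^ y * N ^ K) ≤⟨ base ⟩
      1 * (suc L ^ y * N′ ^ K) ∎
      where
      open ≤-Reasoning
      no-chances : ∀ f → chances H [] f ≡ 0
      no-chances f = trans (∑-cong {zero} {g = λ _ → 0} λ ()) (∑-zero 0)
      base : ⟦ P [] ⟧ * (L ^ y * N ^ K) ≤ 1 * (suc L ^ y * N′ ^ K)
      base with P [] in eq
      ... | false = z≤n
      ... | true with PK [] eq
      ...   | K≤ rewrite n≤0⇒n≡0 (≤-trans K≤ (≤-reflexive (trans (∑-cong (λ f → trans (cong (⟦ survives U H [] f ⟧ *_) (no-chances f)) (*-zeroʳ ⟦ survives U H [] f ⟧))) (∑-zero _)))) =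
        *-monoʳ-≤ 1 (*-monoˡ-≤ 1 (^-monoˡ-≤ y (n≤1+n L)))
    weight {suc n} {k} H U ad two u y K |U|≤ P Pu PK = *-cancelʳ-≤ _ _ (N ^ e * (2 + L)) {{m*n≢0 _ _ {{m^n≢0 N e}}}} (begin
      #Ω R (λ ω → P ω) * (L ^ y * N ^ K) * (N ^ e * (2 + L))
        ≡⟨ cong (λ t → t * (L ^ y * N ^ K) * (N ^ e * (2 + L))) (∑Ω-suc (λ ω → ⟦ P ω ⟧)) ⟩
      ∑ S * (L ^ y * N ^ K) * (N ^ e * (2 + L))
        ≡⟨ reg₁ (∑ S) (L ^ y) (N ^ K) (N ^ e) (2 + L) ⟩
      ∑ S * (L ^ y * (N ^ K * N ^ e) * (2 + L))
        ≡⟨ cong (λ t → ∑ S * (L ^ y * t * (2 + L))) (pow-split N) ⟩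
      ∑ S * (L ^ y * (N ^ K′ * N ^ n₀) * (2 + L))
        ≡⟨ reg₂ (∑ S) (L ^ y) (N ^ K′) (N ^ n₀) (2 + L) ⟩
      ∑ S * (L ^ y * N ^ K′ * (2 + L)) * N ^ n₀
        ≤⟨ *-monoˡ-≤ (N ^ n₀) sum-bound ⟩
      R ^ n * (suc L ^ y * N′ ^ K′) * h′ * N ^ n₀
        ≡⟨ *-assoc (R ^ n * (suc L ^ y * N′ ^ K′)) h′ _ ⟩
      R ^ n * (suc L ^ y * N′ ^ K′) * (h′ * N ^ n₀)
        ≤⟨ *-monoʳ-≤ (R ^ n * (suc L ^ y * N′ ^ K′)) bern ⟩
      R ^ n * (suc L ^ y * N′ ^ K′) * ((2 + L) * R * N′ ^ n₀)
        ≡⟨ reg₃ (R ^ n) (suc L ^ y) (N′ ^ K′) (2 + L) R (N′ ^ n₀) ⟩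
      R * R ^ n * (suc L ^ y * (N′ ^ K′ * N′ ^ n₀)) * (2 + L)
        ≡⟨ cong (λ t → R * R ^ n * (suc L ^ y * t) * (2 + L)) (sym (pow-split N′)) ⟩
      R * R ^ n * (suc L ^ y * (N′ ^ K * N′ ^ e)) * (2 + L)
        ≤⟨ *-monoˡ-≤ (2 + L) (*-monoʳ-≤ (R * R ^ n) (*-monoʳ-≤ (suc L ^ y) (*-monoʳ-≤ (N′ ^ K) (^-monoˡ-≤ e (≤-trans (n≤1+n N′) (≤-reflexive N≡)))))) ⟩
      R * R ^ n * (suc L ^ y * (N′ ^ K * N ^ e)) * (2 + L)
        ≡⟨ reg₄ (R * R ^ n) (suc L ^ y) (N′ ^ K) (N ^ e) (2 + L) ⟩
      R * R ^ n * (suc L ^ y * N′ ^ K) * (N ^ e * (2 + L)) ∎)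
      where
      open ≤-Reasoning
      ω₀ = replicate n x₀
      U↓ : Fin R → Fin k → Bool
      U↓ x f = U f ∧ not (H zero (x ∷ ω₀) f)
      H↓ : Fin R → Fin n → Vec (Fin R) n → Fin k → Bool
      H↓ x i ω f = H (suc i) (x ∷ ω) f
      H-zero : ∀ x ω f → H zero (x ∷ ω) f ≡ H zero (x ∷ ω₀) f
      H-zero x ω f = ad zero (x ∷ ω) (x ∷ ω₀) (λ { zero _ → refl }) f
      hit : Fin R → Fin k → ℕ
      hit x f = ⟦ U f ∧ H zero (x ∷ ω₀) f ⟧
      h : Fin R → ℕ
      h x = ∑ (hit x)
      n₀ = ∑ h
      h≤2 : ∀ x → h x ≤ 2
      h≤2 x = two zero (x ∷ ω₀)
      h′ = ∑ (λ x → 2 + L ∸ h x)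
      h′+n₀ : h′ + n₀ ≡ N
      h′+n₀ = trans (sym (∑-+ (λ x → 2 + L ∸ h x) h))
        (trans (∑-cong (λ x → m∸n+n≡m (≤-trans (h≤2 x) (m≤m+n 2 L)))) (trans (∑-const R (2 + L)) (*-comm R (2 + L))))
      bern : h′ * N ^ n₀ ≤ (2 + L) * R * N′ ^ n₀
      bern = subst (λ t → h′ * t ^ n₀ ≤ t * N′ ^ n₀) N≡ (bernoulli⁻ N′ n₀ h′ (trans h′+n₀ (sym N≡)))
      -- The subtraction may truncate. The surplus `e` restores equality of the exponents, and its
      -- power is cancelled at the end.
      K′ = K ∸ n₀
      e = K′ + n₀ ∸ K
      K+e : K + e ≡ K′ + n₀
      K+e = m+[n∸m]≡n (≤-trans (m≤n+m∸n K n₀) (≤-reflexive (+-comm n₀ K′)))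
      pow-split : ∀ B → B ^ K * B ^ e ≡ B ^ K′ * B ^ n₀
      pow-split B = trans (sym (^-distribˡ-+-* B K e)) (trans (cong (B ^_) K+e) (^-distribˡ-+-* B K′ n₀))
      S : Fin R → ℕ
      S x = #Ω R (λ ω → P (x ∷ ω))
      reg₁ : ∀ s l a b c → s * (l * a) * (b * c) ≡ s * (l * (a * b) * c)
      reg₁ = solve-∀
      reg₂ : ∀ s l a b c → s * (l * (a * b) * c) ≡ s * (l * a * c) * b
      reg₂ = solve-∀
      reg₃ : ∀ r l a c R b → r * (l * a) * (c * R * b) ≡ R * r * (l * (a * b)) * c
      reg₃ = solve-∀
      reg₄ : ∀ r l a b c → r * (l * (a * b)) * c ≡ r * (l * a) * (b * c)
      reg₄ = solve-∀
      survives-∷ : ∀ x ω f → survives U H (x ∷ ω) f ≡ survives (U↓ x) (H↓ x) ω f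
      survives-∷ x ω f = trans (cong (λ b → U f ∧ not b) (trans (any-suc (λ i → H i (x ∷ ω) f)) (cong (_∨ any (λ i → H↓ x i ω f)) (H-zero x ω f))))
                               (demorgan (U f) (H zero (x ∷ ω₀) f) _)
        where
        demorgan : ∀ a b c → a ∧ not (b ∨ c) ≡ (a ∧ not b) ∧ not c
        demorgan true true c = refl
        demorgan true false c = refl
        demorgan false b c = refl
      ad↓ : ∀ x → Adapted (H↓ x)
      ad↓ x i ω ω′ p f = ad (suc i) (x ∷ ω) (x ∷ ω′) (λ { zero _ → refl ; (suc j) (s≤s q) → p j q }) f
      two↓ : ∀ x i ω → # (λ f → U↓ x f ∧ H↓ x i ω f) ≤ 2
      two↓ x i ω = ≤-trans (∑-mono (λ f → ⟦⟧-mono λ q →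
        ∧-true (∧-trueˡ {U f} (∧-trueˡ {U↓ x f} q)) (∧-trueʳ {U↓ x f} q))) (two (suc i) (x ∷ ω))
      |U↓| : ∀ x → # (λ f → U↓ x f) + h x ≡ # (λ f → U f)
      |U↓| x = trans (sym (∑-+ (λ f → ⟦ U↓ x f ⟧) (hit x))) (∑-cong λ f → split (U f) (H zero (x ∷ ω₀) f))
        where
        split : ∀ a b → ⟦ a ∧ not b ⟧ + ⟦ a ∧ b ⟧ ≡ ⟦ a ⟧
        split true true = refl
        split true false = refl
        split false b = refl
      Pu↓ : ∀ x ω → P (x ∷ ω) ≡ true → u ≤ # (λ f → survives (U↓ x) (H↓ x) ω f)
      Pu↓ x ω p = ≤-trans (Pu (x ∷ ω) p) (≤-reflexive (∑-cong (λ f → cong ⟦_⟧ (survives-∷ x ω f))))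
      PK↓ : ∀ x ω → P (x ∷ ω) ≡ true → K′ ≤ ∑ (λ f → ⟦ survives (U↓ x) (H↓ x) ω f ⟧ * chances (H↓ x) ω f)
      PK↓ x ω p = m≤n+o⇒m∸n≤o K n₀ (begin
        K ≤⟨ PK (x ∷ ω) p ⟩
        ∑ (λ f → ⟦ survives U H (x ∷ ω) f ⟧ * chances H (x ∷ ω) f)
          ≡⟨ ∑-cong (λ f → cong₂ _*_ (cong ⟦_⟧ (survives-∷ x ω f)) (∑-suc (λ i → # (λ z → H i ((x ∷ ω) [ i ]≔ z) f)))) ⟩
        ∑ (λ f → s f * (# (λ z → H zero (z ∷ ω) f) + chances (H↓ x) ω f))
          ≡⟨ trans (∑-cong (λ f → *-distribˡ-+ (s f) (# (λ z → H zero (z ∷ ω) f)) _)) (∑-+ (λ f → s f * # (λ z → H zero (z ∷ ω) f)) _) ⟩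
        ∑ (λ f → s f * # (λ z → H zero (z ∷ ω) f)) + ∑ (λ f → s f * chances (H↓ x) ω f)
          ≤⟨ +-monoˡ-≤ _ first ⟩
        n₀ + ∑ (λ f → s f * chances (H↓ x) ω f) ∎)
        where
        s : Fin k → ℕ
        s f = ⟦ survives (U↓ x) (H↓ x) ω f ⟧
        s≤U : ∀ f → s f ≤ ⟦ U f ⟧
        s≤U f = ⟦⟧-mono λ q → ∧-trueˡ {U f} (∧-trueˡ {U↓ x f} q)
        first : ∑ (λ f → s f * # (λ z → H zero (z ∷ ω) f)) ≤ n₀
        first = begin
          ∑ (λ f → s f * # (λ z → H zero (z ∷ ω) f))
            ≤⟨ ∑-mono (λ f → *-monoˡ-≤ _ (s≤U f)) ⟩
          ∑ (λ f → ⟦ U f ⟧ * # (λ z → H zero (z ∷ ω) f))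
            ≡⟨ ∑-cong (λ f → trans (sym (∑-*ˡ ⟦ U f ⟧ _)) (∑-cong (λ z → trans (cong (λ b → ⟦ U f ⟧ * ⟦ b ⟧) (H-zero z ω f)) (sym (⟦∧⟧ (U f) _))))) ⟩
          ∑ (λ f → ∑ (λ z → hit z f))
            ≡⟨ ∑-swap (λ f z → hit z f) ⟩
          n₀ ∎
      -- This says `(1 + 1 / L) ^ a * (1 - a / (2 + L)) ≥ 1`. Here the bound of two hits per
      -- variable enters, and it dictates the denominator: with `1 + L` the case of two hits would
      -- fail.
      factor : ∀ a → a ≤ 2 → L ^ a * (2 + L) ≤ suc L ^ a * (2 + L ∸ a)
      factor zero _ = ≤-refl
      factor (suc zero) _ = ≤-trans (m≤m+n _ 1) (≤-reflexive (sq L))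
        where
        sq : ∀ l → l * 1 * (2 + l) + 1 ≡ (1 + l) * 1 * (1 + l)
        sq = solve-∀
      factor (suc (suc zero)) _ = ≤-trans (m≤m+n _ L) (≤-reflexive (cube L))
        where
        cube : ∀ l → l * (l * 1) * (2 + l) + l ≡ (1 + l) * ((1 + l) * 1) * l
        cube = solve-∀
      factor (suc (suc (suc a))) (s≤s (s≤s ()))
      per-x : ∀ x → S x * (L ^ y * N ^ K′ * (2 + L)) ≤ R ^ n * (suc L ^ y * N′ ^ K′) * (2 + L ∸ h x)
      per-x x with h x ≤? y
      -- More than `y` hits at once leave fewer than `u` targets, so no outcome starting with `x`
      -- belongs to the event.
      ... | no h≰y = ≤-trans (≤-reflexive (cong (_* (L ^ y * N ^ K′ * (2 + L))) none)) z≤n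
        where
        |U↓|<u : # (λ f → U↓ x f) < u
        |U↓|<u = +-cancelʳ-≤ y _ _ (begin
          suc (# (λ f → U↓ x f)) + y ≡⟨ +-suc (# (λ f → U↓ x f)) y ⟨
          # (λ f → U↓ x f) + suc y ≤⟨ +-monoʳ-≤ _ (≰⇒> h≰y) ⟩
          # (λ f → U↓ x f) + h x ≡⟨ |U↓| x ⟩
          # (λ f → U f) ≤⟨ |U|≤ ⟩
          u + y ∎)
        none : S x ≡ 0
        none = trans (∑Ω-cong (λ ω → cong ⟦_⟧ (¬true⇒false {P (x ∷ ω)} λ p →
          <⇒≱ |U↓|<u (≤-trans (Pu↓ x ω p) (∑-mono (λ f → ⟦⟧-mono (∧-trueˡ {U↓ x f}))))))) (∑Ω-zero n)
      ... | yes h≤y = begin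
        S x * (L ^ y * N ^ K′ * (2 + L))
          ≡⟨ cong (λ t → S x * (t * N ^ K′ * (2 + L))) (split-pow L) ⟩
        S x * (L ^ (y ∸ h x) * L ^ h x * N ^ K′ * (2 + L))
          ≡⟨ reg₅ (S x) (L ^ (y ∸ h x)) (L ^ h x) (N ^ K′) (2 + L) ⟩
        S x * (L ^ (y ∸ h x) * N ^ K′) * (L ^ h x * (2 + L))
          ≤⟨ *-mono-≤ (weight (H↓ x) (U↓ x) (ad↓ x) (two↓ x) u (y ∸ h x) K′ |U↓|≤ (P ∘ (x ∷_)) (Pu↓ x) (PK↓ x)) (factor (h x) (h≤2 x)) ⟩
        R ^ n * (suc L ^ (y ∸ h x) * N′ ^ K′) * (suc L ^ h x * (2 + L ∸ h x))
          ≡⟨ reg₆ (R ^ n) (suc L ^ (y ∸ h x)) (N′ ^ K′) (suc L ^ h x) (2 + L ∸ h x) ⟩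
        R ^ n * (suc L ^ (y ∸ h x) * suc L ^ h x * N′ ^ K′) * (2 + L ∸ h x)
          ≡⟨ cong (λ t → R ^ n * (t * N′ ^ K′) * (2 + L ∸ h x)) (sym (split-pow (suc L))) ⟩
        R ^ n * (suc L ^ y * N′ ^ K′) * (2 + L ∸ h x) ∎
        where
        split-pow : ∀ B → B ^ y ≡ B ^ (y ∸ h x) * B ^ h x
        split-pow B = trans (cong (B ^_) (sym (m∸n+n≡m h≤y))) (^-distribˡ-+-* B (y ∸ h x) (h x))
        reg₅ : ∀ s a b c d → s * (a * b * c * d) ≡ s * (a * c) * (b * d)
        reg₅ = solve-∀
        reg₆ : ∀ r a b c d → r * (a * b) * (c * d) ≡ r * (a * c * b) * d
        reg₆ = solve-∀
        |U↓|≤ : # (λ f → U↓ x f) ≤ u + (y ∸ h x)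
        |U↓|≤ = +-cancelʳ-≤ (h x) _ _ (begin
          # (λ f → U↓ x f) + h x ≡⟨ |U↓| x ⟩
          # (λ f → U f) ≤⟨ |U|≤ ⟩
          u + y ≡⟨ cong (u +_) (m∸n+n≡m h≤y) ⟨
          u + (y ∸ h x + h x) ≡⟨ +-assoc u (y ∸ h x) (h x) ⟨
          u + (y ∸ h x) + h x ∎)
      sum-bound : ∑ S * (L ^ y * N ^ K′ * (2 + L)) ≤ R ^ n * (suc L ^ y * N′ ^ K′) * h′
      sum-bound = begin
        ∑ S * (L ^ y * N ^ K′ * (2 + L)) ≡⟨ ∑-*ʳ S _ ⟨
        ∑ (λ x → S x * (L ^ y * N ^ K′ * (2 + L))) ≤⟨ ∑-mono per-x ⟩
        ∑ (λ x → R ^ n * (suc L ^ y * N′ ^ K′) * (2 + L ∸ h x)) ≡⟨ ∑-*ˡ (R ^ n * (suc L ^ y * N′ ^ K′)) (λ x → 2 + L ∸ h x) ⟩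
        R ^ n * (suc L ^ y * N′ ^ K′) * h′ ∎

    -- The condition on `j` gives `1 + 1 / L ≤ (1 + 1 / N′) ^ j`, and `1 + 1 / N′` is the inverse of
    -- `1 - 1 / N`. Paying for `y` hits therefore uses up `y * j` of the `K` factors, and the
    -- `N * t` or more that are left yield `2 ^ t`.
    tail : ∀ {n k} (H : Fin n → Vec (Fin R) n → Fin k → Bool) (U : Fin k → Bool) →
           Adapted H → (∀ i ω → # (λ f → U f ∧ H i ω f) ≤ 2) →
           ∀ u y K j t → # (λ f → U f) ≤ u + y → y * j + N * t ≤ K → N ≤ L * j →
           (P : Vec (Fin R) n → Bool) →
           (∀ ω → P ω ≡ true → u ≤ # (λ f → survives U H ω f)) →
           (∀ ω → P ω ≡ true → K ≤ ∑ (λ f → ⟦ survives U H ω f ⟧ * chances H ω f)) →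
           #Ω R (λ ω → P ω) * 2 ^ t ≤ R ^ n
    tail {n} H U ad two u y K j t |U|≤ K≥ N≤ P Pu PK =
      cancel-weight {S = #Ω R (λ ω → P ω)} {k = t} {{m*n≢0 _ _ {{m^n≢0 L y}} {{m^n≢0 N K}}}}
        (weight H U ad two u y K |U|≤ P Pu PK) powers
      where
      open ≤-Reasoning
      instance
        N′≢0 : NonZero N′
        N′≢0 = >-nonZero (≤-pred (≤-trans (≤-trans (m≤m+n 2 L) (m≤m*n (2 + L) R)) (≤-reflexive (sym N≡))))
      E = K ∸ y * j
      E≡ : y * j + E ≡ K
      E≡ = m+[n∸m]≡n (≤-trans (m≤m+n (y * j) _) K≥)
      N′t≤E : N′ * t ≤ E
      N′t≤E = ≤-trans (*-monoˡ-≤ t (≤-trans (n≤1+n N′) (≤-reflexive N≡)))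
                      (+-cancelˡ-≤ (y * j) _ _ (≤-trans K≥ (≤-reflexive (sym E≡))))
      base : suc L * N′ ^ j ≤ L * suc N′ ^ j
      base = *-cancelˡ-≤ N′ (begin
        N′ * (suc L * N′ ^ j) ≡⟨ reg₁ N′ L (N′ ^ j) ⟩
        (L * N′ + N′) * N′ ^ j ≤⟨ *-monoˡ-≤ (N′ ^ j) (+-monoʳ-≤ (L * N′) (≤-trans (≤-trans (n≤1+n N′) (≤-reflexive N≡)) N≤)) ⟩
        (L * N′ + L * j) * N′ ^ j ≡⟨ reg₂ L N′ j (N′ ^ j) ⟩
        L * ((N′ + j) * N′ ^ j) ≤⟨ *-monoʳ-≤ L (bernoulli⁺ N′ j) ⟩
        L * (N′ * suc N′ ^ j) ≡⟨ x∙yz≈y∙xz L N′ (suc N′ ^ j) ⟩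
        N′ * (L * suc N′ ^ j) ∎)
        where
        reg₁ : ∀ n l p → n * ((1 + l) * p) ≡ (l * n + n) * p
        reg₁ = solve-∀
        reg₂ : ∀ l n j p → (l * n + l * j) * p ≡ l * ((n + j) * p)
        reg₂ = solve-∀
      split-pow : ∀ B → B ^ K ≡ (B ^ j) ^ y * B ^ E
      split-pow B = trans (cong (B ^_) (sym E≡)) (trans (^-distribˡ-+-* B (y * j) E)
        (cong (_* B ^ E) (trans (cong (B ^_) (*-comm y j)) (sym (^-*-assoc B j y)))))
      powers : suc L ^ y * N′ ^ K * 2 ^ t ≤ L ^ y * N ^ K
      powers = begin
        suc L ^ y * N′ ^ K * 2 ^ t ≡⟨ cong (λ s → suc L ^ y * s * 2 ^ t) (split-pow N′) ⟩
        suc L ^ y * ((N′ ^ j) ^ y * N′ ^ E) * 2 ^ t ≡⟨ reg₁ (suc L ^ y) ((N′ ^ j) ^ y) (N′ ^ E) (2 ^ t) ⟩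
        suc L ^ y * (N′ ^ j) ^ y * (2 ^ t * N′ ^ E) ≡⟨ cong (_* (2 ^ t * N′ ^ E)) (^-distrib-* (suc L) (N′ ^ j) y) ⟨
        (suc L * N′ ^ j) ^ y * (2 ^ t * N′ ^ E) ≤⟨ *-mono-≤ (^-monoˡ-≤ y base) (two-pow N′ t E N′t≤E) ⟩
        (L * suc N′ ^ j) ^ y * suc N′ ^ E ≡⟨ cong (_* suc N′ ^ E) (^-distrib-* L (suc N′ ^ j) y) ⟩
        L ^ y * (suc N′ ^ j) ^ y * suc N′ ^ E ≡⟨ *-assoc (L ^ y) _ _ ⟩
        L ^ y * ((suc N′ ^ j) ^ y * suc N′ ^ E) ≡⟨ cong (L ^ y *_) (sym (split-pow (suc N′))) ⟩
        L ^ y * suc N′ ^ K ≡⟨ cong (λ s → L ^ y * s ^ K) N≡ ⟩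
        L ^ y * N ^ K ∎
        where
        reg₁ : ∀ a b c d → a * (b * c) * d ≡ a * b * (d * c)
        reg₁ = solve-∀

  -- Conflict systems on the items of a frame

  -- Items are placeholders for edges: an item that is not an edge lies at no vertex.
  record Frame : Set where
    field
      items vertices : ℕ
      at      : Fin vertices → Fin items → Bool
      end₁    : Fin items → Fin vertices
      end₂    : Fin items → Fin vertices
      at-ends : ∀ v e → at v e ≡ true → v ≡ end₁ e ⊎ v ≡ end₂ e
      simple  : ∀ v w e f → v ≢ w → at v e ≡ true → at w e ≡ true →
                at v f ≡ true → at w f ≡ true → e ≡ f

    DegreeBound : ℕ → Set
    DegreeBound D = ∀ v → # (λ e → at v e) ≤ D

  record Conflict (F : Frame) (ℓ : ℕ) : Set where
    open Frame F
    field
      match        : Fin items → Fin items → Fin ℓ → Maybe (Fin ℓ)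
      match-sym    : ∀ e f c c′ → match e f c ≡ just c′ → match f e c′ ≡ just c
      match-irrefl : ∀ e c → match e e c ≡ nothing
      match-at     : ∀ e f c c′ → match e f c ≡ just c′ →
                     Σ (Fin vertices) λ v → at v e ≡ true × at v f ≡ true

    total : Fin items → Fin ℓ → ℕ
    total e c = # (λ f → is-just (match e f c))

    totalAt : Fin vertices → Fin items → Fin ℓ → ℕ
    totalAt v e c = # (λ f → at v f ∧ is-just (match e f c))

    ColourDegreeBound : ℕ → Set
    ColourDegreeBound d = ∀ v e c → at v e ≡ true → totalAt v e c ≤ d

    Colouring : Set
    Colouring = Σ (Fin items → Fin ℓ) λ σ → ∀ e f → match e f (σ e) ≢ just (σ f)

  is-just-elim : ∀ {A : Set} {x : Maybe A} → is-just x ≡ true → Σ A λ a → x ≡ just a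
  is-just-elim {x = just a} _ = a , refl

  is-just-intro : ∀ {A : Set} {x : Maybe A} {a} → x ≡ just a → is-just x ≡ true
  is-just-intro refl = refl

  module _ {F : Frame} {ℓ : ℕ} (𝒞 : Conflict F ℓ) where
    open Frame F
    open Conflict 𝒞

    -- Every conflict of `e` takes place at one of its two ends. The factors `s₁` and `s₂` are
    -- needed because an item that is not an edge does not lie at its nominal ends, where `bound` is
    -- silent.
    total≤ : ∀ {d} → ColourDegreeBound d → ∀ e c → total e c ≤ 2 * d
    total≤ {d} bound e c = begin
      total e c
        ≤⟨ ∑-mono per-f ⟩
      ∑ (λ f → s₁ * ⟦ at (end₁ e) f ∧ K f ⟧ + s₂ * ⟦ at (end₂ e) f ∧ K f ⟧)
        ≡⟨ ∑-+ (λ f → s₁ * ⟦ at (end₁ e) f ∧ K f ⟧) _ ⟩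
      ∑ (λ f → s₁ * ⟦ at (end₁ e) f ∧ K f ⟧) + ∑ (λ f → s₂ * ⟦ at (end₂ e) f ∧ K f ⟧)
        ≡⟨ cong₂ _+_ (∑-*ˡ s₁ (λ f → ⟦ at (end₁ e) f ∧ K f ⟧)) (∑-*ˡ s₂ (λ f → ⟦ at (end₂ e) f ∧ K f ⟧)) ⟩
      s₁ * totalAt (end₁ e) e c + s₂ * totalAt (end₂ e) e c
        ≤⟨ +-mono-≤ (side (end₁ e)) (≤-trans (side (end₂ e)) (m≤m+n d 0)) ⟩
      2 * d ∎
      where
      open ≤-Reasoning
      K : Fin items → Bool
      K f = is-just (match e f c)
      s₁ = ⟦ at (end₁ e) e ⟧
      s₂ = ⟦ at (end₂ e) e ⟧
      side : ∀ v → ⟦ at v e ⟧ * totalAt v e c ≤ d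
      side v with at v e in eq
      ... | false = z≤n
      ... | true  = ≤-trans (≤-reflexive (+-identityʳ _)) (bound v e c eq)
      per-f : ∀ f → ⟦ K f ⟧ ≤ s₁ * ⟦ at (end₁ e) f ∧ K f ⟧ + s₂ * ⟦ at (end₂ e) f ∧ K f ⟧
      per-f f = ⟦⟧≤ go
        where
        one : ∀ {v} → at v e ≡ true → at v f ≡ true → K f ≡ true → 1 ≤ ⟦ at v e ⟧ * ⟦ at v f ∧ K f ⟧
        one p q r rewrite p | q | r = ≤-refl
        go : K f ≡ true → 1 ≤ s₁ * ⟦ at (end₁ e) f ∧ K f ⟧ + s₂ * ⟦ at (end₂ e) f ∧ K f ⟧
        go j with c′ , m ← is-just-elim j with v , ve , vf ← match-at e f c c′ m with at-ends v e ve
        ... | inj₁ refl = ≤-trans (one ve vf j) (m≤m+n _ _)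
        ... | inj₂ refl = ≤-trans (one ve vf j) (m≤n+m _ (s₁ * ⟦ at (end₁ e) f ∧ K f ⟧))

  ∑Ω-lookup : ∀ {R n} (i : Fin n) (c : Fin R) → #Ω R (λ ω → lookup ω i == c) * R ≡ R ^ n
  ∑Ω-lookup {R} {suc n} zero c = begin
    #Ω R (λ ω → lookup ω zero == c) * R ≡⟨ cong (_* R) (∑Ω-suc (λ ω → ⟦ lookup ω zero == c ⟧)) ⟩
    ∑ (λ x → ∑Ω R (λ (ω : Vec (Fin R) n) → ⟦ x == c ⟧)) * R ≡⟨ cong (_* R) (∑-cong (λ x → trans (∑Ω-cong {n = n} (λ ω → sym (*-identityʳ ⟦ x == c ⟧))) (trans (∑Ω-*ˡ {n = n} ⟦ x == c ⟧ (λ _ → 1)) (cong (⟦ x == c ⟧ *_) (∑Ω-one n))))) ⟩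
    ∑ (λ x → ⟦ x == c ⟧ * R ^ n) * R ≡⟨ cong (_* R) (∑-δ c (λ _ → R ^ n)) ⟩
    R ^ n * R ≡⟨ *-comm (R ^ n) R ⟩
    R * R ^ n ∎
    where open ≡-Reasoning
  ∑Ω-lookup {R} {suc n} (suc i) c = begin
    #Ω R (λ ω → lookup ω (suc i) == c) * R ≡⟨ cong (_* R) (∑Ω-suc (λ ω → ⟦ lookup ω (suc i) == c ⟧)) ⟩
    ∑ (λ (x : Fin R) → #Ω R (λ ω → lookup ω i == c)) * R ≡⟨ cong (_* R) (∑-const R _) ⟩
    R * #Ω R (λ ω → lookup ω i == c) * R ≡⟨ *-assoc R _ R ⟩
    R * (#Ω R (λ ω → lookup ω i == c) * R) ≡⟨ cong (R *_) (∑Ω-lookup i c) ⟩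
    R * R ^ n ∎
    where open ≡-Reasoning

  -- If ℓ ≥ 32 d, a uniformly random colouring with the local lemma applied to the events
  -- "e gets c and f gets the colour matched to c" suffices.
  module _ {F : Frame} {ℓ : ℕ} (𝒞 : Conflict F (suc ℓ)) {d : ℕ}
           (bound : Conflict.ColourDegreeBound 𝒞 d) (32d≤ : 32 * d ≤ suc ℓ) (1≤ℓ : 1 ≤ ℓ) where
    open Frame F
    open Conflict 𝒞

    private
      R = suc ℓ
      Ω = Vec (Fin R) items

      both : Ω → Fin items → Fin items → Fin R → Maybe (Fin R) → Bool
      both ω e f c nothing   = false
      both ω e f c (just c′) = (lookup ω e == c) ∧ (lookup ω f == c′)

      B₃ : Fin items → Fin items → Fin R → Ω → Bool
      B₃ e f c ω = both ω e f c (match e f c)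

      near₃ : Fin items → Fin items → Fin R → Fin items → Bool
      near₃ e f c i = is-just (match e f c) ∧ ((i == e) ∨ (i == f))

      Events = items * (items * R)

      index : Fin Events → Fin items × (Fin items × Fin R)
      index j = let e , fc = remQuot (items * R) j in e , remQuot R fc

      on : ∀ {A : Set} → (Fin items → Fin items → Fin R → A) → Fin Events → A
      on g j = let e , f , c = index j in g e f c

      on-combine : ∀ {A : Set} (g : Fin items → Fin items → Fin R → A) e f c →
                   on g (combine e (combine f c)) ≡ g e f c
      on-combine g e f c = trans
        (cong (λ p → let f′ , c′ = remQuot R (proj₂ p) in g (proj₁ p) f′ c′) (remQuot-combine {items} {items * R} e (combine f c)))
        (cong (λ p → g e (proj₁ p) (proj₂ p)) (remQuot-combine {items} {R} f c))

      ∑-on : ∀ (g : Fin items → Fin items → Fin R → ℕ) →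
             ∑ (on g) ≡ ∑ (λ e → ∑ (λ f → ∑ (λ c → g e f c)))
      ∑-on g = trans (∑-combine items (items * R) (on g)) (∑-cong λ e →
        trans (∑-combine items R (λ k → on g (combine e k))) (∑-cong λ f → ∑-cong λ c → on-combine g e f c))

      dep₃ : ∀ e f c → DependsOn (near₃ e f c) (B₃ e f c)
      dep₃ e f c ω ω′ p with match e f c
      ... | nothing = refl
      ... | just c′ rewrite p e (∨-trueˡ (==-refl e)) | p f (∨-trueʳ {f == e} (==-refl f)) = refl

      prob₃ : ∀ e f c → #Ω R (λ ω → B₃ e f c ω) * (R * R) ≤ R ^ items
      prob₃ e f c with match e f c in eqm
      ... | nothing = ≤-trans (≤-reflexive (cong (_* (R * R)) (∑Ω-zero items))) z≤n
      ... | just c′ = *-cancelʳ-≤ _ _ (R ^ items) {{m^n≢0 R items}} (≤-reflexive (begin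
        #Ω R (λ ω → (lookup ω e == c) ∧ (lookup ω f == c′)) * (R * R) * R ^ items
          ≡⟨ cong (λ t → t * (R * R) * R ^ items) (∑Ω-cong (λ ω → ⟦∧⟧ (lookup ω e == c) _)) ⟩
        ∑Ω R (λ ω → ⟦ lookup ω e == c ⟧ * ⟦ lookup ω f == c′ ⟧) * (R * R) * R ^ items
          ≡⟨ reg₁ (∑Ω R (λ ω → ⟦ lookup ω e == c ⟧ * ⟦ lookup ω f == c′ ⟧)) R (R ^ items) ⟩
        ∑Ω R (λ ω → ⟦ lookup ω e == c ⟧ * ⟦ lookup ω f == c′ ⟧) * R ^ items * (R * R)
          ≡⟨ cong (_* (R * R)) (independence zero (_== e) (λ ω → ⟦ lookup ω e == c ⟧) (λ ω → ⟦ lookup ω f == c′ ⟧)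
               (λ ω ω′ p → cong (λ x → ⟦ x == c ⟧) (p e (==-refl e)))
               (λ ω ω′ p → cong (λ x → ⟦ x == c′ ⟧) (p f (false⇒not (¬true⇒false λ q → e≢f (sym (==⇒≡ q))))))) ⟩
        #Ω R (λ ω → lookup ω e == c) * #Ω R (λ ω → lookup ω f == c′) * (R * R)
          ≡⟨ reg₂ (#Ω R (λ ω → lookup ω e == c)) (#Ω R (λ ω → lookup ω f == c′)) R ⟩
        (#Ω R (λ ω → lookup ω e == c) * R) * (#Ω R (λ ω → lookup ω f == c′) * R)
          ≡⟨ cong₂ _*_ (∑Ω-lookup e c) (∑Ω-lookup f c′) ⟩
        R ^ items * R ^ items ∎))
        where
        open ≡-Reasoning
        e≢f : e ≢ f
        e≢f refl with () ← trans (sym (match-irrefl e c)) eqm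
        reg₁ : ∀ s r p → s * (r * r) * p ≡ s * p * (r * r)
        reg₁ = solve-∀
        reg₂ : ∀ s t r → s * t * (r * r) ≡ (s * r) * (t * r)
        reg₂ = solve-∀

      near≤2 : ∀ e f c → # (λ i → near₃ e f c i) ≤ 2
      near≤2 e f c = ≤-trans (∑-mono (λ i → ≤-trans (⟦⟧-mono (∧-trueʳ {is-just (match e f c)})) (⟦∨⟧≤ (i == e) (i == f))))
        (≤-reflexive (trans (∑-+ (λ i → ⟦ i == e ⟧) (λ i → ⟦ i == f ⟧)) (cong₂ _+_ (∑-== e) (∑-== f))))

      first : ∀ i → ∑ (λ e → ∑ (λ f → ∑ (λ c → ⟦ e == i ⟧ * ⟦ is-just (match e f c) ⟧))) ≤ R * (2 * d)
      first i = begin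
        ∑ (λ e → ∑ (λ f → ∑ (λ c → ⟦ e == i ⟧ * ⟦ is-just (match e f c) ⟧)))
          ≡⟨ ∑-cong (λ e → trans (∑-cong (λ f → ∑-*ˡ ⟦ e == i ⟧ (λ c → ⟦ is-just (match e f c) ⟧))) (∑-*ˡ ⟦ e == i ⟧ (λ f → # (λ c → is-just (match e f c))))) ⟩
        ∑ (λ e → ⟦ e == i ⟧ * ∑ (λ f → # (λ c → is-just (match e f c))))
          ≡⟨ ∑-δ i (λ e → ∑ (λ f → # (λ c → is-just (match e f c)))) ⟩
        ∑ (λ f → # (λ c → is-just (match i f c)))
          ≡⟨ ∑-swap (λ f c → ⟦ is-just (match i f c) ⟧) ⟩
        ∑ (λ c → total i c)
          ≤⟨ ∑-≤const (2 * d) (λ c → total≤ 𝒞 bound i c) ⟩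
        R * (2 * d) ∎
        where open ≤-Reasoning

      -- A partial matching has equally many matched colours on both sides. Events are indexed by a
      -- colour of their first item; this converts the count when the second item is the fixed one.
      #just-sym : ∀ e f → # (λ c → is-just (match e f c)) ≤ # (λ c → is-just (match f e c))
      #just-sym e f = begin
        # (λ c → is-just (match e f c)) ≤⟨ ∑-mono expand ⟩
        ∑ (λ c → # (λ c′ → is (match f e c′) c)) ≡⟨ ∑-swap (λ c c′ → ⟦ is (match f e c′) c ⟧) ⟩
        ∑ (λ c′ → # (λ c → is (match f e c′) c)) ≤⟨ ∑-mono (λ c′ → collapse (match f e c′)) ⟩
        # (λ c′ → is-just (match f e c′)) ∎
        where
        open ≤-Reasoning
        is : Maybe (Fin R) → Fin R → Bool
        is nothing  c = false
        is (just b) c = c == b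
        expand : ∀ c → ⟦ is-just (match e f c) ⟧ ≤ # (λ c′ → is (match f e c′) c)
        expand c = ⟦⟧≤ λ j → let c′ , m = is-just-elim j in
          ≤-trans (≡true⇒1≤ (trans (cong (λ x → is x c) (match-sym e f c c′ m)) (==-refl c)))
                  (term≤∑ (λ c′ → ⟦ is (match f e c′) c ⟧) c′)
        collapse : ∀ x → # (λ c → is x c) ≤ ⟦ is-just x ⟧
        collapse nothing  = ≤-reflexive (∑-zero R)
        collapse (just b) = ≤-reflexive (∑-== b)

      second : ∀ i → ∑ (λ e → ∑ (λ f → ∑ (λ c → ⟦ f == i ⟧ * ⟦ is-just (match e f c) ⟧))) ≤ R * (2 * d)
      second i = begin
        ∑ (λ e → ∑ (λ f → ∑ (λ c → ⟦ f == i ⟧ * ⟦ is-just (match e f c) ⟧)))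
          ≡⟨ ∑-cong (λ e → ∑-cong (λ f → ∑-*ˡ ⟦ f == i ⟧ (λ c → ⟦ is-just (match e f c) ⟧))) ⟩
        ∑ (λ e → ∑ (λ f → ⟦ f == i ⟧ * # (λ c → is-just (match e f c))))
          ≤⟨ ∑-mono (λ e → ∑-mono (λ f → *-monoʳ-≤ ⟦ f == i ⟧ (#just-sym e f))) ⟩
        ∑ (λ e → ∑ (λ f → ⟦ f == i ⟧ * # (λ c → is-just (match f e c))))
          ≡⟨ ∑-swap (λ e f → ⟦ f == i ⟧ * # (λ c → is-just (match f e c))) ⟩
        ∑ (λ f → ∑ (λ e → ⟦ f == i ⟧ * # (λ c → is-just (match f e c))))
          ≡⟨ ∑-cong (λ f → ∑-cong (λ e → ∑-*ˡ ⟦ f == i ⟧ (λ c → ⟦ is-just (match f e c) ⟧))) ⟨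
        ∑ (λ f → ∑ (λ e → ∑ (λ c → ⟦ f == i ⟧ * ⟦ is-just (match f e c) ⟧)))
          ≤⟨ first i ⟩
        R * (2 * d) ∎
        where open ≤-Reasoning

      near≤C : ∀ i → ∑ (λ e → ∑ (λ f → # (λ c → near₃ e f c i))) ≤ R * (2 * d) + R * (2 * d)
      near≤C i = begin
        ∑ (λ e → ∑ (λ f → # (λ c → near₃ e f c i)))
          ≤⟨ ∑-mono (λ e → ∑-mono (λ f → ∑-mono (λ c → bnd e f (is-just (match e f c))))) ⟩
        ∑ (λ e → ∑ (λ f → ∑ (λ c → a e f c + b e f c)))
          ≡⟨ ∑-cong (λ e → trans (∑-cong (λ f → ∑-+ (a e f) (b e f))) (∑-+ (λ f → ∑ (a e f)) (λ f → ∑ (b e f)))) ⟩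
        ∑ (λ e → ∑ (λ f → ∑ (a e f)) + ∑ (λ f → ∑ (b e f)))
          ≡⟨ ∑-+ (λ e → ∑ (λ f → ∑ (a e f))) (λ e → ∑ (λ f → ∑ (b e f))) ⟩
        ∑ (λ e → ∑ (λ f → ∑ (a e f))) + ∑ (λ e → ∑ (λ f → ∑ (b e f)))
          ≤⟨ +-mono-≤ (first i) (second i) ⟩
        R * (2 * d) + R * (2 * d) ∎
        where
        open ≤-Reasoning
        a b : Fin items → Fin items → Fin R → ℕ
        a e f c = ⟦ e == i ⟧ * ⟦ is-just (match e f c) ⟧
        b e f c = ⟦ f == i ⟧ * ⟦ is-just (match e f c) ⟧
        bnd : ∀ e f j → ⟦ j ∧ ((i == e) ∨ (i == f)) ⟧ ≤ ⟦ e == i ⟧ * ⟦ j ⟧ + ⟦ f == i ⟧ * ⟦ j ⟧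
        bnd e f false = z≤n
        bnd e f true rewrite ==-sym e i | ==-sym f i | *-identityʳ ⟦ i == e ⟧ | *-identityʳ ⟦ i == f ⟧ = ⟦∨⟧≤ (i == e) (i == f)

      -- Origin of the 32: an event reads two variables and has probability at most `1 / (R * R)`,
      -- and an item is the first item of at most `2 * d * R` events and the second of as many. The
      -- condition of the local lemma then becomes `32 * d ≤ R`.
      4VC≤ : 4 * (2 * (R * (2 * d) + R * (2 * d))) ≤ R * R
      4VC≤ = ≤-trans (≤-reflexive (reg R d)) (*-monoʳ-≤ R 32d≤)
        where
        reg : ∀ r d → 4 * (2 * (r * (2 * d) + r * (2 * d))) ≡ r * (32 * d)
        reg = solve-∀

      2<R² : 2 < R * R
      2<R² = ≤-trans (s≤s (s≤s (s≤s z≤n))) (*-mono-≤ (s≤s 1≤ℓ) (s≤s 1≤ℓ))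

      conflict : ∀ ω e f → match e f (lookup ω e) ≡ just (lookup ω f) → B₃ e f (lookup ω e) ω ≡ true
      conflict ω e f m rewrite m = ∧-true (==-refl (lookup ω e)) (==-refl (lookup ω f))

      outcome : Σ Ω λ ω → ∀ j → on B₃ j ω ≡ false
      outcome = LocalLemma.avoid zero (on B₃) (on near₃)
        (λ j → let e , f , c = index j in dep₃ e f c) 2 (R * (2 * d) + R * (2 * d)) (R * R)
        (λ j → let e , f , c = index j in near≤2 e f c)
        (λ i → ≤-trans (≤-reflexive (∑-on (λ e f c → ⟦ near₃ e f c i ⟧))) (near≤C i))
        (λ j → let e , f , c = index j in prob₃ e f c)
        4VC≤ 2<R²

    sparse-colouring : Colouring
    sparse-colouring = let ω , avoids = outcome in
      lookup ω , λ e f m → true≢false (conflict ω e f m)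
        (trans (sym (cong (λ b → b ω) (on-combine B₃ e f (lookup ω e)))) (avoids (combine e (combine f (lookup ω e)))))

  opaque
    unfolding ∑
    ∑-<ᵇ : ∀ R t → # {R} (λ x → toℕ x <ᵇ t) ≡ R ⊓ t
    ∑-<ᵇ zero    t       = refl
    ∑-<ᵇ (suc R) zero    = ∑-zero R
    ∑-<ᵇ (suc R) (suc t) = cong suc (∑-<ᵇ R t)

  -- One round of the nibble

  -- Variable (g , 0) is the tentative colour of g, activated when its value lies in Fin ℓ ⊆ Fin R.
  -- Variable (g , 1 + c) is a coin that deletes the colour c at g; its bias makes the expected
  -- number of deletions of every colour the same, namely 2 d / R.
  module Nibble {F : Frame} {ℓ : ℕ} (𝒞 : Conflict F ℓ) (r d x₀ : ℕ)
                (bound : Conflict.ColourDegreeBound 𝒞 d) where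
    open Frame F
    open Conflict 𝒞

    R = ℓ + r
    vars = items * suc ℓ
    Ω = Vec (Fin R) vars

    threshold : Fin items → Fin ℓ → ℕ
    threshold f c = 2 * d ∸ total f c

    picks : Maybe (Fin ℓ) → Fin R → Bool
    picks nothing  x = false
    picks (just c) x = x == (c ↑ˡ r)

    hit : Fin items → Fin (suc ℓ) → Fin R → Fin items → Fin ℓ → Bool
    hit g zero     x f c = picks (match f g c) x
    hit g (suc c₀) x f c = (g == f) ∧ ((c₀ == c) ∧ (toℕ x <ᵇ threshold f c))

    value : Ω → Fin items → Fin (suc ℓ) → Fin R
    value ω g j = lookup ω (combine g j)

    killed : Ω → Fin items → Fin ℓ → Bool
    killed ω f c = any (λ g → any (λ j → hit g j (value ω g j) f c))

    losses : Ω → Fin items → ℕ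
    losses ω f = # (λ c → killed ω f c)

    loses : Fin items → Ω → Bool
    loses e ω = x₀ <ᵇ losses ω e

    -- Only strictly earlier picks count, so of two conflicting picks the earlier one does not
    -- suffer from the later.
    forbidden : Ω → Fin items → Fin ℓ → Bool
    forbidden ω f c = any (λ g → (toℕ g <ᵇ toℕ f) ∧ hit g zero (value ω g zero) f c)

    accepts : Ω → Fin items → Fin R → Bool
    accepts ω f x = any (λ c → (x == (c ↑ˡ r)) ∧ not (forbidden ω f c))

    coloured : Ω → Fin items → Bool
    coloured ω f = accepts ω f (value ω f zero)

    -- Removal of f from the colour neighbourhood at v of (e , c), where c′ is the colour of f
    -- matched to c; deletions of c′ caused at v itself are not counted.
    removes : Fin vertices → Fin items → Fin (suc ℓ) → Fin R → Ω → Fin items → Maybe (Fin ℓ) → Bool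
    removes v g j        x ω f nothing   = false
    removes v g zero     x ω f (just c′) = ((g == f) ∧ accepts ω f x) ∨ (not (at v g) ∧ hit g zero x f c′)
    removes v g (suc c₀) x ω f (just c′) = hit g (suc c₀) x f c′

    process : Fin vertices → Fin items → Fin ℓ → Fin vars → Ω → Fin items → Bool
    process v e c i ω f = let g , j = remQuot {items} (suc ℓ) i in removes v g j (lookup ω i) ω f (match e f c)

    target : Fin vertices → Fin items → Fin ℓ → Fin items → Bool
    target v e c f = at v f ∧ is-just (match e f c)

    process-combine : ∀ v e c g j ω f →
      process v e c (combine g j) ω f ≡ removes v g j (value ω g j) ω f (match e f c)
    process-combine v e c g j ω f =
      cong (λ p → removes v (proj₁ p) (proj₂ p) (value ω g j) ω f (match e f c)) (remQuot-combine {items} {suc ℓ} g j)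

    picks-unique : ∀ f g x c₁ c₂ → picks (match f g c₁) x ≡ true → picks (match f g c₂) x ≡ true → c₁ ≡ c₂
    picks-unique f g x c₁ c₂ p q with match f g c₁ in m₁ | match f g c₂ in m₂
    ... | just a | just b = just-injective (trans (sym (match-sym f g c₁ a m₁))
            (trans (cong (match g f) (↑ˡ-injective r a b (trans (sym (==⇒≡ {i = x} p)) (==⇒≡ {i = x} q)))) (match-sym f g c₂ b m₂)))

    ∑-picks : ∀ x → # (λ y → picks x y) ≡ ⟦ is-just x ⟧
    ∑-picks nothing  = ∑-zero R
    ∑-picks (just c) = ∑-== (c ↑ˡ r)

    module _ (2d≤R : 2 * d ≤ R) where

      ∑-coin : ∀ f c → ∑ (λ g → ∑ (λ c₀ → # (λ x → hit g (suc c₀) x f c))) ≡ threshold f c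
      ∑-coin f c = begin
        ∑ (λ g → ∑ (λ c₀ → # (λ x → (g == f) ∧ ((c₀ == c) ∧ (toℕ x <ᵇ t)))))
          ≡⟨ ∑-cong (λ g → ∑-cong (λ c₀ → trans (∑-cong (λ x → trans (⟦∧⟧ (g == f) _) (cong (⟦ g == f ⟧ *_) (⟦∧⟧ (c₀ == c) _))))
               (trans (∑-*ˡ ⟦ g == f ⟧ (λ x → ⟦ c₀ == c ⟧ * ⟦ toℕ x <ᵇ t ⟧)) (cong (⟦ g == f ⟧ *_) (∑-*ˡ ⟦ c₀ == c ⟧ (λ x → ⟦ toℕ x <ᵇ t ⟧)))))) ⟩
        ∑ (λ g → ∑ (λ c₀ → ⟦ g == f ⟧ * (⟦ c₀ == c ⟧ * # {R} (λ x → toℕ x <ᵇ t))))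
          ≡⟨ ∑-cong (λ g → trans (∑-*ˡ ⟦ g == f ⟧ (λ c₀ → ⟦ c₀ == c ⟧ * # {R} (λ x → toℕ x <ᵇ t))) (cong (⟦ g == f ⟧ *_) (∑-δ c (λ _ → # {R} (λ x → toℕ x <ᵇ t))))) ⟩
        ∑ (λ g → ⟦ g == f ⟧ * # {R} (λ x → toℕ x <ᵇ t))
          ≡⟨ ∑-δ f (λ _ → # {R} (λ x → toℕ x <ᵇ t)) ⟩
        # {R} (λ x → toℕ x <ᵇ t)
          ≡⟨ ∑-<ᵇ R t ⟩
        R ⊓ t
          -- A coin has `R` values, enough for its full bias because `2 * d ≤ R`.
          ≡⟨ m≥n⇒m⊓n≡n (≤-trans (m∸n≤m (2 * d) (total f c)) 2d≤R) ⟩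
        t ∎
        where
        open ≡-Reasoning
        t = threshold f c

      ∑-hit : ∀ f c → ∑ (λ g → ∑ (λ j → # (λ x → hit g j x f c))) ≡ 2 * d
      ∑-hit f c = begin
        ∑ (λ g → ∑ (λ j → # (λ x → hit g j x f c)))
          ≡⟨ ∑-cong (λ g → ∑-suc (λ j → # (λ x → hit g j x f c))) ⟩
        ∑ (λ g → # (λ x → picks (match f g c) x) + ∑ (λ c₀ → # (λ x → hit g (suc c₀) x f c)))
          ≡⟨ ∑-+ (λ g → # (λ x → picks (match f g c) x)) _ ⟩
        ∑ (λ g → # (λ x → picks (match f g c) x)) + ∑ (λ g → ∑ (λ c₀ → # (λ x → hit g (suc c₀) x f c)))
          ≡⟨ cong₂ _+_ (∑-cong (λ g → ∑-picks (match f g c))) (∑-coin f c) ⟩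
        total f c + (2 * d ∸ total f c)
          ≡⟨ m+[n∸m]≡n (total≤ 𝒞 bound f c) ⟩
        2 * d ∎
        where open ≡-Reasoning

      hits : Fin items → Fin vars → Fin R → ℕ
      hits e i x = let g , j = remQuot {items} (suc ℓ) i in # (λ c → hit g j x e c)

      hits-combine : ∀ e g j x → hits e (combine g j) x ≡ # (λ c → hit g j x e c)
      hits-combine e g j x = cong (λ p → # (λ c → hit (proj₁ p) (proj₂ p) x e c)) (remQuot-combine {items} {suc ℓ} g j)

      -- A pick of `g` is matched to at most one colour of `e`, and a coin concerns one colour only.
      -- This is the bounded contribution that `UpperTail` asks for.
      hits≤1 : ∀ e i x → hits e i x ≤ 1
      hits≤1 e i x = go (proj₁ (remQuot {items} (suc ℓ) i)) (proj₂ (remQuot {items} (suc ℓ) i))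
        where
        go : ∀ g j → # (λ c → hit g j x e c) ≤ 1
        go g zero     = ∑-atMostOne (hit g zero x e) (picks-unique e g x)
        go g (suc c₀) = ∑-atMostOne (hit g (suc c₀) x e) (λ c₁ c₂ p q →
          trans (sym (==⇒≡ {i = c₀} (∧-trueˡ {c₀ == c₁} (∧-trueʳ {g == e} p)))) (==⇒≡ {i = c₀} (∧-trueˡ {c₀ == c₂} (∧-trueʳ {g == e} q))))

      ∑-hits : ∀ e → ∑ (λ i → ∑ (hits e i)) ≡ ℓ * (2 * d)
      ∑-hits e = begin
        ∑ (λ i → ∑ (hits e i))
          ≡⟨ ∑-combine items (suc ℓ) (λ i → ∑ (hits e i)) ⟩
        ∑ (λ g → ∑ (λ j → ∑ (hits e (combine g j))))
          ≡⟨ ∑-cong (λ g → ∑-cong (λ j → trans (∑-cong (hits-combine e g j)) (∑-swap (λ x c → ⟦ hit g j x e c ⟧)))) ⟩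
        ∑ (λ g → ∑ (λ j → ∑ (λ c → # (λ x → hit g j x e c))))
          ≡⟨ ∑-cong (λ g → ∑-swap (λ j c → # (λ x → hit g j x e c))) ⟩
        ∑ (λ g → ∑ (λ c → ∑ (λ j → # (λ x → hit g j x e c))))
          ≡⟨ ∑-swap (λ g c → ∑ (λ j → # (λ x → hit g j x e c))) ⟩
        ∑ (λ c → ∑ (λ g → ∑ (λ j → # (λ x → hit g j x e c))))
          ≡⟨ trans (∑-cong (λ c → ∑-hit e c)) (∑-const ℓ (2 * d)) ⟩
        ℓ * (2 * d) ∎
        where open ≡-Reasoning

      losses≤ : ∀ ω e → losses ω e ≤ ∑ (λ i → hits e i (lookup ω i))
      losses≤ ω e = begin
        # (λ c → killed ω e c)
          ≤⟨ ∑-mono (λ c → ≤-trans (⟦any⟧≤∑ (λ g → any (λ j → hit g j (value ω g j) e c))) (∑-mono (λ g → ⟦any⟧≤∑ (λ j → hit g j (value ω g j) e c)))) ⟩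
        ∑ (λ c → ∑ (λ g → # (λ j → hit g j (value ω g j) e c)))
          ≡⟨ ∑-swap (λ c g → # (λ j → hit g j (value ω g j) e c)) ⟩
        ∑ (λ g → ∑ (λ c → # (λ j → hit g j (value ω g j) e c)))
          ≡⟨ ∑-cong (λ g → ∑-swap (λ c j → ⟦ hit g j (value ω g j) e c ⟧)) ⟩
        ∑ (λ g → ∑ (λ j → # (λ c → hit g j (value ω g j) e c)))
          ≡⟨ ∑-cong (λ g → ∑-cong (λ j → hits-combine e g j (value ω g j))) ⟨
        ∑ (λ g → ∑ (λ j → hits e (combine g j) (lookup ω (combine g j))))
          ≡⟨ ∑-combine items (suc ℓ) (λ i → hits e i (lookup ω i)) ⟨
        ∑ (λ i → hits e i (lookup ω i)) ∎
        where open ≤-Reasoning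

      losses-tail : ∀ M j k {{_ : NonZero M}} {{_ : NonZero R}} →
        ℓ * (2 * d) + M * R * k ≤ j * suc x₀ → j * suc M ≤ M * R →
        ∀ e → #Ω R (λ ω → loses e ω) * 2 ^ k ≤ R ^ vars
      losses-tail M j k c₁ c₂ e = UpperTail.tail R M (hits e) (hits≤1 e) (suc x₀) (ℓ * (2 * d)) j k
        (≤-reflexive (∑-hits e)) c₁ c₂ (loses e) (λ ω p → ≤-trans (<ᵇ-true⁻ p) (losses≤ ω e))

      -- Variables are numbered item by item, so the picks of items before `f`, which are all that
      -- `accepts` consults, precede the pick of `f`.
      process-adapted : ∀ v e c → Adapted (process v e c)
      process-adapted v e c i ω ω′ agree f =
        go (proj₁ (remQuot {items} (suc ℓ) i)) (proj₂ (remQuot {items} (suc ℓ) i)) (combine-remQuot {items} (suc ℓ) i) (match e f c)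
        where
        go : ∀ g j → combine g j ≡ i → ∀ x → removes v g j (lookup ω i) ω f x ≡ removes v g j (lookup ω′ i) ω′ f x
        go g j eq nothing = refl
        go g (suc c₀) eq (just c′) rewrite agree i ≤-refl = refl
        go g zero eq (just c′) rewrite agree i ≤-refl with g == f in g≟f
        ... | false = refl
        ... | true  = cong (_∨ (not (at v g) ∧ hit g zero (lookup ω′ i) f c′))
              (any-cong (λ c₀ → cong (λ b → (lookup ω′ i == (c₀ ↑ˡ r)) ∧ not b) (any-cong (earlier c₀))))
          where
          earlier : ∀ c₀ g′ → (toℕ g′ <ᵇ toℕ f) ∧ hit g′ zero (value ω g′ zero) f c₀
                            ≡ (toℕ g′ <ᵇ toℕ f) ∧ hit g′ zero (value ω′ g′ zero) f c₀
          earlier c₀ g′ with toℕ g′ <ᵇ toℕ f in lt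
          ... | false = refl
          ... | true  = cong (λ x → hit g′ zero x f c₀) (agree (combine g′ zero)
                (subst (combine g′ zero ≤F_) (trans (cong (λ h → combine h zero) (sym (==⇒≡ {i = g} {f} g≟f))) eq)
                  (<⇒≤ (combine-monoˡ-< {items} {suc ℓ} {g′} {f} zero zero (<ᵇ-true⁻ lt)))))

      -- A coin, or the pick of an item at `v`, can remove only its own item. The pick of an item
      -- `g` away from `v` reaches items at `v` only through an end of `g`, and by simplicity at
      -- most one item joins `v` to that end.
      process≤2 : ∀ v e c i ω → # (λ f → target v e c f ∧ process v e c i ω f) ≤ 2
      process≤2 v e c i ω = go (proj₁ (remQuot {items} (suc ℓ) i)) (proj₂ (remQuot {items} (suc ℓ) i))
        where
        open ≤-Reasoning
        x = lookup ω i
        go : ∀ g j → # (λ f → (at v f ∧ is-just (match e f c)) ∧ removes v g j x ω f (match e f c)) ≤ 2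
        go g (suc c₀) = ≤-trans (∑-mono (λ f → ⟦⟧-mono (λ p → only f (match e f c) (∧-trueʳ {at v f ∧ is-just (match e f c)} p)))) (≤-trans (≤-reflexive (∑-== g)) (n≤1+n 1))
          where
          only : ∀ f y → removes v g (suc c₀) x ω f y ≡ true → (f == g) ≡ true
          only f (just c′) p = trans (==-sym f g) (∧-trueˡ {g == f} p)
        go g zero with at v g in atg
        ... | true = ≤-trans (∑-mono (λ f → ⟦⟧-mono (λ p → only f (match e f c) (∧-trueʳ {at v f ∧ is-just (match e f c)} p)))) (≤-trans (≤-reflexive (∑-== g)) (n≤1+n 1))
          where
          only : ∀ f y → removes v g zero x ω f y ≡ true → (f == g) ≡ true
          only f (just c′) p rewrite atg with ∨-elim {(g == f) ∧ accepts ω f x} p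
          ... | inj₁ q = trans (==-sym f g) (∧-trueˡ {g == f} q)
          ... | inj₂ ()
        ... | false = begin
          # (λ f → (at v f ∧ is-just (match e f c)) ∧ removes v g zero x ω f (match e f c))
            ≤⟨ ∑-mono (λ f → ≤-trans (⟦⟧-mono (λ p → ends f (match e f c) (∧-trueˡ {at v f} (∧-trueˡ {at v f ∧ is-just (match e f c)} p)) (∧-trueʳ {at v f ∧ is-just (match e f c)} p))) (⟦∨⟧≤ (through (end₁ g) f) (through (end₂ g) f))) ⟩
          ∑ (λ f → ⟦ through (end₁ g) f ⟧ + ⟦ through (end₂ g) f ⟧)
            ≡⟨ ∑-+ (λ f → ⟦ through (end₁ g) f ⟧) _ ⟩
          # (λ f → through (end₁ g) f) + # (λ f → through (end₂ g) f)
            ≤⟨ +-mono-≤ (one (end₁ g)) (one (end₂ g)) ⟩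
          2 ∎
          where
          through : Fin vertices → Fin items → Bool
          through w f = (at w g ∧ at w f) ∧ at v f
          one : ∀ w → # (λ f → through w f) ≤ 1
          one w = ∑-atMostOne (through w) (λ f f′ p q → simple v w f f′
            (λ { refl → true≢false (∧-trueˡ (∧-trueˡ {at w g ∧ at w f} p)) atg })
            (∧-trueʳ {at w g ∧ at w f} p) (∧-trueʳ {at w g} (∧-trueˡ p))
            (∧-trueʳ {at w g ∧ at w f′} q) (∧-trueʳ {at w g} (∧-trueˡ q)))
          ends : ∀ f y → at v f ≡ true → removes v g zero x ω f y ≡ true → through (end₁ g) f ∨ through (end₂ g) f ≡ true
          ends f (just c′) vf p with ∨-elim {(g == f) ∧ accepts ω f x} p
          ... | inj₁ q = ⊥-elim (true≢false vf (trans (cong (at v) (sym (==⇒≡ (∧-trueˡ {g == f} q)))) atg))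
          ... | inj₂ q with match f g c′ in m | ∧-trueʳ {not (at v g)} q
          ...   | just c″ | _ with w , wf , wg ← match-at f g c′ c″ m with at-ends w g wg
          ...     | inj₁ refl = ∨-trueˡ (∧-true (∧-true wg wf) vf)
          ...     | inj₂ refl = ∨-trueʳ {through (end₁ g) f} (∧-true (∧-true wg wf) vf)

      -- A forbidden colour is in particular killed, so the bound on losses leaves at least `ℓ ∸ x₀`
      -- colours whose pick would be kept.
      ∑-accepts : ∀ ω f → losses ω f ≤ x₀ → ℓ ∸ x₀ ≤ # (λ x → accepts ω f x)
      ∑-accepts ω f le = begin
        ℓ ∸ x₀
          ≤⟨ ∸-monoʳ-≤ ℓ (≤-trans (∑-mono (λ c → ⟦⟧-mono (forbidden⇒killed c))) le) ⟩
        ℓ ∸ # (λ c → forbidden ω f c)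
          ≤⟨ m≤n+o⇒m∸n≤o ℓ (# (λ c → forbidden ω f c)) (≤-reflexive (sym split)) ⟩
        # (λ c → not (forbidden ω f c))
          ≤⟨ ∑-mono (λ c → ⟦⟧-mono (λ p → any-intro (λ c₀ → ((c ↑ˡ r) == (c₀ ↑ˡ r)) ∧ not (forbidden ω f c₀)) c (∧-true (==-refl (c ↑ˡ r)) p))) ⟩
        # (λ c → accepts ω f (c ↑ˡ r))
          ≤⟨ m≤m+n _ _ ⟩
        # (λ c → accepts ω f (c ↑ˡ r)) + # (λ y → accepts ω f (ℓ ↑ʳ y))
          ≡⟨ ∑-↑ ℓ r (λ x → ⟦ accepts ω f x ⟧) ⟨
        # (λ x → accepts ω f x) ∎
        where
        open ≤-Reasoning
        forbidden⇒killed : ∀ c → forbidden ω f c ≡ true → killed ω f c ≡ true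
        forbidden⇒killed c p = let g , q = any-elim _ p in
          any-intro _ g (any-intro (λ j → hit g j (value ω g j) f c) zero (∧-trueʳ {toℕ g <ᵇ toℕ f} q))
        split : # (λ c → forbidden ω f c) + # (λ c → not (forbidden ω f c)) ≡ ℓ
        split = trans (sym (∑-+ (λ c → ⟦ forbidden ω f c ⟧) _))
          (trans (∑-cong (λ c → ⟦not⟧ (forbidden ω f c))) (trans (∑-const ℓ 1) (*-identityʳ ℓ)))

      -- Needed because `chances` resets the pick of `f`: being forbidden depends on strictly
      -- earlier items, so the set of acceptable picks is unaffected.
      accepts-update : ∀ ω f y x → accepts (ω [ combine f zero ]≔ y) f x ≡ accepts ω f x
      accepts-update ω f y x = any-cong (λ c → cong (λ b → (x == (c ↑ˡ r)) ∧ not b) (any-cong (same c)))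
        where
        same : ∀ c g → (toℕ g <ᵇ toℕ f) ∧ hit g zero (value (ω [ combine f zero ]≔ y) g zero) f c
                     ≡ (toℕ g <ᵇ toℕ f) ∧ hit g zero (value ω g zero) f c
        same c g with toℕ g <ᵇ toℕ f in lt
        ... | false = refl
        ... | true  = cong (λ z → hit g zero z f c) (lookup∘update′ {i = combine g zero} {j = combine f zero}
                        (λ eq → <⇒≢ (<ᵇ-true⁻ lt) (cong toℕ (combine-injectiveˡ g zero f zero eq))) ω y)

      -- `A` counts picks of `f` that are kept, `B` picks away from `v` that delete the matched
      -- colour, and `C` the coin. By the choice of the coin, `B + C` is `2 * d` minus the conflicts
      -- of `f` at `v`, of which there are at most `d`; `A` adds the `ℓ ∸ x₀`. Without the coin, `B`
      -- would have no lower bound.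
      chances≥ : ∀ v e c ω f → target v e c f ≡ true → losses ω f ≤ x₀ →
                 ℓ ∸ x₀ + d ≤ chances (process v e c) ω f
      chances≥ v e c ω f tf le with c′ , mf ← is-just-elim (∧-trueʳ {at v f} tf) = begin
        ℓ ∸ x₀ + d
          ≤⟨ +-cancelʳ-≤ d _ _ enough ⟩
        A + B + C
          ≡⟨ trans (cong (_+ C) (sym (∑-+ (λ g → # (λ x → a g x)) (λ g → # (λ x → b g x))))) (sym (∑-+ (λ g → # (λ x → a g x) + # (λ x → b g x)) _)) ⟩
        ∑ (λ g → # (λ x → a g x) + # (λ x → b g x) + ∑ (λ c₀ → # (λ x → hit g (suc c₀) x f c′)))
          ≡⟨ ∑-cong (λ g → cong₂ _+_ (trans (sym (∑-+ (λ x → ⟦ a g x ⟧) (λ x → ⟦ b g x ⟧))) (∑-cong (λ x → sym (exclusive g x)))) refl) ⟩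
        ∑ (λ g → # (λ x → a g x ∨ b g x) + ∑ (λ c₀ → # (λ x → hit g (suc c₀) x f c′)))
          ≡⟨ ∑-cong (λ g → ∑-suc (λ j → # (λ x → step g j x))) ⟨
        ∑ (λ g → ∑ (λ j → # (λ x → step g j x)))
          ≡⟨ ∑-cong (λ g → ∑-cong (λ j → ∑-cong (λ x → cong ⟦_⟧ (sym (unfold g j x))))) ⟩
        ∑ (λ g → ∑ (λ j → # (λ x → process v e c (combine g j) (ω [ combine g j ]≔ x) f)))
          ≡⟨ ∑-combine items (suc ℓ) (λ i → # (λ x → process v e c i (ω [ i ]≔ x) f)) ⟨
        ∑ (λ i → # (λ x → process v e c i (ω [ i ]≔ x) f)) ∎
        where
        open ≤-Reasoning
        a b : Fin items → Fin R → Bool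
        a g x = (g == f) ∧ accepts ω f x
        b g x = not (at v g) ∧ hit g zero x f c′
        step : Fin items → Fin (suc ℓ) → Fin R → Bool
        step g zero     x = a g x ∨ b g x
        step g (suc c₀) x = hit g (suc c₀) x f c′
        A = ∑ (λ g → # (λ x → a g x))
        B = ∑ (λ g → # (λ x → b g x))
        C = ∑ (λ g → ∑ (λ c₀ → # (λ x → hit g (suc c₀) x f c′)))
        vf : at v f ≡ true
        vf = ∧-trueˡ tf
        exclusive : ∀ g x → ⟦ a g x ∨ b g x ⟧ ≡ ⟦ a g x ⟧ + ⟦ b g x ⟧
        exclusive g x = disjoint (a g x) (b g x) λ p → cong (λ t → not t ∧ hit g zero x f c′)
          (trans (cong (at v) (==⇒≡ {i = g} {f} (∧-trueˡ p))) vf)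
          where
          disjoint : ∀ p q → (p ≡ true → q ≡ false) → ⟦ p ∨ q ⟧ ≡ ⟦ p ⟧ + ⟦ q ⟧
          disjoint false q h = refl
          disjoint true  q h rewrite h refl = refl
        unfold : ∀ g j x → process v e c (combine g j) (ω [ combine g j ]≔ x) f ≡ step g j x
        unfold g j x = trans (process-combine v e c g j (ω [ combine g j ]≔ x) f)
          (trans (cong₂ (λ y m → removes v g j y (ω [ combine g j ]≔ x) f m) (lookup∘update (combine g j) ω x) mf) (go j))
          where
          go : ∀ j → removes v g j x (ω [ combine g j ]≔ x) f (just c′) ≡ step g j x
          go (suc c₀) = refl
          go zero = cong (_∨ b g x) (own (g == f) refl)
            where
            own : ∀ t → (g == f) ≡ t → t ∧ accepts (ω [ combine g zero ]≔ x) f x ≡ t ∧ accepts ω f x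
            own false _ = refl
            own true  p = trans (cong (λ h → accepts (ω [ combine h zero ]≔ x) f x) (==⇒≡ {i = g} {f} p)) (accepts-update ω f x x)
        A≥ : ℓ ∸ x₀ ≤ A
        A≥ = ≤-trans (∑-accepts ω f le) (≤-trans (≤-reflexive (∑-cong (λ x → cong (λ t → ⟦ t ∧ accepts ω f x ⟧) (sym (==-refl f)))))
               (term≤∑ (λ g → # (λ x → a g x)) f))
        B+at : B + totalAt v f c′ ≡ total f c′
        B+at = trans (cong (_+ totalAt v f c′) (∑-cong (λ g → trans (∑-cong (λ x → ⟦∧⟧ (not (at v g)) (hit g zero x f c′)))
                 (trans (∑-*ˡ ⟦ not (at v g) ⟧ (λ x → ⟦ hit g zero x f c′ ⟧)) (cong (⟦ not (at v g) ⟧ *_) (∑-picks (match f g c′)))))))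
               (trans (sym (∑-+ (λ g → ⟦ not (at v g) ⟧ * ⟦ is-just (match f g c′) ⟧) (λ g → ⟦ at v g ∧ is-just (match f g c′) ⟧)))
                 (∑-cong (λ g → split (at v g) (is-just (match f g c′)))))
          where
          split : ∀ p q → ⟦ not p ⟧ * ⟦ q ⟧ + ⟦ p ∧ q ⟧ ≡ ⟦ q ⟧
          split true  q = refl
          split false q = trans (+-identityʳ _) (+-identityʳ _)
        enough : ℓ ∸ x₀ + d + d ≤ A + B + C + d
        enough = begin
          ℓ ∸ x₀ + d + d ≡⟨ reg₁ (ℓ ∸ x₀) d ⟩
          ℓ ∸ x₀ + 2 * d ≡⟨ cong (ℓ ∸ x₀ +_) (m+[n∸m]≡n (total≤ 𝒞 bound f c′)) ⟨
          ℓ ∸ x₀ + (total f c′ + threshold f c′) ≤⟨ +-monoˡ-≤ _ A≥ ⟩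
          A + (total f c′ + threshold f c′) ≡⟨ cong₂ (λ s t → A + (s + t)) B+at (∑-coin f c′) ⟨
          A + (B + totalAt v f c′ + C) ≤⟨ +-monoʳ-≤ A (+-monoˡ-≤ C (+-monoʳ-≤ B (bound v f c′ vf))) ⟩
          A + (B + d + C) ≡⟨ reg₂ A B d C ⟩
          A + B + C + d ∎
          where
          reg₁ : ∀ a d → a + d + d ≡ a + 2 * d
          reg₁ = solve-∀
          reg₂ : ∀ a b d c → a + (b + d + c) ≡ a + b + c + d
          reg₂ = solve-∀

  -- The local lemma applied to one round

  module NibbleOutcome {F : Frame} {ℓ : ℕ} (𝒞 : Conflict F ℓ) (r d x₀ d′ D : ℕ)
      (bound : Conflict.ColourDegreeBound 𝒞 d) (degree : Frame.DegreeBound F D)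
      (o : Fin (ℓ + r)) (2d≤R : 2 * d ≤ ℓ + r)
      (k M j₁ L j₂ q : ℕ) {{_ : NonZero M}} {{_ : NonZero L}}
      (loss₁ : ℓ * (2 * d) + M * (ℓ + r) * k ≤ j₁ * suc x₀)
      (loss₂ : j₁ * suc M ≤ M * (ℓ + r))
      (surv₁ : (d ∸ d′) * j₂ + (2 + L) * (ℓ + r) * k ≤ suc d′ * (ℓ ∸ x₀ + d))
      (surv₂ : (2 + L) * (ℓ + r) ≤ L * j₂)
      (lll₁ : suc (2 * ℓ) * q ≤ 2 ^ k)
      (lll₂ : 4 * (suc (2 * D) * suc (2 * D) * suc ℓ * (suc (2 * D) * suc (2 * D))) ≤ q)
      (2<q : 2 < q) where
    open Frame F
    open Conflict 𝒞
    open Nibble 𝒞 r d x₀ bound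

    private
      instance
        R≢0 : NonZero (ℓ + r)
        R≢0 = nonZeroIndex o

    survivors : Fin vertices → Fin items → Fin ℓ → Ω → ℕ
    survivors v e c ω = # (λ f → survives (target v e c) (process v e c) ω f)

    -- The clause on `loses` is built in because `chances≥` needs few losses at the items concerned.
    -- When no item loses too much it holds by itself, so avoiding `crowded` then does bound the
    -- survivors.
    crowded : Fin vertices → Fin items → Fin ℓ → Ω → Bool
    crowded v e c ω = at v e ∧ (not (any (λ f → at v f ∧ loses f ω)) ∧ (d′ <ᵇ survivors v e c ω))

    crowded-tail : ∀ v e c → #Ω R (λ ω → crowded v e c ω) * 2 ^ k ≤ R ^ vars
    crowded-tail v e c with at v e in ve
    ... | false = ≤-trans (≤-reflexive (cong (_* 2 ^ k) (∑Ω-zero vars))) z≤n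
    ... | true  = Survivors.tail o L (process v e c) (target v e c) (process-adapted 2d≤R v e c) (process≤2 2d≤R v e c)
        (suc d′) (d ∸ d′) (suc d′ * κ) j₂ k
        (≤-trans (bound v e c ve) (≤-trans (m≤n+m∸n d d′) (n≤1+n _)))
        surv₁ surv₂ P few many
      where
      open ≤-Reasoning
      κ = ℓ ∸ x₀ + d
      P : Ω → Bool
      P ω = not (any (λ f → at v f ∧ loses f ω)) ∧ (d′ <ᵇ survivors v e c ω)
      few : ∀ ω → P ω ≡ true → suc d′ ≤ survivors v e c ω
      few ω p = <ᵇ-true⁻ (∧-trueʳ {not (any (λ f → at v f ∧ loses f ω))} p)
      many : ∀ ω → P ω ≡ true → suc d′ * κ ≤ ∑ (λ f → ⟦ survives (target v e c) (process v e c) ω f ⟧ * chances (process v e c) ω f)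
      many ω p = begin
        suc d′ * κ
          ≤⟨ *-monoˡ-≤ κ (few ω p) ⟩
        survivors v e c ω * κ
          ≡⟨ ∑-*ʳ (λ f → ⟦ survives (target v e c) (process v e c) ω f ⟧) κ ⟨
        ∑ (λ f → ⟦ survives (target v e c) (process v e c) ω f ⟧ * κ)
          ≤⟨ ∑-mono per-f ⟩
        ∑ (λ f → ⟦ survives (target v e c) (process v e c) ω f ⟧ * chances (process v e c) ω f) ∎
        where
        scale : ∀ a b {m n} → (a ≡ true → m ≤ n) → ⟦ a ∧ b ⟧ * m ≤ ⟦ a ∧ b ⟧ * n
        scale true  b h = *-monoʳ-≤ ⟦ b ⟧ (h refl)
        scale false b h = z≤n
        per-f : ∀ f → ⟦ survives (target v e c) (process v e c) ω f ⟧ * κ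
                    ≤ ⟦ survives (target v e c) (process v e c) ω f ⟧ * chances (process v e c) ω f
        per-f f = scale (target v e c f) (not (any (λ i → process v e c i ω f))) λ tf → (chances≥ 2d≤R v e c ω f tf (<ᵇ-false⁻
                (¬true⇒false λ l → true≢false
                  (any-intro (λ f → at v f ∧ loses f ω) f (∧-true (∧-trueˡ {at v f} tf) l))
                  (not-true (∧-trueˡ {not (any (λ f → at v f ∧ loses f ω))} p)))))

    crowded′ : Fin items → Ω → Fin ℓ → Bool
    crowded′ e ω c = crowded (end₁ e) e c ω ∨ crowded (end₂ e) e c ω

    bad : Fin items → Ω → Bool
    bad e ω = loses e ω ∨ any (crowded′ e ω)

    -- A union bound over one loss event and two crowding events for each colour, hence the factor
    -- `suc (2 * ℓ)`.
    bad-tail : ∀ e → #Ω R (λ ω → bad e ω) * q ≤ R ^ vars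
    bad-tail e = *-cancelˡ-≤ (suc (2 * ℓ)) (begin
      suc (2 * ℓ) * (#Ω R (λ ω → bad e ω) * q)
        ≡⟨ x∙yz≈y∙xz (suc (2 * ℓ)) (#Ω R (λ ω → bad e ω)) q ⟩
      #Ω R (λ ω → bad e ω) * (suc (2 * ℓ) * q)
        ≤⟨ *-monoʳ-≤ (#Ω R (λ ω → bad e ω)) lll₁ ⟩
      #Ω R (λ ω → bad e ω) * 2 ^ k
        ≤⟨ *-monoˡ-≤ (2 ^ k) union ⟩
      (a + ∑ (λ c → b₁ c + b₂ c)) * 2 ^ k
        ≡⟨ trans (*-distribʳ-+ (2 ^ k) a _) (cong (a * 2 ^ k +_) (sym (∑-*ʳ (λ c → b₁ c + b₂ c) (2 ^ k)))) ⟩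
      a * 2 ^ k + ∑ (λ c → (b₁ c + b₂ c) * 2 ^ k)
        ≤⟨ +-mono-≤ (losses-tail 2d≤R M j₁ k loss₁ loss₂ e) (∑-≤const (2 * R ^ vars) two) ⟩
      R ^ vars + ℓ * (2 * R ^ vars)
        ≡⟨ reg₂ ℓ (R ^ vars) ⟩
      suc (2 * ℓ) * R ^ vars ∎)
      where
      open ≤-Reasoning
      a = #Ω R (λ ω → loses e ω)
      b₁ b₂ : Fin ℓ → ℕ
      b₁ c = #Ω R (λ ω → crowded (end₁ e) e c ω)
      b₂ c = #Ω R (λ ω → crowded (end₂ e) e c ω)
      reg₂ : ∀ l p → p + l * (2 * p) ≡ (1 + 2 * l) * p
      reg₂ = solve-∀
      two : ∀ c → (b₁ c + b₂ c) * 2 ^ k ≤ 2 * R ^ vars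
      two c = begin
        (b₁ c + b₂ c) * 2 ^ k ≡⟨ *-distribʳ-+ (2 ^ k) (b₁ c) (b₂ c) ⟩
        b₁ c * 2 ^ k + b₂ c * 2 ^ k ≤⟨ +-mono-≤ (crowded-tail (end₁ e) e c) (crowded-tail (end₂ e) e c) ⟩
        R ^ vars + R ^ vars ≡⟨ cong (R ^ vars +_) (+-identityʳ _) ⟨
        2 * R ^ vars ∎
      union : #Ω R (λ ω → bad e ω) ≤ a + ∑ (λ c → b₁ c + b₂ c)
      union = begin
        #Ω R (λ ω → bad e ω)
          ≤⟨ ∑Ω-mono (λ ω → ≤-trans (⟦∨⟧≤ (loses e ω) _) (+-monoʳ-≤ ⟦ loses e ω ⟧ (≤-trans (⟦any⟧≤∑ (crowded′ e ω)) (∑-mono (λ c → ⟦∨⟧≤ (crowded (end₁ e) e c ω) (crowded (end₂ e) e c ω)))))) ⟩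
        ∑Ω R (λ ω → ⟦ loses e ω ⟧ + ∑ (λ c → ⟦ crowded (end₁ e) e c ω ⟧ + ⟦ crowded (end₂ e) e c ω ⟧))
          ≡⟨ ∑Ω-+ (λ ω → ⟦ loses e ω ⟧) _ ⟩
        a + ∑Ω R (λ ω → ∑ (λ c → ⟦ crowded (end₁ e) e c ω ⟧ + ⟦ crowded (end₂ e) e c ω ⟧))
          ≡⟨ cong (a +_) (trans (∑Ω-∑ (λ c ω → ⟦ crowded (end₁ e) e c ω ⟧ + ⟦ crowded (end₂ e) e c ω ⟧)) (∑-cong (λ c → ∑Ω-+ (λ ω → ⟦ crowded (end₁ e) e c ω ⟧) _))) ⟩
        a + ∑ (λ c → b₁ c + b₂ c) ∎

    neighbour : Fin items → Fin items → Bool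
    neighbour e f = (e == f) ∨ any (λ v → at v e ∧ at v f)

    neighbour-sym : ∀ e f → neighbour e f ≡ neighbour f e
    neighbour-sym e f = cong₂ _∨_ (==-sym e f) (any-cong (λ v → ∧-comm (at v e) (at v f)))

    neighbour-at : ∀ {v e f} → at v e ≡ true → at v f ≡ true → neighbour e f ≡ true
    neighbour-at {v} {e} {f} p q = ∨-trueʳ {e == f} (any-intro (λ v → at v e ∧ at v f) v (∧-true p q))

    W : ℕ
    W = suc (2 * D)

    neighbours≤ : ∀ e → # (λ f → neighbour e f) ≤ W
    neighbours≤ e = begin
      # (λ f → neighbour e f)
        ≤⟨ ∑-mono (λ f → ⟦⟧≤ (cover f)) ⟩
      ∑ (λ f → ⟦ f == e ⟧ + (⟦ at (end₁ e) f ⟧ + ⟦ at (end₂ e) f ⟧))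
        ≡⟨ trans (∑-+ (λ f → ⟦ f == e ⟧) _) (cong₂ _+_ (∑-== e) (∑-+ (λ f → ⟦ at (end₁ e) f ⟧) _)) ⟩
      1 + (# (λ f → at (end₁ e) f) + # (λ f → at (end₂ e) f))
        ≤⟨ +-monoʳ-≤ 1 (+-mono-≤ (degree (end₁ e)) (≤-trans (degree (end₂ e)) (m≤m+n D 0))) ⟩
      W ∎
      where
      open ≤-Reasoning
      cover : ∀ f → neighbour e f ≡ true → 1 ≤ ⟦ f == e ⟧ + (⟦ at (end₁ e) f ⟧ + ⟦ at (end₂ e) f ⟧)
      cover f p with ∨-elim {e == f} p
      ... | inj₁ q = ≤-trans (≡true⇒1≤ (trans (==-sym f e) q)) (m≤m+n _ _)
      ... | inj₂ q with v , s ← any-elim (λ v → at v e ∧ at v f) q with at-ends v e (∧-trueˡ s)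
      ...   | inj₁ refl = ≤-trans (≤-trans (≡true⇒1≤ (∧-trueʳ {at v e} s)) (m≤m+n _ _)) (m≤n+m _ ⟦ f == e ⟧)
      ...   | inj₂ refl = ≤-trans (≤-trans (≡true⇒1≤ (∧-trueʳ {at v e} s)) (m≤n+m _ ⟦ at (end₁ e) f ⟧)) (m≤n+m _ ⟦ f == e ⟧)

    within2 : Fin items → Fin items → Bool
    within2 e x = any (λ f → neighbour e f ∧ neighbour f x)

    -- `bad e` asks about losses and removals of neighbours of `e`, and these are determined by the
    -- variables of the neighbours of those neighbours.
    near : Fin items → Fin vars → Bool
    near e i = within2 e (proj₁ (remQuot {items} (suc ℓ) i))

    within2≤ : ∀ e → # (λ x → within2 e x) ≤ W * W
    within2≤ e = ≤-trans (∑-⟦∧⟧-any≤ (neighbour e) neighbour W neighbours≤) (*-monoˡ-≤ W (neighbours≤ e))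

    near≤V : ∀ e → # (λ i → near e i) ≤ W * W * suc ℓ
    near≤V e = begin
      # (λ i → near e i)
        ≡⟨ ∑-combine items (suc ℓ) (λ i → ⟦ near e i ⟧) ⟩
      ∑ (λ x → # (λ j → near e (combine x j)))
        ≡⟨ ∑-cong (λ x → trans (∑-cong (λ j → cong (λ p → ⟦ within2 e (proj₁ p) ⟧) (remQuot-combine {items} {suc ℓ} x j)))
             (trans (∑-const (suc ℓ) ⟦ within2 e x ⟧) (*-comm (suc ℓ) _))) ⟩
      ∑ (λ x → ⟦ within2 e x ⟧ * suc ℓ)
        ≡⟨ ∑-*ʳ (λ x → ⟦ within2 e x ⟧) (suc ℓ) ⟩
      # (λ x → within2 e x) * suc ℓ
        ≤⟨ *-monoˡ-≤ (suc ℓ) (within2≤ e) ⟩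
      W * W * suc ℓ ∎
      where open ≤-Reasoning

    near≤C : ∀ i → # (λ e → near e i) ≤ W * W
    near≤C i = ≤-trans (≤-reflexive (∑-cong (λ e → cong ⟦_⟧ (any-cong (λ f →
        trans (∧-comm (neighbour e f) (neighbour f x)) (cong₂ _∧_ (neighbour-sym f x) (neighbour-sym e f)))))))
        (within2≤ x)
      where x = proj₁ (remQuot {items} (suc ℓ) i)

    module _ (ω ω′ : Ω) where

      Agree : Fin items → Set
      Agree f = ∀ g j → neighbour f g ≡ true → value ω g j ≡ value ω′ g j

      hit-dep : ∀ f → Agree f → ∀ g j c → hit g j (value ω g j) f c ≡ hit g j (value ω′ g j) f c
      hit-dep f ag g zero c with match f g c in m
      ... | nothing = refl
      ... | just c′ with v , vf , vg ← match-at f g c c′ m = cong (_== (c′ ↑ˡ r)) (ag g zero (neighbour-at vf vg))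
      hit-dep f ag g (suc c₀) c = ∧-congʳ (g == f) λ g≟f → cong (λ x → (c₀ == c) ∧ (toℕ x <ᵇ threshold f c))
              (ag g (suc c₀) (∨-trueˡ (trans (==-sym f g) g≟f)))

      losses-dep : ∀ f → Agree f → losses ω f ≡ losses ω′ f
      losses-dep f ag = ∑-cong (λ c → cong ⟦_⟧ (killed-dep c))
        where
        killed-dep : ∀ c → killed ω f c ≡ killed ω′ f c
        killed-dep c = any-cong {p = λ g → any (λ j → hit g j (value ω g j) f c)} {q = λ g → any (λ j → hit g j (value ω′ g j) f c)}
          (λ g → any-cong {p = λ j → hit g j (value ω g j) f c} {q = λ j → hit g j (value ω′ g j) f c} (λ j → hit-dep f ag g j c))

      accepts-dep : ∀ f → Agree f → ∀ x → accepts ω f x ≡ accepts ω′ f x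
      accepts-dep f ag x = any-cong (λ c → cong (λ b → (x == (c ↑ˡ r)) ∧ not b)
        (any-cong (λ g → cong ((toℕ g <ᵇ toℕ f) ∧_) (hit-dep f ag g zero c))))

      removes-dep : ∀ f → Agree f → ∀ v g j m → removes v g j (value ω g j) ω f m ≡ removes v g j (value ω′ g j) ω′ f m
      removes-dep f ag v g j nothing = refl
      removes-dep f ag v g (suc c₀) (just c′) = hit-dep f ag g (suc c₀) c′
      removes-dep f ag v g zero (just c′) = cong₂ _∨_ own (cong (not (at v g) ∧_) (hit-dep f ag g zero c′))
        where
        own : (g == f) ∧ accepts ω f (value ω g zero) ≡ (g == f) ∧ accepts ω′ f (value ω′ g zero)
        own = ∧-congʳ (g == f) λ g≟f → trans (accepts-dep f ag (value ω g zero))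
                (cong (accepts ω′ f) (ag g zero (∨-trueˡ (trans (==-sym f g) g≟f))))

      process-dep : ∀ f → Agree f → ∀ v e c i → process v e c i ω f ≡ process v e c i ω′ f
      process-dep f ag v e c i = subst (λ i → process v e c i ω f ≡ process v e c i ω′ f) (combine-remQuot {items} (suc ℓ) i)
        (trans (process-combine v e c g j ω f) (trans (removes-dep f ag v g j (match e f c)) (sym (process-combine v e c g j ω′ f))))
        where
        g = proj₁ (remQuot {items} (suc ℓ) i)
        j = proj₂ (remQuot {items} (suc ℓ) i)

      crowded-dep : ∀ v e c → (∀ f → neighbour e f ≡ true → Agree f) → crowded v e c ω ≡ crowded v e c ω′
      crowded-dep v e c ag = ∧-congʳ (at v e) λ ve → cong₂ (λ a b → not a ∧ (d′ <ᵇ b)) (any-cong (at-dep ve)) (∑-cong (λ f → cong ⟦_⟧ (surv-dep ve f)))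
        where
        at-dep : at v e ≡ true → ∀ f → at v f ∧ loses f ω ≡ at v f ∧ loses f ω′
        at-dep ve f = ∧-congʳ (at v f) λ vf → cong (x₀ <ᵇ_) (losses-dep f (ag f (neighbour-at ve vf)))
        surv-dep : at v e ≡ true → ∀ f → survives (target v e c) (process v e c) ω f ≡ survives (target v e c) (process v e c) ω′ f
        surv-dep ve f = ∧-congʳ (target v e c f) λ tf →
          cong not (any-cong (process-dep f (ag f (neighbour-at ve (∧-trueˡ tf))) v e c))

    bad-dep : ∀ e → DependsOn (near e) (bad e)
    bad-dep e ω ω′ p = cong₂ _∨_ (cong (x₀ <ᵇ_) (losses-dep ω ω′ e (ag e (∨-trueˡ (==-refl e)))))
      (any-cong (λ c → cong₂ _∨_ (crowded-dep ω ω′ (end₁ e) e c ag) (crowded-dep ω ω′ (end₂ e) e c ag)))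
      where
      ag : ∀ f → neighbour e f ≡ true → Agree ω ω′ f
      ag f nef g j nfg = p (combine g j) (trans (cong (λ p → within2 e (proj₁ p)) (remQuot-combine {items} {suc ℓ} g j))
        (any-intro (λ f → neighbour e f ∧ neighbour f g) f (∧-true nef nfg)))

    opaque
      outcome : Σ Ω λ ω → ∀ e → bad e ω ≡ false
      outcome = LocalLemma.avoid o bad near bad-dep (W * W * suc ℓ) (W * W) q near≤V near≤C bad-tail lll₂ 2<q

    good-outcome : Σ Ω λ ω → (∀ e → losses ω e ≤ x₀) ×
                   (∀ v e c → at v e ≡ true → survivors v e c ω ≤ d′)
    good-outcome = let ω , avoids = outcome in ω , few-losses ω avoids , few-survivors ω avoids
      where
      module _ (ω : Ω) (avoids : ∀ e → bad e ω ≡ false) where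
        few-losses : ∀ e → losses ω e ≤ x₀
        few-losses e = <ᵇ-false⁻ (¬true⇒false λ p → true≢false (∨-trueˡ p) (avoids e))
        no-loses : ∀ v → any (λ f → at v f ∧ loses f ω) ≡ false
        no-loses v = any-none _ (λ f → ¬true⇒false λ p →
          <⇒≱ (<ᵇ-true⁻ (∧-trueʳ {at v f} p)) (few-losses f))
        few-survivors : ∀ v e c → at v e ≡ true → survivors v e c ω ≤ d′
        few-survivors v e c ve = <ᵇ-false⁻ (¬true⇒false λ p →
          true≢false (∨-trueʳ {loses e ω} (any-intro (crowded′ e ω) c (side p))) (avoids e))
          where
          side : (d′ <ᵇ survivors v e c ω) ≡ true → crowded′ e ω c ≡ true
          side p with at-ends v e ve
          ... | inj₁ refl = ∨-trueˡ (∧-true ve (∧-true (false⇒not (no-loses v)) p))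
          ... | inj₂ refl = ∨-trueʳ {crowded (end₁ e) e c ω} (∧-true ve (∧-true (false⇒not (no-loses v)) p))

  -- The residual conflict system after a round

  select : ∀ {n} (p : Fin n → Bool) k → k ≤ # (λ i → p i) →
           Σ (Fin k → Fin n) λ ι → (∀ i → p (ι i) ≡ true) × (∀ i j → ι i ≡ ι j → i ≡ j)
  select p zero le = (λ ()) , (λ ()) , λ ()
  select {zero} p (suc k) le = ⊥-elim (1+n≰n (≤-trans (≤-trans (s≤s z≤n) le) (≤-reflexive (trans (∑-cong {zero} {g = λ _ → 0} λ ()) (∑-zero 0)))))
  select {suc n} p (suc k) le with p zero in p0
  ... | false = let ι , ok , inj = select (p ∘ suc) (suc k) (≤-trans le (≤-reflexive (trans (∑-suc (λ i → ⟦ p i ⟧)) (cong (λ b → ⟦ b ⟧ + # (λ i → p (suc i))) p0)))) in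
        suc ∘ ι , ok , λ i j e → inj i j (sucF-injective e)
  ... | true = ι′ , ok′ , inj′
    where
    rec = select (p ∘ suc) k (≤-pred (≤-trans le (≤-reflexive (trans (∑-suc (λ i → ⟦ p i ⟧)) (cong (λ b → ⟦ b ⟧ + # (λ i → p (suc i))) p0)))))
    ι′ : Fin (suc k) → Fin (suc n)
    ι′ zero    = zero
    ι′ (suc i) = suc (proj₁ rec i)
    ok′ : ∀ i → p (ι′ i) ≡ true
    ok′ zero    = p0
    ok′ (suc i) = proj₁ (proj₂ rec) i
    inj′ : ∀ i j → ι′ i ≡ ι′ j → i ≡ j
    inj′ zero    zero    e = refl
    inj′ (suc i) (suc j) e = cong suc (proj₂ (proj₂ rec) i j (sucF-injective e))

  first : ∀ {k} → (Fin k → Bool) → Maybe (Fin k)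
  first {zero}  p = nothing
  first {suc k} p = if p zero then just zero else mapMaybe suc (first (p ∘ suc))

  first-sound : ∀ {k} (p : Fin k → Bool) {i} → first p ≡ just i → p i ≡ true
  first-sound {suc k} p e with p zero in p0
  first-sound {suc k} p refl | true = p0
  first-sound {suc k} p e | false with first (p ∘ suc) in eq
  first-sound {suc k} p refl | false | just i = first-sound (p ∘ suc) eq

  first-complete : ∀ {k} (p : Fin k → Bool) i → p i ≡ true → Σ (Fin k) λ j → first p ≡ just j
  first-complete {suc k} p i e with p zero in p0
  ... | true = zero , refl
  first-complete {suc k} p zero    e | false = ⊥-elim (true≢false e p0)
  first-complete {suc k} p (suc i) e | false with j , q ← first-complete (p ∘ suc) i e rewrite q = suc j , refl

  -- Coloured items stay in the frame, without conflicts.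
  module Residual {F : Frame} {ℓ : ℕ} (𝒞 : Conflict F ℓ) (r d x₀ d′ ℓ′ : ℕ)
      (bound : Conflict.ColourDegreeBound 𝒞 d)
      (ω : Nibble.Ω 𝒞 r d x₀ bound)
      (few-losses : ∀ e → Nibble.losses 𝒞 r d x₀ bound ω e ≤ x₀)
      (few-survivors : ∀ v e c → Frame.at F v e ≡ true →
         # (λ f → survives (Nibble.target 𝒞 r d x₀ bound v e c) (Nibble.process 𝒞 r d x₀ bound v e c) ω f) ≤ d′)
      (ℓ′≤ : ℓ′ ≤ ℓ ∸ x₀) where
    open Frame F
    open Conflict 𝒞
    open Nibble 𝒞 r d x₀ bound

    alive : Fin items → Fin ℓ → Bool
    alive e c = not (killed ω e c)

    ℓ′≤alive : ∀ e → ℓ′ ≤ # (λ c → alive e c)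
    ℓ′≤alive e = ≤-trans ℓ′≤ (≤-trans (∸-monoʳ-≤ ℓ (few-losses e)) (m≤n+o⇒m∸n≤o ℓ (losses ω e) (≤-reflexive (sym
      (trans (sym (∑-+ (λ c → ⟦ killed ω e c ⟧) _)) (trans (∑-cong (λ c → ⟦not⟧ (killed ω e c))) (trans (∑-const ℓ 1) (*-identityʳ ℓ))))))))

    opaque
      selection : ∀ e → Σ (Fin ℓ′ → Fin ℓ) λ ι → (∀ a → alive e (ι a) ≡ true) × (∀ a b → ι a ≡ ι b → a ≡ b)
      selection e = select (alive e) ℓ′ (ℓ′≤alive e)

    ι : Fin items → Fin ℓ′ → Fin ℓ
    ι e = proj₁ (selection e)

    ι-alive : ∀ e a → killed ω e (ι e a) ≡ false
    ι-alive e a = not-true (proj₁ (proj₂ (selection e)) a)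

    ι-injective : ∀ e a b → ι e a ≡ ι e b → a ≡ b
    ι-injective e = proj₂ (proj₂ (selection e))

    pullback : Fin items → Maybe (Fin ℓ) → Maybe (Fin ℓ′)
    pullback f nothing   = nothing
    pullback f (just c′) = first (λ a → ι f a == c′)

    unless : ∀ {A : Set} → Bool → Maybe A → Maybe A
    unless true  x = nothing
    unless false x = x

    match′ : Fin items → Fin items → Fin ℓ′ → Maybe (Fin ℓ′)
    match′ e f a = unless (coloured ω e ∨ coloured ω f) (pullback f (match e f (ι e a)))

    match′-elim : ∀ e f a b → match′ e f a ≡ just b →
                  coloured ω e ∨ coloured ω f ≡ false × match e f (ι e a) ≡ just (ι f b)
    match′-elim e f a b p = go (coloured ω e ∨ coloured ω f) (match e f (ι e a)) p
      where
      go : ∀ t m → unless t (pullback f m) ≡ just b → t ≡ false × m ≡ just (ι f b)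
      go false (just c′) p = refl , cong just (sym (==⇒≡ {i = ι f b} (first-sound (λ a → ι f a == c′) p)))

    match′-intro : ∀ e f a b → coloured ω e ∨ coloured ω f ≡ false → match e f (ι e a) ≡ just (ι f b) →
                   match′ e f a ≡ just b
    match′-intro e f a b t m = trans (cong₂ (λ t m → unless t (pullback f m)) t m) found
      where
      found : first (λ a → ι f a == ι f b) ≡ just b
      found with first-complete (λ a → ι f a == ι f b) b (==-refl (ι f b))
      ... | b′ , p = trans p (cong just (ι-injective f b′ b (==⇒≡ {i = ι f b′} (first-sound (λ a → ι f a == ι f b) p))))

    residual : Conflict F ℓ′
    residual = record
      { match        = match′
      ; match-sym    = λ e f a b p → let t , m = match′-elim e f a b p in
                       match′-intro f e b a (trans (∨-comm (coloured ω f) (coloured ω e)) t) (match-sym e f (ι e a) (ι f b) m)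
      ; match-irrefl = irrefl
      ; match-at     = λ e f a b p → match-at e f (ι e a) (ι f b) (proj₂ (match′-elim e f a b p))
      }
      where
      irrefl : ∀ e a → match′ e e a ≡ nothing
      irrefl e a with match′ e e a in p
      ... | nothing = refl
      ... | just b with () ← trans (sym (match-irrefl e (ι e a))) (proj₂ (match′-elim e e a b p))

    -- A conflict that remains was removed in none of the ways listed in `removes`: its item `f` is
    -- not coloured, and the colour `ι f b` was not killed by anything. As the process ignores some
    -- deletions, its survivors include all remaining conflicts.
    residual-bound : Conflict.ColourDegreeBound residual d′
    residual-bound v e a ve = ≤-trans (∑-mono (λ f → ⟦⟧-mono (remains f))) (few-survivors v e (ι e a) ve)
      where
      module _ (f : Fin items) (p : at v f ∧ is-just (match′ e f a) ≡ true) where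
        b : Fin ℓ′
        b = proj₁ (is-just-elim (∧-trueʳ {at v f} p))
        both : coloured ω e ∨ coloured ω f ≡ false × match e f (ι e a) ≡ just (ι f b)
        both = match′-elim e f a b (proj₂ (is-just-elim (∧-trueʳ {at v f} p)))
        not-hit : ∀ g j → hit g j (value ω g j) f (ι f b) ≡ true → ⊥
        not-hit g j q = true≢false (any-intro (λ g → any (λ j → hit g j (value ω g j) f (ι f b))) g
          (any-intro (λ j → hit g j (value ω g j) f (ι f b)) j q)) (ι-alive f b)
        not-removed : ∀ g j → removes v g j (value ω g j) ω f (just (ι f b)) ≡ true → ⊥
        not-removed g (suc c₀) q = not-hit g (suc c₀) q
        not-removed g zero q with ∨-elim {(g == f) ∧ accepts ω f (value ω g zero)} q
        ... | inj₁ s = true≢false (∨-trueʳ {coloured ω e}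
                (subst (λ h → accepts ω f (value ω h zero) ≡ true) (==⇒≡ {i = g} {f} (∧-trueˡ s)) (∧-trueʳ {g == f} s)))
                (proj₁ both)
        ... | inj₂ s = not-hit g zero (∧-trueʳ {not (at v g)} s)
        not-processed : ∀ i → process v e (ι e a) i ω f ≡ true → ⊥
        not-processed i q = not-removed g j (trans (sym (trans (process-combine v e (ι e a) g j ω f)
            (cong (removes v g j (value ω g j) ω f) (proj₂ both))))
            (trans (cong (λ i → process v e (ι e a) i ω f) (combine-remQuot {items} (suc ℓ) i)) q))
          where
          g = proj₁ (remQuot {items} (suc ℓ) i)
          j = proj₂ (remQuot {items} (suc ℓ) i)
        remains : survives (target v e (ι e a)) (process v e (ι e a)) ω f ≡ true
        remains = ∧-true (∧-true (∧-trueˡ p) (is-just-intro (proj₂ both)))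
          (false⇒not (any-none _ (λ i → ¬true⇒false (not-processed i))))

    module _ (σ′ : Fin items → Fin ℓ′) (proper : ∀ e f → match′ e f (σ′ e) ≢ just (σ′ f)) where

      Final : Fin items → Fin ℓ → Set
      Final e c = (coloured ω e ≡ true × value ω e zero ≡ c ↑ˡ r × forbidden ω e c ≡ false)
                ⊎ (coloured ω e ≡ false × c ≡ ι e (σ′ e))

      final : ∀ e → Σ (Fin ℓ) (Final e)
      final e with coloured ω e in eq
      ... | false = ι e (σ′ e) , inj₂ (refl , refl)
      ... | true with c , p ← any-elim (λ c → (value ω e zero == (c ↑ˡ r)) ∧ not (forbidden ω e c)) eq =
        c , inj₁ (refl , ==⇒≡ {i = value ω e zero} (∧-trueˡ p) , not-true (∧-trueʳ {value ω e zero == (c ↑ˡ r)} p))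

      hit-by : ∀ e f {c c′} → match e f c ≡ just c′ → value ω f zero ≡ c′ ↑ˡ r → hit f zero (value ω f zero) e c ≡ true
      hit-by e f {c} {c′} m v = trans (cong₂ picks m v) (==-refl (c′ ↑ˡ r))

      clash-earlier : ∀ e f {c c′} → toℕ f < toℕ e → match e f c ≡ just c′ → value ω f zero ≡ c′ ↑ˡ r →
                      forbidden ω e c ≡ false → ⊥
      clash-earlier e f {c} lt m v nf = true≢false
        (any-intro (λ g → (toℕ g <ᵇ toℕ e) ∧ hit g zero (value ω g zero) e c) f (∧-true (<ᵇ-true lt) (hit-by e f m v))) nf

      clash-killed : ∀ e f a {c′} → match e f (ι e a) ≡ just c′ → value ω f zero ≡ c′ ↑ˡ r → ⊥
      clash-killed e f a m v = true≢false (any-intro (λ g → any (λ j → hit g j (value ω g j) e (ι e a))) f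
        (any-intro (λ j → hit f j (value ω f j) e (ι e a)) zero (hit-by e f m v))) (ι-alive e a)

      -- Of two conflicting kept picks the later would have been forbidden. A kept pick kills every
      -- colour in conflict with it, and uncoloured items only use colours that are alive. Two
      -- uncoloured items are handled by the residual colouring.
      clash : ∀ e f {c c′} → Final e c → Final f c′ → match e f c ≢ just c′
      clash e f {c} {c′} (inj₁ (_ , ve , ne)) (inj₁ (_ , vf , nf)) m with <-cmp (toℕ e) (toℕ f)
      ... | tri> _ _ lt = clash-earlier e f lt m vf ne
      ... | tri< lt _ _ = clash-earlier f e lt (match-sym e f c c′ m) ve nf
      ... | tri≈ _ eq _ with refl ← toℕ-injective {i = e} {j = f} eq with () ← trans (sym (match-irrefl e c)) m
      clash e f (inj₁ (_ , ve , _)) (inj₂ (_ , refl)) m = clash-killed f e (σ′ f) (match-sym e f _ _ m) ve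
      clash e f (inj₂ (_ , refl)) (inj₁ (_ , vf , _)) m = clash-killed e f (σ′ e) m vf
      clash e f (inj₂ (te , refl)) (inj₂ (tf , refl)) m = proper e f (match′-intro e f (σ′ e) (σ′ f) (cong₂ _∨_ te tf) m)

    extend : Conflict.Colouring residual → Colouring
    extend (σ′ , proper) = (λ e → proj₁ (final σ′ proper e)) ,
      λ e f → clash σ′ proper e f (proj₂ (final σ′ proper e)) (proj₂ (final σ′ proper f))

  -- Interface for the numerical part. Each tail probability is at most `2 ^ - k`; `M` and `j₁` tune
  -- the tail for losses, `L` and `j₂` the one for survivors, and `1 / q` is the probability fed to
  -- the local lemma.
  nibble-step : ∀ {F ℓ} (𝒞 : Conflict F ℓ) (r d x₀ d′ ℓ′ D : ℕ) →
    Conflict.ColourDegreeBound 𝒞 d → Frame.DegreeBound F D →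
    Fin (ℓ + r) → 2 * d ≤ ℓ + r →
    (k M j₁ L j₂ q : ℕ) {{_ : NonZero M}} {{_ : NonZero L}} →
    ℓ * (2 * d) + M * (ℓ + r) * k ≤ j₁ * suc x₀ →
    j₁ * suc M ≤ M * (ℓ + r) →
    (d ∸ d′) * j₂ + (2 + L) * (ℓ + r) * k ≤ suc d′ * (ℓ ∸ x₀ + d) →
    (2 + L) * (ℓ + r) ≤ L * j₂ →
    suc (2 * ℓ) * q ≤ 2 ^ k →
    4 * (suc (2 * D) * suc (2 * D) * suc ℓ * (suc (2 * D) * suc (2 * D))) ≤ q →
    2 < q → ℓ′ ≤ ℓ ∸ x₀ →
    ((𝒞′ : Conflict F ℓ′) → Conflict.ColourDegreeBound 𝒞′ d′ → Conflict.Colouring 𝒞′) →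
    Conflict.Colouring 𝒞
  nibble-step 𝒞 r d x₀ d′ ℓ′ D bound degree o 2d≤R k M j₁ L j₂ q loss₁ loss₂ surv₁ surv₂ lll₁ lll₂ 2<q ℓ′≤ rest =
    let ω , few-losses , few-survivors =
          NibbleOutcome.good-outcome 𝒞 r d x₀ d′ D bound degree o 2d≤R k M j₁ L j₂ q loss₁ loss₂ surv₁ surv₂ lll₁ lll₂ 2<q
        module Res = Residual 𝒞 r d x₀ d′ ℓ′ bound ω few-losses few-survivors ℓ′≤
    in Res.extend (rest Res.residual Res.residual-bound)

  -- Numerical conditions

  n<2^n : ∀ n → n < 2 ^ n
  n<2^n zero    = s≤s z≤n
  n<2^n (suc n) = ≤-trans (s≤s (n<2^n n)) (≤-trans (+-monoˡ-≤ (2 ^ n) (m^n>0 2 n)) (≤-reflexive (cong (2 ^ n +_) (sym (+-identityʳ _)))))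

  -- The exponent 6 is the number of factors linear in `k` in `lll`. With `j = k / 7`, the seventh
  -- power of `suc j` is at most `2 ^ k`, and its seventh factor absorbs the constant.
  exp-beats-power : ∀ C → Σ ℕ λ k₀ → ∀ k → k₀ ≤ k → C * k ^ 6 ≤ 2 ^ k
  exp-beats-power C = 7 * (C * 7 ^ 6) , λ k k₀≤k → let j = k / 7 in begin
    C * k ^ 6 ≤⟨ *-monoʳ-≤ C (^-monoˡ-≤ 6 (k≤ k)) ⟩
    C * (7 * suc j) ^ 6 ≡⟨ cong (C *_) (^-distrib-* 7 (suc j) 6) ⟩
    C * (7 ^ 6 * suc j ^ 6) ≡⟨ *-assoc C (7 ^ 6) _ ⟨
    C * 7 ^ 6 * suc j ^ 6 ≤⟨ *-monoˡ-≤ (suc j ^ 6) (≤-trans (large k k₀≤k) (n≤1+n j)) ⟩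
    suc j ^ 7 ≤⟨ ^-monoˡ-≤ 7 (n<2^n j) ⟩
    (2 ^ j) ^ 7 ≡⟨ ^-*-assoc 2 j 7 ⟩
    2 ^ (j * 7) ≤⟨ ^-monoʳ-≤ 2 (m/n*n≤m k 7) ⟩
    2 ^ k ∎
    where
    open ≤-Reasoning
    large : ∀ k → 7 * (C * 7 ^ 6) ≤ k → C * 7 ^ 6 ≤ k / 7
    large k le = ≤-trans (≤-reflexive (sym (trans (cong (_/ 7) (*-comm 7 (C * 7 ^ 6))) (m*n/n≡m (C * 7 ^ 6) 7)))) (/-monoˡ-≤ 7 le)
    k≤ : ∀ k → k ≤ 7 * suc (k / 7)
    k≤ k = begin
      k ≡⟨ m≡m%n+[m/n]*n k 7 ⟩
      k % 7 + k / 7 * 7 ≤⟨ +-monoˡ-≤ (k / 7 * 7) (<⇒≤ (m%n<n k 7)) ⟩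
      suc (k / 7) * 7 ≡⟨ *-comm (suc (k / 7)) 7 ⟩
      7 * suc (k / 7) ∎

  -- The drift of the ratio r / B: with ρ = r / B it is ρ (1 + ρ) against 2 ρ², up to errors of order 1 / l.
  drift : ∀ S r b l L → l ≡ 32 * S → L ≡ suc l → .{{_ : NonZero S}} →
          (r + b) * (r + b) ≤ S * (r * b) → L * L * L ≤ r + b →
          (l + 3) * (l + 2) * ((L * L + 2) * (r + b) + 2 * (r * r)) + (r + b + r) * (l * l)
            ≤ r * (r + b + r) * (l * l)
  drift S r b l L refl refl product L³≤B = *-cancelˡ-≤ S (begin
    S * ((l + 3) * (l + 2) * ((L * L + 2) * B + 2 * (r * r)) + (B + r) * (l * l))
      ≡⟨ cong (S *_) (reg₁ l ((L * L + 2) * B) (r * r) ((B + r) * (l * l))) ⟩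
    S * (l * l * (2 * (r * r)) + ((5 * l + 6) * (2 * (r * r)) + (l + 3) * (l + 2) * ((L * L + 2) * B) + (B + r) * (l * l)))
      ≤⟨ *-monoʳ-≤ S (+-monoʳ-≤ (l * l * (2 * (r * r))) errors) ⟩
    S * (l * l * (2 * (r * r)) + 32 * (l * (B * B)))
      ≡⟨ reg₂ S l (r * r) (B * B) ⟩
    S * (l * l * (2 * (r * r))) + l * (32 * S) * (B * B)
      -- The gain is that `r * (B + r)` exceeds `2 * (r * r)` by `r * b`, which is at least
      -- `B * B / S`. The choice `l = 32 * S` makes the collected errors fit into exactly this gain.
      ≤⟨ +-monoʳ-≤ (S * (l * l * (2 * (r * r)))) (*-monoʳ-≤ (l * l) product) ⟩
    S * (l * l * (2 * (r * r))) + l * l * (S * (r * b))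
      ≡⟨ reg₃ S l r b ⟩
    S * (r * (B + r) * (l * l)) ∎)
    where
    open ≤-Reasoning
    B = r + b
    reg₁ : ∀ l X r² Y → (l + 3) * (l + 2) * (X + 2 * r²) + Y
         ≡ l * l * (2 * r²) + ((5 * l + 6) * (2 * r²) + (l + 3) * (l + 2) * X + Y)
    reg₁ = solve-∀
    reg₂ : ∀ S l r² B² → S * (l * l * (2 * r²) + 32 * (l * B²)) ≡ S * (l * l * (2 * r²)) + l * (32 * S) * B²
    reg₂ = solve-∀
    reg₃ : ∀ S l r b → S * (l * l * (2 * (r * r))) + l * l * (S * (r * b)) ≡ S * (r * (r + b + r) * (l * l))
    reg₃ = solve-∀
    32≤l : 32 ≤ l
    32≤l = m≤m*n 32 S
    r≤B : r ≤ B
    r≤B = m≤m+n r b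
    l≤L³ : l ≤ L * L * L
    l≤L³ = ≤-trans (n≤1+n l) (≤-trans (m≤m*n L (L * L)) (≤-reflexive (sym (*-assoc L L L))))
    l≤B : l ≤ B
    l≤B = ≤-trans l≤L³ L³≤B
    e₁ : (5 * l + 6) * (2 * (r * r)) ≤ 22 * (l * (B * B))
    e₁ = begin
      (5 * l + 6) * (2 * (r * r)) ≤⟨ *-mono-≤ (+-monoʳ-≤ (5 * l) (≤-trans (m≤m+n 6 26) (≤-trans 32≤l (m≤m+n l (5 * l))))) (*-monoʳ-≤ 2 (*-mono-≤ r≤B r≤B)) ⟩
      (5 * l + 6 * l) * (2 * (B * B)) ≡⟨ reg l (B * B) ⟩
      22 * (l * (B * B)) ∎
      where
      reg : ∀ l B² → (5 * l + 6 * l) * (2 * B²) ≡ 22 * (l * B²)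
      reg = solve-∀
    e₂ : (l + 3) * (l + 2) * ((L * L + 2) * B) ≤ 2 * (l * (B * B))
    e₂ = begin
      (l + 3) * (l + 2) * ((L * L + 2) * B) ≡⟨ reg₄ l (L * L + 2) B ⟩
      (l * l + (5 * l + 6)) * (L * L + 2) * B ≤⟨ *-monoˡ-≤ B (*-monoˡ-≤ (L * L + 2) (+-monoʳ-≤ (l * l) 5l+6≤)) ⟩
      (l * l + l * l) * (L * L + 2) * B ≡⟨ reg₅ l (L * L + 2) B ⟩
      2 * (l * (l * (L * L + 2) * B)) ≤⟨ *-monoʳ-≤ 2 (*-monoʳ-≤ l (*-monoˡ-≤ B (≤-trans l[L²+2]≤ L³≤B))) ⟩
      2 * (l * (B * B)) ∎
      where
      reg₄ : ∀ l x B → (l + 3) * (l + 2) * (x * B) ≡ (l * l + (5 * l + 6)) * x * B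
      reg₄ = solve-∀
      reg₅ : ∀ l x B → (l * l + l * l) * x * B ≡ 2 * (l * (l * x * B))
      reg₅ = solve-∀
      5l+6≤ : 5 * l + 6 ≤ l * l
      5l+6≤ = begin
        5 * l + 6 ≤⟨ +-monoʳ-≤ (5 * l) (≤-trans (m≤m+n 6 26) 32≤l) ⟩
        5 * l + l ≡⟨ reg₆ l ⟩
        6 * l ≤⟨ *-monoˡ-≤ l (≤-trans (m≤m+n 6 26) 32≤l) ⟩
        l * l ∎
        where
        reg₆ : ∀ l → 5 * l + l ≡ 6 * l
        reg₆ = solve-∀
      l[L²+2]≤ : l * (L * L + 2) ≤ L * L * L
      l[L²+2]≤ = ≤-trans (m≤m+n _ (l * l + 1)) (≤-reflexive (reg₇ l))
        where
        reg₇ : ∀ l → l * ((1 + l) * (1 + l) + 2) + (l * l + 1) ≡ (1 + l) * (1 + l) * (1 + l)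
        reg₇ = solve-∀
    e₃ : (B + r) * (l * l) ≤ 2 * (l * (B * B))
    e₃ = begin
      (B + r) * (l * l) ≤⟨ *-mono-≤ (+-monoʳ-≤ B r≤B) (*-monoʳ-≤ l l≤B) ⟩
      (B + B) * (l * B) ≡⟨ reg B l ⟩
      2 * (l * (B * B)) ∎
      where
      reg : ∀ B l → (B + B) * (l * B) ≡ 2 * (l * (B * B))
      reg = solve-∀
    errors : (5 * l + 6) * (2 * (r * r)) + (l + 3) * (l + 2) * ((L * L + 2) * B) + (B + r) * (l * l) ≤ 32 * (l * (B * B))
    errors = begin
      (5 * l + 6) * (2 * (r * r)) + (l + 3) * (l + 2) * ((L * L + 2) * B) + (B + r) * (l * l)
        ≤⟨ +-mono-≤ (+-mono-≤ e₁ e₂) e₃ ⟩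
      22 * (l * (B * B)) + 2 * (l * (B * B)) + 2 * (l * (B * B))
        ≡⟨ reg (l * (B * B)) ⟩
      26 * (l * (B * B))
        ≤⟨ *-monoˡ-≤ (l * (B * B)) (m≤m+n 26 6) ⟩
      32 * (l * (B * B)) ∎
      where
      reg : ∀ z → 22 * z + 2 * z + 2 * z ≡ 26 * z
      reg = solve-∀

  -- `q` is a scale: a round changes `q` and `r` but keeps `B`. The degree has its own constant `A`
  -- because coloured items stay in the frame, so the degree does not shrink along with `q`. It only
  -- enters the local lemma, where any polynomial size is harmless.
  Solvable : ℕ → ℕ → Set
  Solvable B r = ∀ A → Σ ℕ λ Q → ∀ q → Q ≤ q → ∀ {F D} → Frame.DegreeBound F D → D ≤ A * q →
    (𝒞 : Conflict F (B * q)) → Conflict.ColourDegreeBound 𝒞 (r * q) → Conflict.Colouring 𝒞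

  solvable-sparse : ∀ B r {{_ : NonZero B}} → 32 * r ≤ B → Solvable B r
  solvable-sparse B r 32r≤B A = 2 , λ q 2≤q {F} _ _ 𝒞 bound →
    go q (B * q) (≤-trans 2≤q (m≤n*m q B)) (≤-trans (≤-reflexive (sym (*-assoc 32 r q))) (*-monoˡ-≤ q 32r≤B)) 𝒞 bound
    where
    go : ∀ q n → 2 ≤ n → 32 * (r * q) ≤ n → ∀ {F} (𝒞 : Conflict F n) →
         Conflict.ColourDegreeBound 𝒞 (r * q) → Conflict.Colouring 𝒞
    go q (suc n) (s≤s 1≤n) le 𝒞 bound = sparse-colouring 𝒞 bound le 1≤n

  -- One round with explicit parameters

  module Step (S b r′ l : ℕ) {{_ : NonZero S}} (l≡ : l ≡ 32 * S) where
    -- A round lowers the scale `q`, which is about `T * k`, by `w * k`: the share `2 * r` of `w`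
    -- covers the mean number of losses and the share 1 their fluctuation. `X` bounds the new scale
    -- divided by `k` from below; it uses `suc w` because only `pred T * k ≤ q` is available.
    r L B T w X : ℕ
    r = suc r′
    L = suc l
    B = r + b
    T = L * L * B
    w = suc (2 * r)
    X = T ∸ suc w

    module _ (product : B * B ≤ S * (r * b)) (L³≤B : L * L * L ≤ B) where
      open ≤-Reasoning

      32≤l : 32 ≤ l
      32≤l = subst (32 ≤_) (sym l≡) (m≤m*n 32 S)

      L≤L³ : L ≤ L * L * L
      L≤L³ = ≤-trans (m≤m*n L (L * L)) (≤-reflexive (sym (*-assoc L L L)))

      r≤B : r ≤ B
      r≤B = m≤m+n r b

      L[1+w]≤T : L * suc w ≤ T
      L[1+w]≤T = begin
        L * suc w ≤⟨ *-monoʳ-≤ L 1+w≤ ⟩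
        L * (L * B) ≡⟨ *-assoc L L B ⟨
        T ∎
        where
        1+w≤ : suc w ≤ L * B
        1+w≤ = begin
          2 + 2 * r ≤⟨ +-mono-≤ (*-monoʳ-≤ 2 (≤-trans (s≤s z≤n) r≤B)) (*-monoʳ-≤ 2 r≤B) ⟩
          2 * B + 2 * B ≡⟨ *-distribʳ-+ B 2 2 ⟨
          4 * B ≤⟨ *-monoˡ-≤ B (≤-trans (≤-trans (m≤m+n 4 28) 32≤l) (n≤1+n l)) ⟩
          L * B ∎

      1+w≤T : suc w ≤ T
      1+w≤T = ≤-trans (m≤n*m (suc w) L) L[1+w]≤T

      X+ : X + suc w ≡ T
      X+ = m∸n+n≡m 1+w≤T

      lT≤LX : l * T ≤ L * X
      lT≤LX = +-cancelʳ-≤ (L * suc w) _ _ (begin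
        l * T + L * suc w ≤⟨ +-monoʳ-≤ (l * T) L[1+w]≤T ⟩
        l * T + T ≡⟨ +-comm (l * T) T ⟩
        L * T ≡⟨ cong (L *_) X+ ⟨
        L * (X + suc w) ≡⟨ *-distribˡ-+ L X (suc w) ⟩
        L * X + L * suc w ∎)

      -- This is `surv₁` divided by `k * k`, with `q` bounded above by `T * k` on the left and the
      -- scales bounded below by `X * k` on the right. Since `X` is at least `l / L` of `T`, it
      -- follows from `drift`, whose extra term `(B + r) * (l * l)` pays for having `r′` instead of
      -- `r`.
      main : (2 + L) * suc L * B * T * (T + r′ * w + L) ≤ r′ * X * (B * X + r * X)
      main = *-cancelʳ-≤ _ _ (L * L) (begin
        (2 + L) * suc L * B * T * (T + r′ * w + L) * (L * L)
          ≡⟨ reg₁ l B T (T + r′ * w + L) ⟩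
        (l + 3) * (l + 2) * (T + r′ * w + L) * (T * (L * L * B))
          ≤⟨ *-monoˡ-≤ (T * T) (+-cancelʳ-≤ ((B + r) * (l * l)) ((l + 3) * (l + 2) * (T + r′ * w + L)) (r′ * (B + r) * (l * l)) stars) ⟩
        r′ * (B + r) * (l * l) * (T * T)
          ≡⟨ reg₂ r′ (B + r) l T ⟩
        r′ * (B + r) * ((l * T) * (l * T))
          ≤⟨ *-monoʳ-≤ (r′ * (B + r)) (*-mono-≤ lT≤LX lT≤LX) ⟩
        r′ * (B + r) * ((L * X) * (L * X))
          ≡⟨ reg₃ r′ B r L X ⟩
        r′ * X * (B * X + r * X) * (L * L) ∎)
        where
        reg₁ : ∀ l B T Z → (3 + l) * (2 + l) * B * T * Z * ((1 + l) * (1 + l))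
             ≡ (l + 3) * (l + 2) * Z * (T * ((1 + l) * (1 + l) * B))
        reg₁ = solve-∀
        reg₂ : ∀ a x l T → a * x * (l * l) * (T * T) ≡ a * x * ((l * T) * (l * T))
        reg₂ = solve-∀
        reg₃ : ∀ a B r L X → a * (B + r) * ((L * X) * (L * X)) ≡ a * X * (B * X + r * X) * (L * L)
        reg₃ = solve-∀
        Z≤ : T + r′ * w + L ≤ (L * L + 2) * B + 2 * (r * r)
        Z≤ = begin
          T + r′ * w + L ≤⟨ +-mono-≤ (+-monoʳ-≤ T r′w≤) (≤-trans L≤L³ (≤-trans L³≤B (m≤m+n B (1 * B)))) ⟩
          T + 2 * (r * r) + 2 * B ≡⟨ reg₄ (L * L) B (2 * (r * r)) ⟩
          (L * L + 2) * B + 2 * (r * r) ∎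
          where
          reg₄ : ∀ x B y → x * B + y + 2 * B ≡ (x + 2) * B + y
          reg₄ = solve-∀
          r′w≤ : r′ * w ≤ 2 * (r * r)
          r′w≤ = ≤-trans (m≤m+n _ (2 + r′)) (≤-reflexive (reg₅ r′))
            where
            reg₅ : ∀ a → a * (1 + 2 * (1 + a)) + (2 + a) ≡ 2 * ((1 + a) * (1 + a))
            reg₅ = solve-∀
        stars : (l + 3) * (l + 2) * (T + r′ * w + L) + (B + r) * (l * l) ≤ r′ * (B + r) * (l * l) + (B + r) * (l * l)
        stars = begin
          (l + 3) * (l + 2) * (T + r′ * w + L) + (B + r) * (l * l)
            ≤⟨ +-monoˡ-≤ _ (*-monoʳ-≤ ((l + 3) * (l + 2)) Z≤) ⟩
          (l + 3) * (l + 2) * ((L * L + 2) * B + 2 * (r * r)) + (B + r) * (l * l)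
            ≤⟨ drift S r b l L l≡ refl product L³≤B ⟩
          r * (B + r) * (l * l)
            ≡⟨ reg₆ r′ (B + r) (l * l) ⟩
          r′ * (B + r) * (l * l) + (B + r) * (l * l) ∎
          where
          reg₆ : ∀ a x y → (1 + a) * x * y ≡ a * x * y + x * y
          reg₆ = solve-∀

      module _ (q k : ℕ) (lower : pred T * k ≤ q) (upper : q ≤ T * k) where

        q′ = q ∸ w * k

        Xk+wk≤q : X * k + w * k ≤ q
        Xk+wk≤q = ≤-trans (≤-reflexive (trans (sym (*-distribʳ-+ k X w)) (cong (_* k) X+w))) lower
          where
          X+w : X + w ≡ pred T
          X+w = cong pred (trans (sym (+-suc X w)) X+)

        q′+ : q′ + w * k ≡ q
        q′+ = m∸n+n≡m (≤-trans (m≤n+m (w * k) (X * k)) Xk+wk≤q)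

        Xk≤q′ : X * k ≤ q′
        Xk≤q′ = +-cancelʳ-≤ (w * k) _ _ (≤-trans Xk+wk≤q (≤-reflexive (sym q′+)))

        ℓ d x₀ d′ j₁ j₂ : ℕ
        ℓ  = B * q
        d  = r * q
        x₀ = B * (w * k)
        d′ = r′ * q′
        j₁ = L * L * ℓ
        j₂ = (2 + L) * suc L * ℓ

        ℓ∸x₀ : ℓ ∸ x₀ ≡ B * q′
        ℓ∸x₀ = sym (*-distribˡ-∸ B q (w * k))

        -- The mean takes the share `2 * r` of `w`. The deviation term takes the remaining 1, which
        -- suffices as `suc L ≤ B`.
        loss₁ : ℓ * (2 * d) + L * (suc L * L * ℓ) * k ≤ j₁ * suc x₀
        loss₁ = begin
          ℓ * (2 * d) + L * (suc L * L * ℓ) * k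
            ≡⟨ reg₁ ℓ r q L k ⟩
          ℓ * (2 * r * q + L * L * suc L * k)
            ≤⟨ *-monoʳ-≤ ℓ (+-mono-≤ (*-monoʳ-≤ (2 * r) upper) (*-monoˡ-≤ k (*-monoʳ-≤ (L * L) 1+L≤B))) ⟩
          ℓ * (2 * r * (T * k) + L * L * B * k)
            ≡⟨ reg₂ ℓ r L B k ⟩
          L * L * ℓ * (B * (suc (2 * r) * k))
            ≤⟨ *-monoʳ-≤ (L * L * ℓ) (n≤1+n _) ⟩
          j₁ * suc x₀ ∎
          where
          reg₁ : ∀ ℓ r q L k → ℓ * (2 * (r * q)) + L * ((1 + L) * L * ℓ) * k ≡ ℓ * (2 * r * q + L * L * (1 + L) * k)
          reg₁ = solve-∀
          reg₂ : ∀ ℓ r L B k → ℓ * (2 * r * (L * L * B * k) + L * L * B * k) ≡ L * L * ℓ * (B * ((1 + 2 * r) * k))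
          reg₂ = solve-∀
          1+L≤B : suc L ≤ B
          1+L≤B = ≤-trans (≤-trans (m≤m+n (suc L) l) (≤-reflexive (reg₃ l))) (≤-trans (*-monoˡ-≤ L (≤-trans (s≤s (≤-trans (s≤s z≤n) 32≤l)) (m≤m*n L L))) L³≤B)
            where
            reg₃ : ∀ l → 1 + (1 + l) + l ≡ 2 * (1 + l)
            reg₃ = solve-∀

        -- With the sample range `R = suc L * L * ℓ` this condition and `surv₂` are equalities, so
        -- `j₁` and `j₂` need no rounding.
        loss₂ : j₁ * suc L ≤ L * (suc L * L * ℓ)
        loss₂ = ≤-reflexive (reg L ℓ)
          where
          reg : ∀ L ℓ → L * L * ℓ * (1 + L) ≡ L * ((1 + L) * L * ℓ)
          reg = solve-∀

        d∸d′ : d ∸ d′ ≡ q + r′ * (w * k)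
        d∸d′ = trans (cong (_∸ d′) eq) (m+n∸m≡n d′ _)
          where
          eq : d ≡ d′ + (q + r′ * (w * k))
          eq = trans (cong (λ t → q + r′ * t) (sym q′+)) (reg q r′ q′ (w * k))
            where
            reg : ∀ q a q′ y → q + a * (q′ + y) ≡ a * q′ + (q + a * y)
            reg = solve-∀

        surv₁ : (d ∸ d′) * j₂ + (2 + L) * (suc L * L * ℓ) * k ≤ suc d′ * (ℓ ∸ x₀ + d)
        surv₁ = begin
          (d ∸ d′) * j₂ + (2 + L) * (suc L * L * ℓ) * k
            ≡⟨ cong (λ t → t * j₂ + (2 + L) * (suc L * L * ℓ) * k) d∸d′ ⟩
          (q + r′ * (w * k)) * ((2 + L) * suc L * (B * q)) + (2 + L) * (suc L * L * (B * q)) * k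
            ≡⟨ reg₁ L B q r′ w k ⟩
          (2 + L) * suc L * B * q * (q + r′ * w * k + L * k)
            ≤⟨ *-mono-≤ (*-monoʳ-≤ ((2 + L) * suc L * B) upper) (+-monoˡ-≤ (L * k) (+-monoˡ-≤ (r′ * w * k) upper)) ⟩
          (2 + L) * suc L * B * (T * k) * (T * k + r′ * w * k + L * k)
            ≡⟨ reg₂ L B T k (r′ * w) ⟩
          (2 + L) * suc L * B * T * (T + r′ * w + L) * (k * k)
            ≤⟨ *-monoˡ-≤ (k * k) main ⟩
          r′ * X * (B * X + r * X) * (k * k)
            ≡⟨ reg₃ r′ X B r k ⟩
          r′ * (X * k) * (B * (X * k) + r * (X * k))
            ≤⟨ *-mono-≤ (*-monoʳ-≤ r′ Xk≤q′) (+-mono-≤ (*-monoʳ-≤ B Xk≤q′) (*-monoʳ-≤ r (≤-trans Xk≤q′ (m∸n≤m q (w * k))))) ⟩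
          r′ * q′ * (B * q′ + r * q)
            ≤⟨ *-mono-≤ (n≤1+n d′) (≤-reflexive (cong (_+ d) (sym ℓ∸x₀))) ⟩
          suc d′ * (ℓ ∸ x₀ + d) ∎
          where
          reg₁ : ∀ L B q a w k → (q + a * (w * k)) * ((2 + L) * (1 + L) * (B * q)) + (2 + L) * ((1 + L) * L * (B * q)) * k
               ≡ (2 + L) * (1 + L) * B * q * (q + a * w * k + L * k)
          reg₁ = solve-∀
          reg₂ : ∀ L B T k y → (2 + L) * (1 + L) * B * (T * k) * (T * k + y * k + L * k)
               ≡ (2 + L) * (1 + L) * B * T * (T + y + L) * (k * k)
          reg₂ = solve-∀
          reg₃ : ∀ a X B r k → a * X * (B * X + r * X) * (k * k) ≡ a * (X * k) * (B * (X * k) + r * (X * k))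
          reg₃ = solve-∀

        surv₂ : (2 + L) * (suc L * L * ℓ) ≤ L * j₂
        surv₂ = ≤-reflexive (reg L ℓ)
          where
          reg : ∀ L ℓ → (2 + L) * ((1 + L) * L * ℓ) ≡ L * ((2 + L) * (1 + L) * ℓ)
          reg = solve-∀

        2d≤R : 2 * d ≤ suc L * L * ℓ
        2d≤R = *-mono-≤ (≤-trans (s≤s (s≤s z≤n)) (m≤m*n (suc L) L)) (*-monoˡ-≤ q r≤B)

        1≤X : 1 ≤ X
        1≤X = *-cancelˡ-< L 0 X (≤-trans (s≤s (≤-reflexive (*-zeroʳ L))) (≤-trans (*-mono-≤ (≤-trans (s≤s z≤n) 32≤l) (≤-trans (s≤s z≤n) 1+w≤T)) lT≤LX))

        k≤q′ : k ≤ q′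
        k≤q′ = ≤-trans (≤-trans (≤-reflexive (sym (+-identityʳ k))) (*-monoˡ-≤ k 1≤X)) Xk≤q′

        q≤2q′ : q ≤ 2 * q′
        q≤2q′ = begin
          q ≤⟨ upper ⟩
          T * k ≤⟨ *-monoˡ-≤ k T≤2X ⟩
          2 * X * k ≡⟨ *-assoc 2 X k ⟩
          2 * (X * k) ≤⟨ *-monoʳ-≤ 2 Xk≤q′ ⟩
          2 * q′ ∎
          where
          T≤2X : T ≤ 2 * X
          T≤2X = *-cancelˡ-≤ l {{>-nonZero (≤-trans (s≤s z≤n) 32≤l)}} (begin
            l * T ≤⟨ lT≤LX ⟩
            L * X ≤⟨ *-monoˡ-≤ X (+-monoˡ-≤ l (≤-trans (s≤s z≤n) 32≤l)) ⟩
            (l + l) * X ≡⟨ reg l X ⟩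
            l * (2 * X) ∎)
            where
            reg : ∀ l X → (l + l) * X ≡ l * (2 * X)
            reg = solve-∀

      lll-constant : ℕ → ℕ
      lll-constant A = suc (2 * (B * T)) * (4 * (suc (2 * (A * T)) * suc (2 * (A * T)) * suc (B * T) * (suc (2 * (A * T)) * suc (2 * (A * T)))))

      lll : ∀ A D q k → 1 ≤ k → q ≤ T * k → D ≤ A * q → lll-constant A * k ^ 6 ≤ 2 ^ k →
            suc (2 * (B * q)) * (4 * (suc (2 * D) * suc (2 * D) * suc (B * q) * (suc (2 * D) * suc (2 * D)))) ≤ 2 ^ k
      lll A D q k k≥1 upper D≤ big = begin
        suc (2 * (B * q)) * (4 * (suc (2 * D) * suc (2 * D) * suc (B * q) * (suc (2 * D) * suc (2 * D))))
          ≤⟨ *-mono-≤ (affine (2 * (B * T)) b₁) (*-monoʳ-≤ 4 (*-mono-≤ (*-mono-≤ (*-mono-≤ W≤ W≤) (affine (B * T) b₂)) (*-mono-≤ W≤ W≤))) ⟩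
        suc (2 * (B * T)) * k * (4 * (W * k * (W * k) * (suc (B * T) * k) * (W * k * (W * k))))
          ≡⟨ reg (suc (2 * (B * T))) W (suc (B * T)) k ⟩
        lll-constant A * k ^ 6
          ≤⟨ big ⟩
        2 ^ k ∎
        where
        W = suc (2 * (A * T))
        affine : ∀ c {x} → x ≤ c * k → suc x ≤ suc c * k
        affine c le = +-mono-≤ k≥1 le
        b₂ : B * q ≤ B * T * k
        b₂ = ≤-trans (*-monoʳ-≤ B upper) (≤-reflexive (sym (*-assoc B T k)))
        b₁ : 2 * (B * q) ≤ 2 * (B * T) * k
        b₁ = ≤-trans (*-monoʳ-≤ 2 b₂) (≤-reflexive (sym (*-assoc 2 (B * T) k)))
        W≤ : suc (2 * D) ≤ W * k
        W≤ = affine (2 * (A * T)) (≤-trans (*-monoʳ-≤ 2 (≤-trans D≤ (≤-trans (*-monoʳ-≤ A upper) (≤-reflexive (sym (*-assoc A T k)))))) (≤-reflexive (sym (*-assoc 2 (A * T) k))))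
        reg : ∀ a W c k → a * k * (4 * (W * k * (W * k) * (c * k) * (W * k * (W * k))))
            ≡ a * (4 * (W * W * c * (W * W))) * (k * (k * (k * (k * (k * (k * 1))))))
        reg = solve-∀

      -- The scale at most halves, so a degree bound `A * q` becomes `2 * A * q′`, which is why the
      -- hypothesis is invoked at `2 * A`.
      step : Solvable B r′ → Solvable B r
      step rec A = c * K₀ , λ q Q≤q {F} {D} degree D≤Aq 𝒞 bound →
        let k = q / c
            K₀≤k : K₀ ≤ k
            K₀≤k = ≤-trans (≤-reflexive (sym (trans (cong (_/ c) (*-comm c K₀)) (m*n/n≡m K₀ c)))) (/-monoˡ-≤ c Q≤q)
            k≥1 : 1 ≤ k
            k≥1 = ≤-trans (s≤s z≤n) (≤-trans (m≤m+n 1 _) K₀≤k)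
            c≤k : c ≤ k
            c≤k = ≤-trans (≤-trans (m≤m+n c _) (m≤n+m _ 1)) K₀≤k
            lower : c * k ≤ q
            lower = ≤-trans (≤-reflexive (*-comm c k)) (m/n*n≤m q c)
            upper : q ≤ T * k
            upper = upper-bound q c≤k
            big : lll-constant A * k ^ 6 ≤ 2 ^ k
            big = proj₂ (exp-beats-power (lll-constant A)) k (≤-trans (≤-trans (≤-trans (m≤m+n k₁ Q₁) (m≤n+m _ c)) (m≤n+m _ 1)) K₀≤k)
            Q₁≤q′ : Q₁ ≤ q′ q k lower upper
            Q₁≤q′ = ≤-trans (≤-trans (≤-trans (≤-trans (m≤n+m Q₁ k₁) (m≤n+m _ c)) (m≤n+m _ 1)) K₀≤k) (k≤q′ q k lower upper)
            D≤ : D ≤ 2 * A * q′ q k lower upper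
            D≤ = ≤-trans D≤Aq (≤-trans (*-monoʳ-≤ A (q≤2q′ q k lower upper)) (≤-reflexive (swap A 2 _)))
            W = suc (2 * D)
        -- Besides the `B * q` colours there are `(l + L * L) * (B * q)` idle values; together they
        -- make up `suc L * L * (B * q)`.
        in nibble-step 𝒞 ((l + L * L) * (B * q)) (r * q) (B * (w * k)) (r′ * q′ q k lower upper) (B * q′ q k lower upper) D
             bound degree (fromℕ< (R>0 q k k≥1 lower)) (2d≤R q k lower upper)
             k L (L * L * (B * q)) L ((2 + L) * suc L * (B * q)) (4 * (W * W * suc (B * q) * (W * W)))
             (loss₁ q k lower upper) (loss₂ q k lower upper) (surv₁ q k lower upper) (surv₂ q k lower upper)
             (lll A D q k k≥1 upper D≤Aq big) ≤-refl (≤-trans (n≤1+n 3) (m≤m*n 4 (W * W * suc (B * q) * (W * W))))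
             (≤-reflexive (sym (ℓ∸x₀ q k lower upper)))
             (λ 𝒞′ bound′ → proj₂ (rec (2 * A)) (q′ q k lower upper) Q₁≤q′ degree D≤ 𝒞′ bound′)
        where
        swap : ∀ a b c → a * (b * c) ≡ b * a * c
        swap = solve-∀
        c = pred T
        k₁ = proj₁ (exp-beats-power (lll-constant A))
        Q₁ = proj₁ (rec (2 * A))
        -- The summand 1 makes `k` positive, `c` makes the remainder of `q` modulo `c` at most `k`
        -- so that `q ≤ T * k`, `k₁` serves the local lemma, and `Q₁` the next round, because
        -- `k ≤ q′`.
        K₀ = 1 + (c + (k₁ + Q₁))
        2≤T : 2 ≤ T
        2≤T = ≤-trans (s≤s (s≤s z≤n)) 1+w≤T
        1+c : suc c ≡ T
        1+c = suc-pred T {{>-nonZero (≤-trans (s≤s z≤n) 2≤T)}}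
        instance
          c≢0 : NonZero c
          c≢0 = >-nonZero (≤-pred (≤-trans 2≤T (≤-reflexive (sym 1+c))))
        upper-bound : ∀ q → c ≤ q / c → q ≤ T * (q / c)
        upper-bound q c≤k = begin
          q ≡⟨ m≡m%n+[m/n]*n q c ⟩
          q % c + q / c * c ≤⟨ +-mono-≤ (≤-trans (<⇒≤ (m%n<n q c)) c≤k) (≤-reflexive (*-comm (q / c) c)) ⟩
          suc c * (q / c) ≡⟨ cong (_* (q / c)) 1+c ⟩
          T * (q / c) ∎
        R>0 : ∀ q k → 1 ≤ k → c * k ≤ q → 0 < suc L * L * (B * q)
        R>0 q k k≥1 lower = *-mono-≤ {1} {suc L * L} (≤-trans (s≤s z≤n) (m≤m*n (suc L) L))
          (*-mono-≤ {1} {B} (s≤s z≤n) (≤-trans (*-mono-≤ (>-nonZero⁻¹ c) k≥1) lower))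

  -- A ratio r / B with 1 - r / B ≥ 1 / H is lowered by 1 / B per round until it is at most 1 / 32.
  solvable : ∀ H l → {{_ : NonZero H}} → l ≡ 32 * (32 * H) → ∀ B → suc l * suc l * suc l ≤ B →
             ∀ r b → r + b ≡ B → B ≤ H * b → Solvable B r
  solvable H l l≡ B L³≤B zero b eq B≤Hb = solvable-sparse B 0 {{>-nonZero (≤-trans (s≤s z≤n) L³≤B)}} z≤n
  solvable H l l≡ B L³≤B (suc r′) b eq B≤Hb with 32 * suc r′ ≤? B
  ... | yes 32r≤B = solvable-sparse B (suc r′) {{>-nonZero (≤-trans (s≤s z≤n) L³≤B)}} 32r≤B
  -- Now `B < 32 * r` and `B ≤ H * b`, so the hypothesis on the product holds with `S = 32 * H`.
  -- Passing from `r` to `r′` increases `b`, which preserves the second inequality for the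
  -- recursion.
  ... | no  32r≰B = subst (λ B → Solvable B (suc r′)) eq
      (Step.step (32 * H) b r′ l {{m*n≢0 32 H}} l≡
        (subst (λ B → B * B ≤ 32 * H * (suc r′ * b)) (sym eq)
          (≤-trans (*-mono-≤ (<⇒≤ (≰⇒> 32r≰B)) B≤Hb) (≤-reflexive (reg (suc r′) H b))))
        (≤-trans L³≤B (≤-reflexive (sym eq)))
        (subst (λ B → Solvable B r′) (sym eq)
          (solvable H l l≡ B L³≤B r′ (suc b) (trans (+-suc r′ b) eq) (≤-trans B≤Hb (*-monoʳ-≤ H (n≤1+n b))))))
    where
    reg : ∀ r H b → 32 * r * (H * b) ≡ 32 * H * (r * b)
    reg = solve-∀

  open import Defs hiding (sym)

  -- From graphs to frames

  opaque
    unfolding ∑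
    sum-tabulate : ∀ {n} (f : Fin n → ℕ) → sum (tabulate f) ≡ ∑ f
    sum-tabulate {zero}  f = refl
    sum-tabulate {suc n} f = cong (f zero +_) (sum-tabulate (f ∘ suc))

  ≤-max : ∀ {n} (f : Fin n → ℕ) i → f i ≤ foldr _⊔_ 0 (tabulate f)
  ≤-max f zero    = m≤m⊔n (f zero) _
  ≤-max f (suc i) = ≤-trans (≤-max (f ∘ suc) i) (m≤n⊔m (f zero) _)

  max-attained : ∀ {n} (f : Fin n → ℕ) → 0 < foldr _⊔_ 0 (tabulate f) →
                 Σ (Fin n) λ i → f i ≡ foldr _⊔_ 0 (tabulate f)
  max-attained {suc n} f pos with ≤-total (foldr _⊔_ 0 (tabulate (f ∘ suc))) (f zero)
  ... | inj₁ le = zero , sym (m≥n⇒m⊔n≡m le)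
  ... | inj₂ ge = let eq = m≤n⇒m⊔n≡n ge ; i , p = max-attained (f ∘ suc) (subst (0 <_) eq pos)
                  in suc i , trans p (sym eq)

  module _ (G : Graph) where

    private
      N = n G

    degree≡ : ∀ v → degree G v ≡ # (λ u → adj G v u)
    degree≡ v = trans (cong sum (map-tabulate id (λ u → if adj G v u then 1 else 0)))
      (trans (sum-tabulate (λ u → if adj G v u then 1 else 0)) (∑-cong (λ u → indicator (adj G v u))))
      where
      indicator : ∀ b → (if b then 1 else 0) ≡ ⟦ b ⟧
      indicator true  = refl
      indicator false = refl

    maxDegree≡ : maxDegree G ≡ foldr _⊔_ 0 (tabulate (degree G))
    maxDegree≡ = cong (foldr _⊔_ 0) (map-tabulate id (degree G))

    degree≤ : ∀ v → # (λ u → adj G v u) ≤ maxDegree G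
    degree≤ v = ≤-trans (≤-reflexive (sym (degree≡ v)))
      (≤-trans (≤-max (degree G) v) (≤-reflexive (sym maxDegree≡)))

    edge-≡ : ∀ {e f : Edge G} → lo e ≡ lo f → hi e ≡ hi f → e ≡ f
    edge-≡ {edge u v p q} {edge .u .v p′ q′} refl refl =
      cong₂ (edge u v) (<-irrelevant p p′) (Decidable⇒UIP.≡-irrelevant _≟B_ q q′)

    incident? : (e f : Edge G) → Dec (Incident e f)
    incident? e f = ¬? ((lo e ≟F lo f) ×-dec (hi e ≟F hi f)) ×-dec
      ((lo e ≟F lo f) ⊎-dec ((lo e ≟F hi f) ⊎-dec ((hi e ≟F lo f) ⊎-dec (hi e ≟F hi f))))

    incident-sym : ∀ {e f : Edge G} → Incident e f → Incident f e
    incident-sym (distinct , share) = (λ (p , q) → distinct (sym p , sym q)) , flip share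
      where
      flip : ∀ {a b c d : Fin N} → a ≡ c ⊎ a ≡ d ⊎ b ≡ c ⊎ b ≡ d → c ≡ a ⊎ c ≡ b ⊎ d ≡ a ⊎ d ≡ b
      flip (inj₁ p)               = inj₁ (sym p)
      flip (inj₂ (inj₁ p))        = inj₂ (inj₂ (inj₁ (sym p)))
      flip (inj₂ (inj₂ (inj₁ p))) = inj₂ (inj₁ (sym p))
      flip (inj₂ (inj₂ (inj₂ p))) = inj₂ (inj₂ (inj₂ (sym p)))

    valid : Fin N → Fin N → Bool
    valid u v = (toℕ u <ᵇ toℕ v) ∧ adj G u v

    validEdge : ∀ u v → valid u v ≡ true → Edge G
    validEdge u v p = edge u v (<ᵇ-true⁻ (∧-trueˡ p)) (∧-trueʳ {toℕ u <ᵇ toℕ v} p)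

    valid-edge : (e : Edge G) → valid (lo e) (hi e) ≡ true
    valid-edge e = ∧-true (<ᵇ-true (lo<hi e)) (isAdj e)

    left right : Fin (N * N) → Fin N
    left  i = proj₁ (remQuot {N} N i)
    right i = proj₂ (remQuot {N} N i)

    edgeIf : ∀ i b → valid (left i) (right i) ≡ b → Maybe (Edge G)
    edgeIf i true  p = just (validEdge (left i) (right i) p)
    edgeIf i false p = nothing

    edgeOf : Fin (N * N) → Maybe (Edge G)
    edgeOf i = edgeIf i (valid (left i) (right i)) refl

    item : Edge G → Fin (N * N)
    item e = combine (lo e) (hi e)

    left-item : ∀ e → left (item e) ≡ lo e
    left-item e = cong proj₁ (remQuot-combine {N} {N} (lo e) (hi e))

    right-item : ∀ e → right (item e) ≡ hi e
    right-item e = cong proj₂ (remQuot-combine {N} {N} (lo e) (hi e))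

    edgeOf-ends : ∀ i {e} → edgeOf i ≡ just e →
                  valid (left i) (right i) ≡ true × lo e ≡ left i × hi e ≡ right i
    edgeOf-ends i {e} p = go (valid (left i) (right i)) refl p
      where
      go : ∀ b (q : valid (left i) (right i) ≡ b) → edgeIf i b q ≡ just e → valid (left i) (right i) ≡ true × lo e ≡ left i × hi e ≡ right i
      go true q refl = q , refl , refl

    edgeOf-item : ∀ e → edgeOf (item e) ≡ just e
    edgeOf-item e = go (valid (left (item e)) (right (item e))) refl
      where
      go : ∀ b (q : valid (left (item e)) (right (item e)) ≡ b) → edgeIf (item e) b q ≡ just e
      go true  q = cong just (edge-≡ (left-item e) (right-item e))
      go false q = ⊥-elim (true≢false (valid-edge e) (trans (sym (cong₂ valid (left-item e) (right-item e))) q))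

    -- All ordered pairs of vertices serve as items, so edges need not be enumerated; the pairs that
    -- are not stored edges lie at no vertex.
    frame : Frame
    frame = record
      { items    = N * N
      ; vertices = N
      ; at       = λ x i → valid (left i) (right i) ∧ ((x == left i) ∨ (x == right i))
      ; end₁     = left
      ; end₂     = right
      ; at-ends  = λ x i p → ends x i p
      ; simple   = λ v w e f v≢w ve we vf wf → simple′ v w e f v≢w
                     (ends v e ve) (ends w e we) (ends v f vf) (ends w f wf) (ordered ve) (ordered vf)
      }
      where
      ends : ∀ x i → valid (left i) (right i) ∧ ((x == left i) ∨ (x == right i)) ≡ true → x ≡ left i ⊎ x ≡ right i
      ends x i p with ∨-elim {x == left i} (∧-trueʳ {valid (left i) (right i)} p)
      ... | inj₁ q = inj₁ (==⇒≡ {i = x} q)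
      ... | inj₂ q = inj₂ (==⇒≡ {i = x} q)
      ordered : ∀ {i b} → valid (left i) (right i) ∧ b ≡ true → toℕ (left i) < toℕ (right i)
      ordered {i} p = <ᵇ-true⁻ (∧-trueˡ (∧-trueˡ {valid (left i) (right i)} p))
      same : ∀ e f → left e ≡ left f → right e ≡ right f → e ≡ f
      same e f p q = trans (sym (combine-remQuot {N} N e)) (trans (cong₂ combine p q) (combine-remQuot {N} N f))
      simple′ : ∀ v w e f → v ≢ w → v ≡ left e ⊎ v ≡ right e → w ≡ left e ⊎ w ≡ right e →
                v ≡ left f ⊎ v ≡ right f → w ≡ left f ⊎ w ≡ right f →
                toℕ (left e) < toℕ (right e) → toℕ (left f) < toℕ (right f) → e ≡ f
      simple′ v w e f v≢w (inj₁ p) (inj₁ q) _ _ _ _ = ⊥-elim (v≢w (trans p (sym q)))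
      simple′ v w e f v≢w (inj₂ p) (inj₂ q) _ _ _ _ = ⊥-elim (v≢w (trans p (sym q)))
      simple′ v w e f v≢w _ _ (inj₁ p) (inj₁ q) _ _ = ⊥-elim (v≢w (trans p (sym q)))
      simple′ v w e f v≢w _ _ (inj₂ p) (inj₂ q) _ _ = ⊥-elim (v≢w (trans p (sym q)))
      simple′ v w e f v≢w (inj₁ p) (inj₂ q) (inj₁ p′) (inj₂ q′) _ _ = same e f (trans (sym p) p′) (trans (sym q) q′)
      simple′ v w e f v≢w (inj₂ p) (inj₁ q) (inj₂ p′) (inj₁ q′) _ _ = same e f (trans (sym q) q′) (trans (sym p) p′)
      simple′ v w e f v≢w (inj₁ p) (inj₂ q) (inj₂ p′) (inj₁ q′) lt lt′ =
        ⊥-elim (<-asym lt (subst₂ _<_ (cong toℕ (trans (sym q′) q)) (cong toℕ (trans (sym p′) p)) lt′))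
      simple′ v w e f v≢w (inj₂ p) (inj₁ q) (inj₁ p′) (inj₂ q′) lt lt′ =
        ⊥-elim (<-asym lt (subst₂ _<_ (cong toℕ (trans (sym p′) p)) (cong toℕ (trans (sym q′) q)) lt′))

    open Frame frame using (at)

    -- For a neighbour `v` of `x`, exactly one of the pairs `(x , v)` and `(v , x)` is valid, so
    -- items at `x` are counted by neighbours.
    frame-degree : Frame.DegreeBound frame (maxDegree G)
    frame-degree x = begin
      # (λ i → at x i)
        ≡⟨ ∑-combine N N (λ i → ⟦ at x i ⟧) ⟩
      ∑ (λ u → # (λ v → at x (combine u v)))
        ≡⟨ ∑-cong (λ u → ∑-cong (λ v → cong (λ p → ⟦ valid (proj₁ p) (proj₂ p) ∧ ((x == proj₁ p) ∨ (x == proj₂ p)) ⟧) (remQuot-combine {N} {N} u v))) ⟩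
      ∑ (λ u → # (λ v → valid u v ∧ ((x == u) ∨ (x == v))))
        ≤⟨ ∑-mono (λ u → ∑-mono (λ v → split (valid u v) u v)) ⟩
      ∑ (λ u → ∑ (λ v → ⟦ u == x ⟧ * ⟦ valid u v ⟧ + ⟦ v == x ⟧ * ⟦ valid u v ⟧))
        ≡⟨ ∑-cong (λ u → ∑-+ (λ v → ⟦ u == x ⟧ * ⟦ valid u v ⟧) (λ v → ⟦ v == x ⟧ * ⟦ valid u v ⟧)) ⟩
      ∑ (λ u → ∑ (λ v → ⟦ u == x ⟧ * ⟦ valid u v ⟧) + ∑ (λ v → ⟦ v == x ⟧ * ⟦ valid u v ⟧))
        ≡⟨ ∑-cong (λ u → cong₂ _+_ (∑-*ˡ ⟦ u == x ⟧ (λ v → ⟦ valid u v ⟧)) (∑-δ x (λ v → ⟦ valid u v ⟧))) ⟩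
      ∑ (λ u → ⟦ u == x ⟧ * # (λ v → valid u v) + ⟦ valid u x ⟧)
        ≡⟨ ∑-+ (λ u → ⟦ u == x ⟧ * # (λ v → valid u v)) (λ u → ⟦ valid u x ⟧) ⟩
      ∑ (λ u → ⟦ u == x ⟧ * # (λ v → valid u v)) + # (λ u → valid u x)
        ≡⟨ cong (_+ # (λ u → valid u x)) (∑-δ x (λ u → # (λ v → valid u v))) ⟩
      # (λ v → valid x v) + # (λ v → valid v x)
        ≡⟨ ∑-+ (λ v → ⟦ valid x v ⟧) (λ v → ⟦ valid v x ⟧) ⟨
      ∑ (λ v → ⟦ valid x v ⟧ + ⟦ valid v x ⟧)
        ≤⟨ ∑-mono one-way ⟩
      # (λ v → adj G x v)
        ≤⟨ degree≤ x ⟩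
      maxDegree G ∎
      where
      open ≤-Reasoning
      split : ∀ b u v → ⟦ b ∧ ((x == u) ∨ (x == v)) ⟧ ≤ ⟦ u == x ⟧ * ⟦ b ⟧ + ⟦ v == x ⟧ * ⟦ b ⟧
      split false u v = z≤n
      split true u v rewrite ==-sym u x | ==-sym v x | *-identityʳ ⟦ x == u ⟧ | *-identityʳ ⟦ x == v ⟧ = ⟦∨⟧≤ (x == u) (x == v)
      one-way : ∀ v → ⟦ valid x v ⟧ + ⟦ valid v x ⟧ ≤ ⟦ adj G x v ⟧
      one-way v rewrite Graph.sym G v x with toℕ x <ᵇ toℕ v in lt | toℕ v <ᵇ toℕ x in gt
      ... | true  | true  = ⊥-elim (<-asym (<ᵇ-true⁻ {toℕ x} lt) (<ᵇ-true⁻ {toℕ v} gt))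
      ... | true  | false = ≤-reflexive (+-identityʳ _)
      ... | false | true  = ≤-refl
      ... | false | false = z≤n

    module _ {q : ℕ} (C : EdgeCorrespondence G q) where

      when : ∀ {P A : Set} → Dec P → Maybe A → Maybe A
      when (yes _) x = x
      when (no _)  x = nothing

      matched : Maybe (Edge G) → Maybe (Edge G) → Fin q → Maybe (Fin q)
      matched (just e) (just f) c = when (incident? e f) (first (λ c′ → M C e f c c′))
      matched (just e) nothing  c = nothing
      matched nothing  _        c = nothing

      Matched : Maybe (Edge G) → Maybe (Edge G) → Fin q → Fin q → Set
      Matched x y c c′ = Σ (Edge G) λ e → Σ (Edge G) λ f → x ≡ just e × y ≡ just f × Incident e f × M C e f c c′ ≡ true

      matched-elim : ∀ x y {c c′} → matched x y c ≡ just c′ → Matched x y c c′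
      matched-elim (just e) (just f) {c} {c′} p = go (incident? e f) p
        where
        go : (dec : Dec (Incident e f)) → when dec (first (λ c′ → M C e f c c′)) ≡ just c′ → Matched (just e) (just f) c c′
        go (yes inc) p = e , f , refl , refl , inc , first-sound (λ c′ → M C e f c c′) p

      matched-intro : ∀ e f {c c′} → Incident e f → M C e f c c′ ≡ true → matched (just e) (just f) c ≡ just c′
      matched-intro e f {c} {c′} inc m = go (incident? e f)
        where
        go : (dec : Dec (Incident e f)) → when dec (first (λ c′ → M C e f c c′)) ≡ just c′
        go (no ¬inc) = ⊥-elim (¬inc inc)
        go (yes _) = let b , p = first-complete (λ c′ → M C e f c c′) c′ m in
          trans p (cong just (matchingˡ C e f inc c b c′ (first-sound (λ c′ → M C e f c c′) p) m))

      conflict : Conflict frame q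
      conflict = record
        { match        = λ i j → matched (edgeOf i) (edgeOf j)
        ; match-sym    = symm
        ; match-irrefl = irr
        ; match-at     = shared
        }
        where
        symm : ∀ i j c c′ → matched (edgeOf i) (edgeOf j) c ≡ just c′ → matched (edgeOf j) (edgeOf i) c′ ≡ just c
        symm i j c c′ p with e , f , ei , fj , inc , m ← matched-elim (edgeOf i) (edgeOf j) p =
          trans (cong₂ (λ x y → matched x y c′) fj ei)
            (matched-intro f e (incident-sym {e} {f} inc) (trans (reversal C e f inc c c′) m))
        irr : ∀ i c → matched (edgeOf i) (edgeOf i) c ≡ nothing
        irr i c with matched (edgeOf i) (edgeOf i) c in p
        ... | nothing = refl
        ... | just c′ with e , f , ei , fi , (distinct , _) , m ← matched-elim (edgeOf i) (edgeOf i) p =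
          ⊥-elim (distinct (cong lo e≡f , cong hi e≡f))
          where
          e≡f : e ≡ f
          e≡f = just-injective (trans (sym ei) fi)
        at-left : ∀ i {e} → edgeOf i ≡ just e → at (lo e) i ≡ true
        at-left i {e} p = let v , l , _ = edgeOf-ends i p in
          ∧-true v (∨-trueˡ (trans (cong (_== left i) l) (==-refl (left i))))
        at-right : ∀ i {e} → edgeOf i ≡ just e → at (hi e) i ≡ true
        at-right i {e} p = let v , _ , h = edgeOf-ends i p in
          ∧-true v (∨-trueʳ {hi e == left i} (trans (cong (_== right i) h) (==-refl (right i))))
        shared : ∀ i j c c′ → matched (edgeOf i) (edgeOf j) c ≡ just c′ →
                 Σ (Fin N) λ v → at v i ≡ true × at v j ≡ true
        shared i j c c′ p with matched-elim (edgeOf i) (edgeOf j) p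
        ... | e , f , ei , fj , (_ , inj₁ s) , m = lo f , subst (λ v → at v i ≡ true) s (at-left i ei) , at-left j fj
        ... | e , f , ei , fj , (_ , inj₂ (inj₁ s)) , m = hi f , subst (λ v → at v i ≡ true) s (at-left i ei) , at-right j fj
        ... | e , f , ei , fj , (_ , inj₂ (inj₂ (inj₁ s))) , m = lo f , subst (λ v → at v i ≡ true) s (at-right i ei) , at-left j fj
        ... | e , f , ei , fj , (_ , inj₂ (inj₂ (inj₂ s))) , m = hi f , subst (λ v → at v i ≡ true) s (at-right i ei) , at-right j fj

      conflict-bound : ∀ {d} → maxDegree G ≤ d → Conflict.ColourDegreeBound conflict d
      conflict-bound le v e c _ = ≤-trans (∑-mono (λ f → ⟦⟧-mono (∧-trueˡ {at v f}))) (≤-trans (frame-degree v) le)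

      transfer : Conflict.Colouring conflict → Σ (Edge G → Fin q) (IsCorrespondenceColouring C)
      transfer (σ , proper) = σ ∘ item , λ e f inc m → proper (item e) (item f)
        (trans (cong₂ (λ x y → matched x y (σ (item e))) (edgeOf-item e) (edgeOf-item f)) (matched-intro e f inc m))

  -- Lower bound

    star : ∀ v w → adj G v w ≡ true → Σ (Edge G) λ e → (lo e ≡ v × hi e ≡ w) ⊎ (lo e ≡ w × hi e ≡ v)
    star v w p with <-cmp (toℕ v) (toℕ w)
    ... | tri< lt _ _ = edge v w lt p , inj₁ (refl , refl)
    ... | tri> _ _ gt = edge w v gt (trans (Graph.sym G w v) p) , inj₂ (refl , refl)
    ... | tri≈ _ eq _ = ⊥-elim (true≢false p (trans (cong (adj G v) (sym (toℕ-injective eq))) (irrefl G v)))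

    star-incident : ∀ v w w′ (p : adj G v w ≡ true) (p′ : adj G v w′ ≡ true) → w ≢ w′ →
                    Incident (proj₁ (star v w p)) (proj₁ (star v w′ p′))
    star-incident v w w′ p p′ w≢w′ = go (proj₁ (star v w p)) (proj₁ (star v w′ p′)) (proj₂ (star v w p)) (proj₂ (star v w′ p′))
      where
      v≢w : v ≢ w
      v≢w refl = true≢false p (irrefl G v)
      go : ∀ e f → (lo e ≡ v × hi e ≡ w) ⊎ (lo e ≡ w × hi e ≡ v) → (lo f ≡ v × hi f ≡ w′) ⊎ (lo f ≡ w′ × hi f ≡ v) → Incident e f
      go e f (inj₁ (a , b)) (inj₁ (c , d)) = (λ (x , y) → w≢w′ (trans (sym b) (trans y d))) , inj₁ (trans a (sym c))
      go e f (inj₁ (a , b)) (inj₂ (c , d)) = (λ (x , y) → v≢w (trans (sym d) (trans (sym y) b))) , inj₂ (inj₁ (trans a (sym d)))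
      go e f (inj₂ (a , b)) (inj₁ (c , d)) = (λ (x , y) → v≢w (trans (sym c) (trans (sym x) a))) , inj₂ (inj₂ (inj₁ (trans b (sym c))))
      go e f (inj₂ (a , b)) (inj₂ (c , d)) = (λ (x , y) → w≢w′ (trans (sym a) (trans x c))) , inj₂ (inj₂ (inj₂ (trans b (sym d))))

    -- With equal colours matched, the colourings are the ordinary proper edge colourings, and these
    -- need distinct colours on all edges at a vertex of maximum degree.
    equality : ∀ q → EdgeCorrespondence G q
    equality q = record
      { M         = λ e f a b → a == b
      ; matchingˡ = λ e f _ a b b′ p p′ → trans (sym (==⇒≡ {i = a} p)) (==⇒≡ {i = a} p′)
      ; matchingʳ = λ e f _ a a′ b p p′ → trans (==⇒≡ {j = b} p) (sym (==⇒≡ {j = b} p′))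
      ; reversal  = λ e f _ a b → ==-sym b a
      }

    maxDegree≤ : ∀ q → DPEdgeColourable G q → maxDegree G ≤ q
    maxDegree≤ q colourable with maxDegree G in eq
    ... | zero  = z≤n
    ... | suc Δ = subst (_≤ q) (trans (proj₂ top) (trans (sym maxDegree≡) eq)) (≤-trans (≤-reflexive (degree≡ v)) (begin
      # (λ w → adj G v w)
        ≤⟨ ∑-mono (λ w → ⟦⟧≤ (λ p → ≤-trans (≡true⇒1≤ (used-intro w p)) (term≤∑ (λ c → ⟦ used w c ⟧) (σ (proj₁ (star v w p)))))) ⟩
      ∑ (λ w → # (λ c → used w c))
        ≡⟨ ∑-swap (λ w c → ⟦ used w c ⟧) ⟩
      ∑ (λ c → # (λ w → used w c))
        ≤⟨ ∑-≤const 1 (λ c → ∑-atMostOne (λ w → used w c) (unique c)) ⟩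
      q * 1
        ≡⟨ *-identityʳ q ⟩
      q ∎))
      where
      open ≤-Reasoning
      top : Σ (Fin N) λ v → degree G v ≡ foldr _⊔_ 0 (tabulate (degree G))
      top = max-attained (degree G) (subst (0 <_) (trans (sym eq) maxDegree≡) (s≤s z≤n))
      v = proj₁ top
      σ = proj₁ (colourable (equality q))
      used′ : ∀ w b → adj G v w ≡ b → Fin q → Bool
      used′ w true  p c = σ (proj₁ (star v w p)) == c
      used′ w false p c = false
      used : Fin N → Fin q → Bool
      used w c = used′ w (adj G v w) refl c
      used-intro : ∀ w (p : adj G v w ≡ true) → used w (σ (proj₁ (star v w p))) ≡ true
      used-intro w p = go (adj G v w) refl
        where
        go : ∀ b (e : adj G v w ≡ b) → used′ w b e (σ (proj₁ (star v w p))) ≡ true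
        go true e rewrite Decidable⇒UIP.≡-irrelevant _≟B_ e p = ==-refl (σ (proj₁ (star v w p)))
        go false e = ⊥-elim (true≢false p e)
      used-elim : ∀ w c → used w c ≡ true → Σ (adj G v w ≡ true) λ p → σ (proj₁ (star v w p)) ≡ c
      used-elim w c = go (adj G v w) refl
        where
        go : ∀ b (e : adj G v w ≡ b) → used′ w b e c ≡ true → Σ (adj G v w ≡ true) λ p → σ (proj₁ (star v w p)) ≡ c
        go true e u = e , ==⇒≡ {i = σ (proj₁ (star v w e))} u
      unique : ∀ c w w′ → used w c ≡ true → used w′ c ≡ true → w ≡ w′
      unique c w w′ u u′ with used-elim w c u | used-elim w′ c u′
      ... | p , s | p′ , s′ = decidable-stable (w ≟F w′) λ w≢w′ →
        proj₂ (colourable (equality q)) (proj₁ (star v w p)) (proj₁ (star v w′ p′)) (star-incident v w w′ p p′ w≢w′)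
          (trans (cong₂ _==_ s s′) (==-refl c))

  -- Deciding colourability

  -- Exhaustive search closed under finite vectors. Correspondences and colourings are functions on
  -- edges, so they are searched through tables indexed by items; a table need only agree with its
  -- function at the edges.
  Searchable : Set → Set₁
  Searchable A = (P : A → Set) → (∀ a → Dec (P a)) → Dec (Σ A P)

  ∀-dec : ∀ {A} → Searchable A → (P : A → Set) → (∀ a → Dec (P a)) → Dec (∀ a → P a)
  ∀-dec search P dec with search (¬_ ∘ P) (¬? ∘ dec)
  ... | yes (a , ¬p) = no λ all → ¬p (all a)
  ... | no none      = yes λ a → decidable-stable (dec a) (λ ¬p → none (a , ¬p))

  search-Fin : ∀ n → Searchable (Fin n)
  search-Fin n P dec = any? dec

  search-Bool : Searchable Bool
  search-Bool P dec with dec true | dec false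
  ... | yes p | _     = yes (true , p)
  ... | no _  | yes p = yes (false , p)
  ... | no ¬t | no ¬f = no λ { (true , p) → ¬t p ; (false , p) → ¬f p }

  search-Vec : ∀ {A} → Searchable A → ∀ n → Searchable (Vec A n)
  search-Vec search zero P dec with dec []
  ... | yes p = yes ([] , p)
  ... | no ¬p = no λ { ([] , p) → ¬p p }
  search-Vec search (suc n) P dec with search (λ a → Σ (Vec _ n) λ as → P (a ∷ as)) (λ a → search-Vec search n _ (λ as → dec (a ∷ as)))
  ... | yes (a , as , p) = yes (a ∷ as , p)
  ... | no none          = no λ { (a ∷ as , p) → none (a , as , p) }

  module _ (G : Graph) where

    private
      N = n G

    search-Edge : Searchable (Edge G)
    search-Edge P dec = result (any? (λ i → holds? (edgeOf G i)))
      where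
      Holds : Maybe (Edge G) → Set
      Holds nothing  = ⊥
      Holds (just e) = P e
      holds? : ∀ x → Dec (Holds x)
      holds? nothing  = no λ ()
      holds? (just e) = dec e
      extract : ∀ x → Holds x → Σ (Edge G) P
      extract (just e) p = e , p
      result : Dec (Σ (Fin (N * N)) (λ i → Holds (edgeOf G i))) → Dec (Σ (Edge G) P)
      result (yes (i , h)) = yes (extract (edgeOf G i) h)
      result (no none)     = no λ (e , p) → none (item G e , subst Holds (sym (edgeOf-item G e)) p)

    module _ (q : ℕ) where

      Relation : Set
      Relation = Edge G → Edge G → Fin (suc q) → Fin (suc q) → Bool

      Lawful : Relation → Set
      Lawful m = ∀ e f → Incident e f →
        (∀ a b b′ → m e f a b ≡ true → m e f a b′ ≡ true → b ≡ b′) ×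
        (∀ a a′ b → m e f a b ≡ true → m e f a′ b ≡ true → a ≡ a′) ×
        (∀ a b → m f e b a ≡ m e f a b)

      Proper : Relation → (Edge G → Fin (suc q)) → Set
      Proper m σ = ∀ e f → Incident e f → ¬ (m e f (σ e) (σ f) ≡ true)

      ∀Edge : (P : Edge G → Set) → (∀ e → Dec (P e)) → Dec (∀ e → P e)
      ∀Edge = ∀-dec search-Edge

      ∀Fin : (P : Fin (suc q) → Set) → (∀ a → Dec (P a)) → Dec (∀ a → P a)
      ∀Fin = ∀-dec (search-Fin (suc q))

      lawful? : ∀ m → Dec (Lawful m)
      lawful? m = ∀Edge _ λ e → ∀Edge _ λ f → incident? G e f →-dec
        ((∀Fin _ λ a → ∀Fin _ λ b → ∀Fin _ λ b′ → (m e f a b ≟B true) →-dec ((m e f a b′ ≟B true) →-dec (b ≟F b′))) ×-dec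
        ((∀Fin _ λ a → ∀Fin _ λ a′ → ∀Fin _ λ b → (m e f a b ≟B true) →-dec ((m e f a′ b ≟B true) →-dec (a ≟F a′))) ×-dec
        (∀Fin _ λ a → ∀Fin _ λ b → m f e b a ≟B m e f a b)))

      proper? : ∀ m σ → Dec (Proper m σ)
      proper? m σ = ∀Edge _ λ e → ∀Edge _ λ f → incident? G e f →-dec ¬? (m e f (σ e) (σ f) ≟B true)

      Code : Set
      Code = Vec (Vec (Vec (Vec Bool (suc q)) (suc q)) (N * N)) (N * N)

      relation : Code → Relation
      relation code e f a b = lookup (lookup (lookup (lookup code (item G e)) (item G f)) a) b

      colours : Vec (Fin (suc q)) (N * N) → Edge G → Fin (suc q)
      colours s e = lookup s (item G e)

      Bad : Code → Set
      Bad code = Lawful (relation code) × ¬ Σ (Vec (Fin (suc q)) (N * N)) (Proper (relation code) ∘ colours)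

      bad? : ∀ code → Dec (Bad code)
      bad? code = lawful? (relation code) ×-dec
        ¬? (search-Vec (search-Fin (suc q)) (N * N) _ (λ s → proper? (relation code) (colours s)))

      -- Table entries at items that are not edges need some default colour, hence the palette of
      -- size `suc q`.
      colourOf : (Edge G → Fin (suc q)) → Maybe (Edge G) → Fin (suc q)
      colourOf σ (just e) = σ e
      colourOf σ nothing  = zero

      encodeColouring : (Edge G → Fin (suc q)) → Vec (Fin (suc q)) (N * N)
      encodeColouring σ = tabulateV (λ i → colourOf σ (edgeOf G i))

      colours-encode : ∀ σ e → colours (encodeColouring σ) e ≡ σ e
      colours-encode σ e = trans (lookup∘tabulateV _ (item G e)) (cong (colourOf σ) (edgeOf-item G e))

      entryOf : Relation → Maybe (Edge G) → Maybe (Edge G) → Fin (suc q) → Fin (suc q) → Bool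
      entryOf m (just e) (just f) a b = m e f a b
      entryOf m _        _        a b = false

      encodeRelation : Relation → Code
      encodeRelation m = tabulateV (λ i → tabulateV (λ j → tabulateV (λ a → tabulateV (entryOf m (edgeOf G i) (edgeOf G j) a))))

      relation-encode : ∀ m e f a b → relation (encodeRelation m) e f a b ≡ m e f a b
      relation-encode m e f a b =
        trans (cong (λ v → lookup (lookup (lookup v (item G f)) a) b) (lookup∘tabulateV (λ i → tabulateV (λ j → tabulateV (λ a → tabulateV (entryOf m (edgeOf G i) (edgeOf G j) a)))) (item G e)))
        (trans (cong (λ v → lookup (lookup v a) b) (lookup∘tabulateV (λ j → tabulateV (λ a → tabulateV (entryOf m (edgeOf G (item G e)) (edgeOf G j) a))) (item G f)))
        (trans (cong (λ v → lookup v b) (lookup∘tabulateV (λ a → tabulateV (entryOf m (edgeOf G (item G e)) (edgeOf G (item G f)) a)) a))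
        (trans (lookup∘tabulateV (entryOf m (edgeOf G (item G e)) (edgeOf G (item G f)) a) b)
        (cong₂ (λ x y → entryOf m x y a b) (edgeOf-item G e) (edgeOf-item G f)))))

      colourable? : Dec (DPEdgeColourable G (suc q))
      colourable? with search-Vec (search-Vec (search-Vec (search-Vec search-Bool (suc q)) (suc q)) (N * N)) (N * N) Bad bad?
      ... | yes (code , lawful , none) = no λ colourable →
        let σ , proper = colourable (record
              { M         = relation code
              ; matchingˡ = λ e f inc → proj₁ (lawful e f inc)
              ; matchingʳ = λ e f inc → proj₁ (proj₂ (lawful e f inc))
              ; reversal  = λ e f inc → proj₂ (proj₂ (lawful e f inc)) })
        in none (encodeColouring σ , λ e f inc →
             subst₂ (λ a b → ¬ (relation code e f a b ≡ true)) (sym (colours-encode σ e)) (sym (colours-encode σ f)) (proper e f inc))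
      ... | no none = yes λ C → colouring C
        where
        module _ (C : EdgeCorrespondence G (suc q)) where
          code = encodeRelation (M C)
          eq : ∀ e f a b → relation code e f a b ≡ M C e f a b
          eq = relation-encode (M C)
          lawful : Lawful (relation code)
          lawful e f inc =
            (λ a b b′ p p′ → matchingˡ C e f inc a b b′ (trans (sym (eq e f a b)) p) (trans (sym (eq e f a b′)) p′)) ,
            (λ a a′ b p p′ → matchingʳ C e f inc a a′ b (trans (sym (eq e f a b)) p) (trans (sym (eq e f a′ b)) p′)) ,
            (λ a b → trans (eq f e b a) (trans (reversal C e f inc a b) (sym (eq e f a b))))
          colouring : Σ (Edge G → Fin (suc q)) (IsCorrespondenceColouring C)
          colouring =
            let s , proper = decidable-stable (search-Vec (search-Fin (suc q)) (N * N) _ (λ s → proper? (relation code) (colours s)))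
                               (λ ¬s → none (code , lawful , ¬s))
            in colours s , λ e f inc p → proper e f inc (trans (eq e f _ _) p)

  least : (P : ℕ → Set) → (∀ q → Dec (P q)) → ∀ k → P k →
          Σ ℕ λ χ → χ ≤ k × P χ × (∀ q → q < χ → ¬ P q)
  least P dec k p = go (<-wellFounded k) p
    where
    go : ∀ {k} → Acc _<_ k → P k → Σ ℕ λ χ → χ ≤ k × P χ × (∀ q → q < χ → ¬ P q)
    go {k} (acc rec) p with anyUpTo? dec k
    ... | no none = k , ≤-refl , p , λ q lt pq → none (q , lt , pq)
    ... | yes (q , lt , pq) with χ , χ≤q , rest ← go (rec lt) pq = χ , ≤-trans χ≤q (<⇒≤ lt) , rest

  -- With h ≥ 1 / ε the list size B q stays below (1 + 1 / h) Δ for q just above Δ / r.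
  module Bound (h : ℕ) {{_ : NonZero h}} where
    H l L³ r B : ℕ
    H  = suc (2 * h)
    l  = 32 * (32 * H)
    L³ = suc l * suc l * suc l
    r  = 2 * h * L³
    B  = r + L³

    -- The initial slack `b = L³` is the fraction `1 / H` of `B`. Scaling by `L³` is what makes `B`
    -- large enough for `drift`.
    solution : Solvable B r
    solution = solvable H l refl B (m≤n+m L³ r) r L³ refl (≤-reflexive (+-comm r L³))

    instance
      r≢0 : NonZero r
      r≢0 = m*n≢0 (2 * h) L³ {{m*n≢0 2 h}}

    -- `H * r` absorbs the rounding of `Δ / r` in `size`, `r * proj₁ (solution r)` makes the scale
    -- `q` large enough, and the successor makes the maximum degree positive, which rules out zero
    -- colours in `dec`.
    Δ₀ : ℕ
    Δ₀ = suc (H * r + r * proj₁ (solution r))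

    -- The allowed excess `Δ / h` is spent in two halves: one on lists longer than `r * q` by the
    -- factor `1 + 1 / (2 * h)`, one on rounding `Δ / r` up.
    upper : ∀ G → Δ₀ ≤ maxDegree G → Σ ℕ λ k → DPEdgeColourable G k × h * k ≤ suc h * maxDegree G
    upper G Δ₀≤Δ = B * q , colourable , size
      where
      open ≤-Reasoning
      Δ = maxDegree G
      q = suc (Δ / r)
      Q≤q : proj₁ (solution r) ≤ q
      Q≤q = ≤-trans (≤-trans (≤-reflexive (sym (trans (cong (_/ r) (*-comm r (proj₁ (solution r)))) (m*n/n≡m _ r))))
              (/-monoˡ-≤ r (≤-trans (≤-trans (m≤n+m _ (H * r)) (n≤1+n _)) Δ₀≤Δ))) (n≤1+n _)
      Δ≤rq : Δ ≤ r * q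
      Δ≤rq = begin
        Δ ≡⟨ m≡m%n+[m/n]*n Δ r ⟩
        Δ % r + Δ / r * r ≤⟨ +-monoˡ-≤ (Δ / r * r) (<⇒≤ (m%n<n Δ r)) ⟩
        q * r ≡⟨ *-comm q r ⟩
        r * q ∎
      colourable : DPEdgeColourable G (B * q)
      colourable C = transfer G C (proj₂ (solution r) q Q≤q (frame-degree G) Δ≤rq (conflict G C) (conflict-bound G C Δ≤rq))
      size : h * (B * q) ≤ suc h * Δ
      size = *-cancelˡ-≤ 2 (begin
        2 * (h * (B * q)) ≡⟨ reg₁ h L³ q ⟩
        H * (q * r) ≤⟨ *-monoʳ-≤ H (+-monoʳ-≤ r (m/n*n≤m Δ r)) ⟩
        H * (r + Δ) ≡⟨ *-distribˡ-+ H r Δ ⟩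
        H * r + H * Δ ≤⟨ +-monoˡ-≤ (H * Δ) (≤-trans (≤-trans (m≤m+n (H * r) _) (n≤1+n _)) Δ₀≤Δ) ⟩
        Δ + H * Δ ≡⟨ reg₂ h Δ ⟩
        2 * (suc h * Δ) ∎)
        where
        reg₁ : ∀ h c q → 2 * (h * ((2 * h * c + c) * q)) ≡ (1 + 2 * h) * (q * (2 * h * c))
        reg₁ = solve-∀
        reg₂ : ∀ h Δ → Δ + (1 + 2 * h) * Δ ≡ 2 * ((1 + h) * Δ)
        reg₂ = solve-∀

    number : ∀ G → Δ₀ ≤ maxDegree G → Σ ℕ λ χ → IsEdgeCorrespondenceNumber G χ ×
             maxDegree G ≤ χ × h * χ ≤ suc h * maxDegree G
    number G Δ₀≤Δ = let k , colourable , size = upper G Δ₀≤Δ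
                        χ , χ≤k , ok , minimal = least (DPEdgeColourable G) dec k colourable
                    in χ , (ok , minimal) , maxDegree≤ G χ ok , ≤-trans (*-monoʳ-≤ h χ≤k) size
      where
      dec : ∀ q → Dec (DPEdgeColourable G q)
      dec zero    = no λ colourable → 1+n≰n (≤-trans (≤-trans (s≤s z≤n) Δ₀≤Δ) (maxDegree≤ G 0 colourable))
      dec (suc q) = colourable? G q

  -- The bound over the rationals

  open import Data.Integer using (+_; +[1+_]; -[1+_]; +≤+; +<+)

  positive⇒1≤numerator : ∀ ε → ℚ.0ℚ ℚ.< ε → Σ ℕ λ p → ℚ.↥ ε ≡ + suc p
  positive⇒1≤numerator (ℚ.mkℚ +[1+ p ] _ _) _ = p , refl
  positive⇒1≤numerator (ℚ.mkℚ (+ 0) _ _) (ℚ.*<* (+<+ ()))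
  positive⇒1≤numerator (ℚ.mkℚ -[1+ _ ] _ _) (ℚ.*<* ())

  -- A positive `ε` has numerator at least 1, so with `h` its denominator `1 / h ≤ ε`; after
  -- clearing denominators only this comparison remains.
  ratio-bound : ∀ ε → ℚ.0ℚ ℚ.< ε → ∀ χ Δ → ℚ.↧ₙ ε * χ ≤ suc (ℚ.↧ₙ ε) * Δ →
                (+ χ ℚ./ 1) ℚ.≤ ((ℚ.1ℚ ℚ.+ ε) ℚ.* (+ Δ ℚ./ 1))
  ratio-bound ε@(ℚ.mkℚ _ d-1 _) ε>0 χ Δ le with p , refl ← positive⇒1≤numerator ε ε>0 =
    ℚ.toℚᵘ-cancel-≤ (ℚᵘ.≤-respˡ-≃ (ℚᵘ.≃-sym (ℚ.toℚᵘ-fromℚᵘ (ℚᵘ.mkℚᵘ (+ χ) 0)))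
      (ℚᵘ.≤-respʳ-≃ (ℚᵘ.≃-sym rhs) (ℚᵘ.*≤* (subst₂ ℤ._≤_ (ℤ.pos-* χ (1 * h * 1)) eq (+≤+ ineq)))))
    where
    h = suc d-1
    rhs : ℚ.toℚᵘ ((ℚ.1ℚ ℚ.+ ε) ℚ.* (+ Δ ℚ./ 1)) ℚᵘ.≃ (ℚᵘ.1ℚᵘ ℚᵘ.+ ℚᵘ.mkℚᵘ (+ suc p) d-1) ℚᵘ.* ℚᵘ.mkℚᵘ (+ Δ) 0
    rhs = ℚᵘ.≃-trans (ℚ.toℚᵘ-homo-* (ℚ.1ℚ ℚ.+ ε) (+ Δ ℚ./ 1))
      (ℚᵘ.*-cong (ℚ.toℚᵘ-homo-+ ℚ.1ℚ ε) (ℚ.toℚᵘ-fromℚᵘ (ℚᵘ.mkℚᵘ (+ Δ) 0)))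
    eq : + ((1 * h + suc p * 1) * Δ * 1) ≡ (+ 1 ℤ.* + h ℤ.+ + suc p ℤ.* + 1) ℤ.* + Δ ℤ.* + 1
    eq = trans (ℤ.pos-* ((1 * h + suc p * 1) * Δ) 1) (cong (ℤ._* + 1) (trans (ℤ.pos-* (1 * h + suc p * 1) Δ)
           (cong (ℤ._* + Δ) (trans (ℤ.pos-+ (1 * h) (suc p * 1)) (cong₂ ℤ._+_ (ℤ.pos-* 1 h) (ℤ.pos-* (suc p) 1))))))
    ineq : χ * (1 * h * 1) ≤ (1 * h + suc p * 1) * Δ * 1
    ineq = begin
      χ * (1 * h * 1) ≡⟨ reg₁ χ h ⟩
      h * χ ≤⟨ le ⟩
      suc h * Δ ≤⟨ *-monoˡ-≤ Δ (+-monoˡ-≤ h (s≤s (z≤n {p}))) ⟩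
      (suc p + h) * Δ ≡⟨ reg₂ p h Δ ⟩
      (1 * h + suc p * 1) * Δ * 1 ∎
      where
      open ≤-Reasoning
      reg₁ : ∀ χ h → χ * (1 * h * 1) ≡ h * χ
      reg₁ = solve-∀
      reg₂ : ∀ p h Δ → (1 + p + h) * Δ ≡ (1 * h + (1 + p) * 1) * Δ * 1
      reg₂ = solve-∀

  asymptotics : (ε : ℚ.ℚ) → ℚ.0ℚ ℚ.< ε → Σ ℕ λ Δ₀ → (G : Graph) → Δ₀ ≤ maxDegree G →
    Σ ℕ λ χ → IsEdgeCorrespondenceNumber G χ ×
      (maxDegree G ≤ χ × (+ χ ℚ./ 1) ℚ.≤ ((ℚ.1ℚ ℚ.+ ε) ℚ.* (+ maxDegree G ℚ./ 1)))
  asymptotics ε ε>0 = Bound.Δ₀ (ℚ.↧ₙ ε) , λ G large →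
    let χ , isNumber , lower , upper = Bound.number (ℚ.↧ₙ ε) G large
    in χ , isNumber , lower , ratio-bound ε ε>0 χ (maxDegree G) upper

open import Defs
open import Data.Nat using (ℕ; _≤_)
open import Data.Product using (Σ; _×_)
open import Data.Integer using (+_)
open import Data.Rational using (ℚ; 0ℚ; 1ℚ; _/_; _+_; _*_) renaming (_<_ to _<ℚ_; _≤_ to _≤ℚ_)

theorem1 : (ε : ℚ) → 0ℚ <ℚ ε →
    Σ ℕ (λ Δ₀ → (G : Graph) → Δ₀ ≤ maxDegree G →
    Σ ℕ (λ χ → IsEdgeCorrespondenceNumber G χ ×
    (maxDegree G ≤ χ ×
    (+ χ / 1) ≤ℚ ((1ℚ + ε) * (+ maxDegree G / 1)))))
theorem1 = EdgeCorrespondences.asymptotics
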